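{- Let $K$ be a perfect field and let $f$ be an irreducible polynomial of degree $n>2$ over $K$ with Galois group $G=\mathrm{Gal}(K_f/K)$, where $K_f$ is the splitting field of $f$. Let $k$ be a positive integer with $k<n$. Then $G$ is $k$-transitive (on the roots of $f$) if and only if all of the following hold: (1) Every minimal generating set for $f$ over $K$ has cardinality $\geq k$. (2) Every subset $D$ of the set of roots of $f$ of cardinality $\leq k$ satisfies $\delta\notin K(D\setminus\{\delta\})$ for all $\delta\in D$. Also, every such $D$ is contained in some minimal generating set $B$ for $f$ over $K$. (3) If $k\geq 2$, then $r_K(f)=1$ and $s_K(f)=n$. (4) The length of any cluster tower of $f$ is $\geq k$, and the first $k$ terms in its degree sequence are ${}^nP_1,{}^nP_2,\dots,{}^nP_k$. Thus there are at least ${}^nP_{k-1}$ many distinct cluster towers.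
   Context: Fix an algebraic closure $\bar K$ of $K$; $R\subset\bar K$ is the set of roots of $f$, and $K(B)$ is the field generated over $K$ by $B$. Here ${}^nP_j=n(n-1)\cdots(n-j+1)$, with ${}^nP_0=1$. $k$-transitivity: $G$ is $k$-transitive if for any two ordered $k$-tuples of distinct roots $(\alpha_1,\dots,\alpha_k)$ and $(\beta_1,\dots,\beta_k)$ of $f$ there is $\sigma\in G$ with $\sigma(\alpha_i)=\beta_i$ for all $1\le i\le k$. Minimal generating set: $B\subset R$ is a minimal generating set for $f$ over $K$ if $K(B)=K_f$ and $K(A)\neq K_f$ for every $A\subsetneq B$. Clusters: roots $\alpha,\beta\in R$ are equivalent if $K(\alpha)=K(\beta)$ (equality of subfields of $\bar K$); the equivalence classes are the root clusters of $f$. All clusters have the same cardinality, denoted $r_K(f)$, and the number of clusters is $s_K(f)$. Cluster towers: for an ordering $(\beta_1,\dots,\beta_s)$, $s=s_K(f)$, of a complete set of representatives of the clusters, the chain $K\subseteq K(\beta_1)\subseteq K(\beta_1,\beta_2)\subseteq\dots\subseteq K(\beta_1,\dots,\beta_s)=K_f$ is a cluster tower of $f$. Its length is the number of strict inclusions. Its degree sequence is $([L_1:K],[L_2:K],\dots,[K_f:K])$, where $K\subsetneq L_1\subsetneq L_2\subsetneq\dots\subsetneq K_f$ are the distinct fields in the tower. Two cluster towers are equal if their fields are equal at each step, and distinct otherwise. -}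

module Defs where

open import Level using (Level; _⊔_; suc)
open import Algebra.Apartness.Bundles using (HeytingField; HeytingCommutativeRing)
open import Algebra.Bundles using (CommutativeRing)
open import Algebra.Bundles.Raw using (RawRing)
import Algebra.Definitions.RawMonoid
import Algebra.Definitions.RawSemiring
open import Algebra.Morphism.Bundles using (RingHomomorphism)
open import Algebra.Morphism.Structures using (IsRingIsomorphism)
open import Data.Fin.Base using (Fin)
open import Data.List.Base using (List; []; _∷_; [_]; map; foldr; length; tabulate; inits)
import Data.List.Membership.Setoid
open import Data.List.Relation.Binary.Pointwise.Base using (Pointwise)
import Data.List.Relation.Binary.Pointwise
open import Data.Nat.Base as ℕ using (ℕ; zero)
open import Data.Product.Base using (Σ; ∃; ∃₂; _×_; _,_; proj₁; proj₂)
open import Function.Bundles using (Bijection; Injection)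
open import Relation.Binary.Bundles using (Setoid)
open import Relation.Binary.Definitions using (_Respects_)
import Relation.Binary.Construct.On as On
open import Relation.Binary.PropositionalEquality using (_≡_)
import Relation.Binary.PropositionalEquality.Properties as ≡
open import Relation.Nullary.Negation.Core using (¬_)
open import Relation.Unary using (Pred; _∈_; _∉_; _⊆_; _⊂_; _≐_)
open import Relation.Unary.Relation.Binary.Equality using (≐-setoid)

private
  variable
    a ℓ c ℓ₁ ℓ₂ c′ ℓ₁′ ℓ₂′ : Level

HasCardinality : Setoid a ℓ → ℕ → Set (a ⊔ ℓ)
HasCardinality S m = Bijection (≡.setoid (Fin m)) S

HasAtLeast : ℕ → Setoid a ℓ → Set (a ⊔ ℓ)
HasAtLeast m S = Injection (≡.setoid (Fin m)) S

-- Under excluded middle the apartness `_#_` of a HeytingField coincides with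
-- `_≉_`, so Heyting fields are then exactly the classical fields (with 0 ≉ 1).

fieldRing : HeytingField c ℓ₁ ℓ₂ → CommutativeRing c ℓ₁
fieldRing K =
  HeytingCommutativeRing.commutativeRing (HeytingField.heytingCommutativeRing K)

-- Univariate polynomials as coefficient lists, constant term first.  Lists
-- differing by trailing zeros are identified by `_≈ₚ_`.

module Polynomial (R : CommutativeRing c ℓ) where
  open CommutativeRing R

  Poly : Set c
  Poly = List Carrier

  coeff : Poly → ℕ → Carrier
  coeff []      _          = 0#
  coeff (x ∷ _) zero       = x
  coeff (_ ∷ p) (ℕ.suc i)  = coeff p i

  infix 4 _≈ₚ_
  _≈ₚ_ : Poly → Poly → Set ℓ
  p ≈ₚ q = ∀ i → coeff p i ≈ coeff q i

  infixl 6 _+ₚ_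
  _+ₚ_ : Poly → Poly → Poly
  []      +ₚ q       = q
  (x ∷ p) +ₚ []      = x ∷ p
  (x ∷ p) +ₚ (y ∷ q) = (x + y) ∷ (p +ₚ q)

  infixl 7 _*ₚ_
  _*ₚ_ : Poly → Poly → Poly
  []      *ₚ q = []
  (x ∷ p) *ₚ q = map (x *_) q +ₚ (0# ∷ (p *ₚ q))

  rawRing-Poly : RawRing c ℓ
  rawRing-Poly = record
    { Carrier = Poly
    ; _≈_     = _≈ₚ_
    ; _+_     = _+ₚ_
    ; _*_     = _*ₚ_
    ; -_      = map (λ x → - x)
    ; 0#      = []
    ; 1#      = [ 1# ]
    }

  open Algebra.Definitions.RawSemiring (RawRing.rawSemiring rawRing-Poly) public
    using (Irreducible; Coprime)

  HasDegree : Poly → ℕ → Set ℓ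
  HasDegree p n = coeff p n ≉ 0# × (∀ i → n ℕ.< i → coeff p i ≈ 0#)

  eval : Poly → Carrier → Carrier
  eval p x = foldr (λ y acc → y + x * acc) 0# p

  -- (x + X p)′ = p + X p′
  derivative : Poly → Poly
  derivative []      = []
  derivative (_ ∷ p) = p +ₚ (0# ∷ derivative p)

  Separable : Poly → Set (c ⊔ ℓ)
  Separable p = Coprime p (derivative p)

IsPerfect : HeytingField c ℓ₁ ℓ₂ → Set (c ⊔ ℓ₁)
IsPerfect K = ∀ p → Irreducible p → Separable p
  where open Polynomial (fieldRing K)

record AlgebraicClosure (K : HeytingField c ℓ₁ ℓ₂) (c′ ℓ₁′ ℓ₂′ : Level)
       : Set (c ⊔ ℓ₁ ⊔ suc (c′ ⊔ ℓ₁′ ⊔ ℓ₂′)) where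
  field
    K̄ : HeytingField c′ ℓ₁′ ℓ₂′

  private
    module K  = CommutativeRing (fieldRing K)
    module K̄  = CommutativeRing (fieldRing K̄)
    module K[X] = Polynomial (fieldRing K)
    module K̄[X] = Polynomial (fieldRing K̄)

  field
    embedding : RingHomomorphism K.rawRing K̄.rawRing

  ι : K.Carrier → K̄.Carrier
  ι = RingHomomorphism.⟦_⟧ embedding

  evalAt : K[X].Poly → K̄.Carrier → K̄.Carrier
  evalAt p = K̄[X].eval (map ι p)

  field
    algebraic : ∀ x → ∃₂ λ p d → K[X].HasDegree p d × evalAt p x K̄.≈ K̄.0#
    algebraicallyClosed :
      ∀ p d → K̄[X].HasDegree p (ℕ.suc d) → ∃ λ x → K̄[X].eval p x K̄.≈ K̄.0#

module Adjunction {K : HeytingField c ℓ₁ ℓ₂}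
                  (C : AlgebraicClosure K c′ ℓ₁′ ℓ₂′) where
  open AlgebraicClosure C using (K̄; embedding; ι)
  open CommutativeRing (fieldRing K̄)
  private
    module K = CommutativeRing (fieldRing K)
    module ι = RingHomomorphism embedding

  -- K⟨ B ⟩ is K(B), the smallest subfield of K̄ containing K and B.
  data K⟨_⟩ {b : Level} (B : Pred Carrier b) : Pred Carrier (c ⊔ c′ ⊔ ℓ₁′ ⊔ b) where
    base : ∀ x → ι x ∈ K⟨ B ⟩
    gen  : ∀ {x} → x ∈ B → x ∈ K⟨ B ⟩
    add  : ∀ {x y} → x ∈ K⟨ B ⟩ → y ∈ K⟨ B ⟩ → x + y ∈ K⟨ B ⟩
    neg  : ∀ {x} → x ∈ K⟨ B ⟩ → - x ∈ K⟨ B ⟩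
    mul  : ∀ {x y} → x ∈ K⟨ B ⟩ → y ∈ K⟨ B ⟩ → x * y ∈ K⟨ B ⟩
    inv  : ∀ {x y} → x ∈ K⟨ B ⟩ → x * y ≈ 1# → y ∈ K⟨ B ⟩
    resp : ∀ {x y} → x ≈ y → x ∈ K⟨ B ⟩ → y ∈ K⟨ B ⟩

  rawRing-K⟨_⟩ : ∀ {b} → Pred Carrier b → RawRing (c ⊔ c′ ⊔ ℓ₁′ ⊔ b) ℓ₁′
  rawRing-K⟨ B ⟩ = record
    { Carrier = Σ Carrier K⟨ B ⟩
    ; _≈_     = λ x y → proj₁ x ≈ proj₁ y
    ; _+_     = λ (x , p) (y , q) → x + y , add p q
    ; _*_     = λ (x , p) (y , q) → x * y , mul p q
    ; -_      = λ (x , p) → - x , neg p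
    ; 0#      = 0# , resp ι.0#-homo (base K.0#)
    ; 1#      = 1# , resp ι.1#-homo (base K.1#)
    }

  -- Gal(K(B)/K), elementwise
  record Automorphism {b : Level} (B : Pred Carrier b)
         : Set (c ⊔ c′ ⊔ ℓ₁′ ⊔ b) where
    private module L = RawRing rawRing-K⟨ B ⟩
    field
      ⟦_⟧               : L.Carrier → L.Carrier
      isRingIsomorphism : IsRingIsomorphism rawRing-K⟨ B ⟩ rawRing-K⟨ B ⟩ ⟦_⟧
      fixesK            : ∀ x → ⟦ ι x , base x ⟧ L.≈ (ι x , base x)

  open Algebra.Definitions.RawMonoid +-rawMonoid using (sum)

  -- [ L :K]≡ d : L has a K-basis of d elements.
  record [_:K]≡_ {b : Level} (L : Pred Carrier b) (d : ℕ)
         : Set (c ⊔ ℓ₁ ⊔ c′ ⊔ ℓ₁′ ⊔ b) where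
    field
      basis       : Fin d → Carrier
      basis∈L     : ∀ i → basis i ∈ L
      independent : ∀ (x : Fin d → K.Carrier) →
                    sum (λ i → ι (x i) * basis i) ≈ 0# → ∀ i → x i K.≈ K.0#
      spanning    : ∀ {y} → y ∈ L →
                    ∃ λ (x : Fin d → K.Carrier) → y ≈ sum (λ i → ι (x i) * basis i)

module Roots {K : HeytingField c ℓ₁ ℓ₂}
             (C : AlgebraicClosure K c′ ℓ₁′ ℓ₂′)
             (f : Polynomial.Poly (fieldRing K)) where
  open AlgebraicClosure C using (K̄; evalAt)
  open CommutativeRing (fieldRing K̄) using (Carrier; _≈_; _≉_; 0#; setoid)
  open Data.List.Membership.Setoid setoid using () renaming (_∈_ to _∈ᴸ_)
  open Adjunction C public

  R : Pred Carrier ℓ₁′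
  R x = evalAt f x ≈ 0#

  K_f : Pred Carrier (c ⊔ c′ ⊔ ℓ₁′)
  K_f = K⟨ R ⟩

  elements : ∀ {b} → Pred Carrier b → Setoid (c′ ⊔ b) ℓ₁′
  elements B = On.setoid setoid (proj₁ {B = B})

  Root : Set (c′ ⊔ ℓ₁′)
  Root = Setoid.Carrier (elements R)

  G : Set (c ⊔ c′ ⊔ ℓ₁′)
  G = Automorphism R

  infix 8 _·_
  _·_ : G → Root → Carrier
  σ · (α , α∈R) = proj₁ (Automorphism.⟦_⟧ σ (α , gen α∈R))

  Transitive[_] : ℕ → Set (c ⊔ c′ ⊔ ℓ₁′)
  Transitive[ k ] =
    (α β : Injection (≡.setoid (Fin k)) (elements R)) →
    ∃ λ (σ : G) → ∀ i → σ · Injection.to α i ≈ proj₁ (Injection.to β i)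

  record RootSubset : Set (suc (c′ ⊔ ℓ₁′)) where
    field
      member   : Pred Carrier (c′ ⊔ ℓ₁′)
      respects : member Respects _≈_
      ⊆R       : member ⊆ R

  open RootSubset public using (member)

  CardinalityAtLeast : ℕ → RootSubset → Set (c′ ⊔ ℓ₁′)
  CardinalityAtLeast k B = ∃ λ m → HasCardinality (elements (member B)) m × k ℕ.≤ m

  CardinalityAtMost : ℕ → RootSubset → Set (c′ ⊔ ℓ₁′)
  CardinalityAtMost k B = ∃ λ m → HasCardinality (elements (member B)) m × m ℕ.≤ k

  infixl 6 _∖_
  _∖_ : RootSubset → Carrier → Pred Carrier (c′ ⊔ ℓ₁′)
  (D ∖ δ) x = x ∈ member D × x ≉ δ

  MinimalGenerating : RootSubset → Set (c ⊔ suc (c′ ⊔ ℓ₁′))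
  MinimalGenerating B =
    K⟨ member B ⟩ ≐ K_f ×
    (∀ (A : RootSubset) → member A ⊂ member B → ¬ (K⟨ member A ⟩ ≐ K_f))

  Field : Set (suc (c ⊔ c′ ⊔ ℓ₁′))
  Field = Pred Carrier (c ⊔ c′ ⊔ ℓ₁′)

  -- K(β₁,…,βᵢ)
  Kᴸ⟨_⟩ : List Carrier → Field
  Kᴸ⟨ βs ⟩ = K⟨ (_∈ᴸ βs) ⟩

  -- The roots modulo α ~ β ⇔ K(α) = K(β); the elements of this setoid are
  -- the root clusters.
  clusters : Setoid (c′ ⊔ ℓ₁′) (c ⊔ c′ ⊔ ℓ₁′)
  clusters = On.setoid (≐-setoid Carrier (c ⊔ c′ ⊔ ℓ₁′)) (λ ((α , _) : Root) → Kᴸ⟨ [ α ] ⟩)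

  cluster : Root → Pred Carrier (c ⊔ c′ ⊔ ℓ₁′)
  cluster (α , _) x = x ∈ R × Kᴸ⟨ [ x ] ⟩ ≐ Kᴸ⟨ [ α ] ⟩

  r_K≡ : ℕ → Set (c ⊔ c′ ⊔ ℓ₁′)
  r_K≡ r = ∀ α → HasCardinality (elements (cluster α)) r

  s_K≡ : ℕ → Set (c ⊔ c′ ⊔ ℓ₁′)
  s_K≡ s = HasCardinality clusters s

  -- A bijection from Fin s onto the clusters is the same thing as an ordering
  -- (β₁,…,βₛ) of a complete set of representatives.
  record ClusterTower : Set (c ⊔ c′ ⊔ ℓ₁′) where
    field
      s        : ℕ
      ordering : HasCardinality clusters s

    representatives : List Carrier
    representatives = tabulate (λ i → proj₁ (Bijection.to ordering i))

    -- [ K , K(β₁) , … , K(β₁,…,βₛ) ]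
    fields : List Field
    fields = map Kᴸ⟨_⟩ (inits representatives)

  open ClusterTower public using (fields)

  clusterTowers : Setoid (c ⊔ c′ ⊔ ℓ₁′) (suc (c ⊔ c′ ⊔ ℓ₁′))
  clusterTowers =
    On.setoid (Data.List.Relation.Binary.Pointwise.setoid (≐-setoid Carrier (c ⊔ c′ ⊔ ℓ₁′))) fields

  -- StrictSteps Fs Ls : Ls lists the fields of the chain Fs that strictly
  -- contain their predecessor (so the first field of Fs is not in Ls).
  data StrictSteps : List Field → List Field → Set (suc (c ⊔ c′ ⊔ ℓ₁′)) where
    done   : ∀ {F} → StrictSteps [ F ] []
    equal  : ∀ {F L Fs Ls} → F ≐ L → StrictSteps (L ∷ Fs) Ls →
             StrictSteps (F ∷ L ∷ Fs) Ls
    strict : ∀ {F L Fs Ls} → F ⊂ L → StrictSteps (L ∷ Fs) Ls →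
             StrictSteps (F ∷ L ∷ Fs) (L ∷ Ls)

  HasLength : ClusterTower → ℕ → Set (suc (c ⊔ c′ ⊔ ℓ₁′))
  HasLength T m = ∃ λ Ls → StrictSteps (fields T) Ls × length Ls ≡ m

  HasDegreeSequence : ClusterTower → List ℕ → Set (ℓ₁ ⊔ suc (c ⊔ c′ ⊔ ℓ₁′))
  HasDegreeSequence T ds =
    ∃ λ Ls → StrictSteps (fields T) Ls × Pointwise [_:K]≡_ Ls ds

-- By separability f has n distinct roots ρ.  A tuple of roots γ can be moved to
-- γ′ by G exactly when every polynomial relation over K satisfied by γ is
-- satisfied by γ′ (Spec), because such a specialisation extends one root at a time.
--
-- If G is k-transitive and j < k < n, a root outside a j-tuple a has another
-- conjugate over K(a), hence is not in K(a).  This yields (1)–(3), where for the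
-- last part of (2) a generating set of least size is moved by G.  For (4), the minimal
-- polynomial over K(a) of a further root vanishes at all n − j remaining roots, so
-- it is f divided by the factors X − aᵢ, and the first k steps of a cluster tower
-- have degrees n, n − 1, …, n − k + 1.
--
-- Conversely, for k = 1 irreducibility of f suffices.  For k ≥ 2, (3) allows a
-- cluster tower to start with any k distinct roots α, its first k steps are
-- proper by (2), and (4) gives [K(α):K] = nPk.  The monomials x₁^{e₁} ⋯ x_k^{e_k} with
-- eᵢ ≤ n − i span K(α), and there are nPk of them, so they form a basis.  Rewriting
-- into these monomials uses only relations common to all arrangements of k
-- roots, so α specialises to every such arrangement.

module Submission where

open import Defs
open import Level using (Level; _⊔_; Lift; lift; lower)
open import Algebra.Apartness.Bundles using (HeytingField)
open import Algebra.Bundles using (CommutativeRing)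
open import Algebra.Bundles.Raw using (RawRing)
open import Algebra.Definitions.RawSemiring using (module Irreducible)
open import Algebra.Morphism.Bundles using (RingHomomorphism)
open import Algebra.Morphism.Structures using (IsRingIsomorphism)
open import Axiom.ExcludedMiddle using (ExcludedMiddle)
open import Data.Bool.Base using (true)
open import Data.Empty using (⊥; ⊥-elim)
open import Data.Fin.Base as Fin using (Fin; zero; suc; inject₁; inject≤; fromℕ; punchIn; punchOut;
                                        splitAt; remQuot; combine; _↑ˡ_; _↑ʳ_)
import Data.Fin.Properties as Finₚ
open import Data.List.Base using (List; []; _∷_; [_]; map; take; applyUpTo; length; tabulate; inits; _++_)
import Data.List.Properties as Listₚ
import Data.List.Membership.Setoid
open import Data.List.Relation.Binary.Pointwise.Base using (Pointwise; []; _∷_)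
import Data.List.Relation.Binary.Pointwise.Properties as Pointwiseₚ
open import Data.List.Relation.Unary.Any using (here; there)
open import Data.Nat.Base using (ℕ; zero; suc; _≤_; _<_; _∸_; _⊓_; z≤n; s≤s; _≤ᵇ_)
  renaming (_+_ to _+ᴺ_; _*_ to _*ᴺ_)
open import Data.Nat.Combinatorics using (_P_)
open import Data.Nat.Combinatorics.Base using (_P′_)
open import Data.Nat.Induction using (<-rec)
import Data.Nat.Properties as ℕₚ
import Relation.Binary.Construct.On as On
open import Data.Product.Base using (Σ; ∃; ∃₂; _×_; _,_; proj₁; proj₂)
open import Data.Sum.Base using (_⊎_; inj₁; inj₂; [_,_]′)
open import Data.Unit.Base using (⊤; tt)
open import Data.Vec.Functional using (insertAt) renaming (_∷_ to _∷ᶠ_)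
open import Data.Vec.Functional.Properties using (insertAt-lookup; insertAt-punchIn)
open import Function.Base using (_∘_; id)
open import Function.Bundles using (_⇔_; Bijection; Injection)
open import Function.Definitions using (Injective)
open import Relation.Binary.Bundles using (Setoid)
open import Relation.Binary.PropositionalEquality as ≡ using (_≡_; _≢_; _≗_)
open import Relation.Nullary using (¬_; Dec; yes; no; ¬?)
open import Relation.Nullary.Negation using (contradiction)
open import Relation.Unary using (Pred; _∈_; _∉_; _⊆_; _⊂_; _≐_)

-- Facts about one tuple of roots have to be carried to a conjugate tuple, so the work is done on
-- syntax: an `Expr` is a polynomial that can be evaluated at both. No fractions enter, since the
-- inverse of an algebraic element is a polynomial in it. The same fact makes `Spec` symmetric, so
-- that it serves as an isomorphism of the two generated fields without the map being built.
-- Reduction modulo a monic polynomial and rewriting into monomials happen on expressions, before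
-- any tuple is chosen. The converse rests on this uniformity: with coefficients depending on the
-- tuple, a dimension count at α would say nothing about another tuple. The hypothesis k < n enters
-- through spare roots: after j < k roots and one more there is still another root, onto which the
-- extra one can be moved.

private
  variable
    a a′ ℓ c ℓ₁ ℓ₂ c′ ℓ₁′ ℓ₂′ : Level
    j m n : ℕ

-- Finite combinatorics: falling factorials, arrangements, injections of finite sets.

Inj : {A : Set a} {B : Set a′} → (A → B) → Set _
Inj f = Injective _≡_ _≡_ f

P≡P′ : j ≤ n → n P j ≡ n P′ j
P≡P′ {j} {n} j≤n with j ≤ᵇ n | ℕₚ.≤⇒≤ᵇ j≤n
... | true | _ = ≡.refl

P-suc : j < n → n P suc j ≡ (n ∸ j) *ᴺ (n P j)
P-suc {j} {n} j<n = ≡.trans (P≡P′ j<n) (≡.cong ((n ∸ j) *ᴺ_) (≡.sym (P≡P′ (ℕₚ.<⇒≤ j<n))))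

-- `_P′_` recurses by splitting off its smallest factor; `arrangement` chooses its first entry among
-- all `suc n` values and needs the largest factor split off.
suc-P′-suc : ∀ n j → suc n P′ suc j ≡ suc n *ᴺ (n P′ j)
suc-P′-suc n zero    = ≡.refl
suc-P′-suc n (suc j) = begin
  (n ∸ j) *ᴺ (suc n P′ suc j)        ≡⟨ ≡.cong ((n ∸ j) *ᴺ_) (suc-P′-suc n j) ⟩
  (n ∸ j) *ᴺ (suc n *ᴺ (n P′ j))     ≡⟨ ℕₚ.*-assoc (n ∸ j) (suc n) _ ⟨
  (n ∸ j) *ᴺ suc n *ᴺ (n P′ j)       ≡⟨ ≡.cong (_*ᴺ (n P′ j)) (ℕₚ.*-comm (n ∸ j) (suc n)) ⟩
  suc n *ᴺ (n ∸ j) *ᴺ (n P′ j)       ≡⟨ ℕₚ.*-assoc (suc n) (n ∸ j) _ ⟩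
  suc n *ᴺ ((n ∸ j) *ᴺ (n P′ j))     ∎
  where open ≡.≡-Reasoning

∷-injective : {B : Set a′} {x : B} {f : Fin j → B} → (∀ i → f i ≢ x) → Inj f → Inj (x ∷ᶠ f)
∷-injective fresh inj {zero}  {zero}  _  = ≡.refl
∷-injective fresh inj {zero}  {suc i} eq = contradiction (≡.sym eq) (fresh i)
∷-injective fresh inj {suc i} {zero}  eq = contradiction eq (fresh i)
∷-injective fresh inj {suc _} {suc _} eq = ≡.cong suc (inj eq)

-- A mixed-radix code: the first digit is the first value `x`, the rest codes an arrangement of the
-- other values, which `punchIn x` renumbers around `x`. The codes index the cluster towers that are
-- counted later.
arrangement : ∀ n j → Fin (n P′ j) → Fin j → Fin n
arrangement zero    (suc j) c = ⊥-elim (Finₚ.¬Fin0 (≡.subst Fin (0-P′-suc j) c))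
  where
  0-P′-suc : ∀ j → 0 P′ suc j ≡ 0
  0-P′-suc zero    = ≡.refl
  0-P′-suc (suc _) = ≡.refl
arrangement (suc n) (suc j) c =
  let x , c′ = remQuot {suc n} (n P′ j) (≡.subst Fin (suc-P′-suc n j) c)
  in x ∷ᶠ (punchIn x ∘ arrangement n j c′)

arrangement-injective : ∀ n j c → Inj (arrangement n j c)
arrangement-injective zero    (suc zero)    ()
arrangement-injective zero    (suc (suc _)) ()
arrangement-injective (suc n) (suc j) c = ∷-injective (λ _ → Finₚ.punchInᵢ≢i _ _)
  (λ eq → arrangement-injective n j _ (Finₚ.punchIn-injective _ _ _ eq))

arrangement-distinct : ∀ n j c c′ → arrangement n j c ≗ arrangement n j c′ → c ≡ c′
arrangement-distinct n       zero    zero zero _ = ≡.refl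
arrangement-distinct zero    (suc zero)    ()
arrangement-distinct zero    (suc (suc _)) ()
arrangement-distinct (suc n) (suc j) c c′ eq = ≡.subst-injective (suc-P′-suc n j) (begin
  d                                    ≡⟨ Finₚ.combine-remQuot {suc n} _ d ⟨
  combine (proj₁ r) (proj₂ r)          ≡⟨ ≡.cong₂ combine (eq zero) tails ⟩
  combine (proj₁ r′) (proj₂ r′)        ≡⟨ Finₚ.combine-remQuot {suc n} _ d′ ⟩
  d′                                   ∎)
  where
  open ≡.≡-Reasoning
  d  = ≡.subst Fin (suc-P′-suc n j) c
  d′ = ≡.subst Fin (suc-P′-suc n j) c′
  r  = remQuot {suc n} (n P′ j) d
  r′ = remQuot {suc n} (n P′ j) d′
  tails : proj₂ r ≡ proj₂ r′
  tails = arrangement-distinct n j _ _ λ i → Finₚ.punchIn-injective (proj₁ r) _ _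
    (≡.trans (eq (suc i)) (≡.cong (λ x → punchIn x (arrangement n j (proj₂ r′) i)) (≡.sym (eq zero))))

-- A cluster tower lists representatives of all clusters, so a chosen beginning must be completed to
-- a permutation. The recursion deletes the value `a zero` from the target.
extend : (a : Fin j → Fin n) → Inj a →
         ∃ λ (π : Fin n → Fin n) → Inj π × (∀ j≤n i → π (inject≤ i j≤n) ≡ a i)
extend {zero}          a inj = id , id , λ _ ()
extend {suc j} {zero}  a inj = contradiction (a zero) Finₚ.¬Fin0
extend {suc j} {suc n} a inj =
  x ∷ᶠ (punchIn x ∘ π) ,
  ∷-injective (λ _ → Finₚ.punchInᵢ≢i _ _) (λ eq → π-inj (Finₚ.punchIn-injective _ _ _ eq)) ,
  agrees
  where
  x = a zero
  x≢ : ∀ i → x ≢ a (suc i)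
  x≢ i eq with () ← inj eq
  rec = extend (λ i → punchOut (x≢ i))
    (λ eq → Finₚ.suc-injective (inj (Finₚ.punchOut-injective (x≢ _) (x≢ _) eq)))
  π = proj₁ rec
  π-inj = proj₁ (proj₂ rec)
  agrees : ∀ le i → (x ∷ᶠ (punchIn x ∘ π)) (inject≤ i le) ≡ a i
  agrees (s≤s le) zero    = ≡.refl
  agrees (s≤s le) (suc i) =
    ≡.trans (≡.cong (punchIn x) (proj₂ (proj₂ rec) le i)) (Finₚ.punchIn-punchOut (x≢ i))

hit? : (f : Fin m → Fin n) (y : Fin n) → Dec (∃ λ x → f x ≡ y)
hit? f y = Finₚ.any? λ x → f x Finₚ.≟ y

-- If every value were hit, choosing preimages would inject `Fin n` into the smaller `Fin m`.
avoided : (f : Fin m → Fin n) → m < n → ∃ λ y → ∀ x → f x ≢ y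
avoided f m<n with Finₚ.any? (λ y → Finₚ.all? λ x → ¬? (f x Finₚ.≟ y))
... | yes found = found
... | no  none  = contradiction m<n (ℕₚ.≤⇒≯ (Finₚ.injective⇒≤ {f = proj₁ ∘ preimage} inj))
  where
  preimage : ∀ y → ∃ λ x → f x ≡ y
  preimage y with hit? f y
  ... | yes hit  = hit
  ... | no  miss = contradiction (y , λ x eq → miss (x , eq)) none
  inj : Inj (proj₁ ∘ preimage)
  inj {y} {y′} eq =
    ≡.trans (≡.sym (proj₂ (preimage y))) (≡.trans (≡.cong f eq) (proj₂ (preimage y′)))

injective⇒surjective : (f : Fin n → Fin n) → Inj f → ∀ y → ∃ λ x → f x ≡ y
injective⇒surjective f inj y with hit? f y
... | yes hit  = hit
... | no  miss = contradiction (Finₚ.injective⇒≤ (∷-injective (λ x eq → miss (x , eq)) inj)) ℕₚ.1+n≰n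

-- Classical logic: least numbers and finite setoids.

module Classical (em : ∀ {a} → ExcludedMiddle a) where

  dec : (A : Set a) → Dec A
  dec A = em

  byContradiction : {A : Set a} → ¬ ¬ A → A
  byContradiction {A = A} ¬¬A with dec A
  ... | yes x = x
  ... | no ¬x = contradiction ¬x ¬¬A

  least : (Q : ℕ → Set a′) → ∃ Q → ∃ λ d → Q d × (∀ i → i < d → ¬ Q i)
  least Q (d , q) = <-rec (λ d → Q d → ∃ λ d → Q d × (∀ i → i < d → ¬ Q i)) step d q
    where
    step : ∀ d → (∀ {i} → i < d → Q i → _) → Q d → ∃ λ d → Q d × (∀ i → i < d → ¬ Q i)
    step d rec q with dec (∃ λ i → i < d × Q i)
    ... | yes (i , i<d , qi) = rec i<d qi
    ... | no  none           = d , q , λ i i<d qi → none (i , i<d , qi)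

  module _ (S : Setoid a ℓ) where
    open Setoid S renaming (Carrier to A)

    Covers : (Fin m → A) → Set _
    Covers g = ∀ x → ∃ λ i → g i ≈ x

    -- A covering list of least length has no repetition, since a repeated entry could be dropped.
    covered⇒finite : (g : Fin m → A) → Covers g → ∃ (HasCardinality S)
    covered⇒finite {m} g cov with least (λ l → ∃ λ (g : Fin l → A) → Covers g) (m , g , cov)
    ... | l , (h , h-cov) , minimal = l , record
      { to        = h
      ; cong      = λ { ≡.refl → refl }
      ; bijective = injective , λ y → proj₁ (h-cov y) , λ { ≡.refl → proj₂ (h-cov y) }
      }
      where
      redundant : ∀ {l} (h : Fin (suc l) → A) → Covers h → ∀ i i′ → i ≢ i′ → h i ≈ h i′ →
                  Covers (h ∘ punchIn i)
      redundant h cov i i′ i≢i′ eq x with cov x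
      ... | i″ , eq″ with i Finₚ.≟ i″
      ... | no i≢i″ = punchOut i≢i″ , trans (reflexive (≡.cong h (Finₚ.punchIn-punchOut i≢i″))) eq″
      ... | yes ≡.refl = punchOut i≢i′ ,
        trans (reflexive (≡.cong h (Finₚ.punchIn-punchOut i≢i′))) (trans (sym eq) eq″)
      drop-one : ∀ {l} (h : Fin l → A) → Covers h → (∀ i → i < l → ¬ ∃ λ (g : Fin i → A) → Covers g) →
                 ∀ i i′ → h i ≈ h i′ → i ≢ i′ → ⊥
      drop-one {suc l} h cov min i i′ eq i≢i′ =
        min l ℕₚ.≤-refl (h ∘ punchIn i , redundant h cov i i′ i≢i′ eq)
      injective : Injective _≡_ _≈_ h
      injective {i} {i′} eq = byContradiction (drop-one h h-cov minimal i i′ eq)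

  module _ (S : Setoid a ℓ) where
    open Setoid S renaming (Carrier to A)

    subset-finite : {Q : Pred A a′} (r : Fin n → A) → (∀ x → x ∈ Q → ∃ λ i → r i ≈ x) →
                    ∃ (HasCardinality (On.setoid S (proj₁ {B = Q})))
    subset-finite {Q = Q} r cov with subcover r
      where
      subcover : ∀ {n} (r : Fin n → A) → ∃₂ λ l (g : Fin l → Σ A Q) →
                 ∀ x → x ∈ Q → ∃ (λ i → r i ≈ x) → ∃ λ i → proj₁ (g i) ≈ x
      subcover {zero}  r = 0 , (λ ()) , λ _ _ ()
      subcover {suc n} r with subcover (r ∘ suc) | dec (∃ λ x → x ∈ Q × r zero ≈ x)
      -- `Q` is not assumed to respect `_≈_`, so the element `y` of `Q` found next to `r zero` is
      -- kept, not `r zero` itself.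
      ... | l , g , cov | yes (y , q , eq) = suc l , (y , q) ∷ᶠ g , λ where
        x x∈Q (zero  , eq′) → zero , trans (sym eq) eq′
        x x∈Q (suc i , eq′) → let i′ , eq″ = cov x x∈Q (i , eq′) in suc i′ , eq″
      ... | l , g , cov | no  none         = l , g , λ where
        x x∈Q (zero  , eq′) → contradiction (x , x∈Q , eq′) none
        x x∈Q (suc i , eq′) → cov x x∈Q (i , eq′)
    ... | l , g , g-cov = covered⇒finite _ g λ (x , q) → g-cov x q (cov x q)

-- Polynomials as coefficient vectors: Horner values, division by linear factors, derivatives.

-- A polynomial of degree at most d is given by its coefficient t of X^d and
-- the vector u of the lower coefficients, constant term first.

module Horner {A : Set a} (_+_ _*_ : A → A → A) where

  horner : A → (Fin n → A) → A → A
  horner {zero}  t u x = t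
  horner {suc n} t u x = u zero + (x * horner t (u ∘ suc) x)

  -- Synthetic division by X - b: the partial Horner values at b are the coefficients of the
  -- quotient. Only bare operations are required because the same formulas are later applied to
  -- `Expr`, which is not a ring on the nose.
  quotient : A → (Fin (suc n) → A) → A → Fin n → A
  quotient {suc n} t u b zero    = horner t (u ∘ suc) b
  quotient {suc n} t u b (suc i) = quotient t (u ∘ suc) b i

module HornerProperties (R : CommutativeRing c ℓ) where
  open CommutativeRing R hiding (zero)
  open Horner _+_ _*_ public
  open import Algebra.Solver.Ring.NaturalCoefficients.Default commutativeSemiring
    using (solve; _:+_; _:*_; _:=_)
  open import Relation.Binary.Reasoning.Setoid setoid

  horner-cong : ∀ {s t x y} (u v : Fin n → Carrier) → s ≈ t → (∀ i → u i ≈ v i) → x ≈ y →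
                horner s u x ≈ horner t v y
  horner-cong {zero}  u v s≈t u≈v x≈y = s≈t
  horner-cong {suc n} u v s≈t u≈v x≈y =
    +-cong (u≈v zero) (*-cong x≈y (horner-cong (u ∘ suc) (v ∘ suc) s≈t (u≈v ∘ suc) x≈y))

  horner-congʳ : ∀ t (u : Fin n → Carrier) {x y} → x ≈ y → horner t u x ≈ horner t u y
  horner-congʳ t u = horner-cong u u refl (λ _ → refl)

  horner-+ : ∀ s t (u v : Fin n → Carrier) x →
             horner (s + t) (λ i → u i + v i) x ≈ horner s u x + horner t v x
  horner-+ {zero}  s t u v x = refl
  horner-+ {suc n} s t u v x = trans
    (+-congˡ (*-congˡ (horner-+ s t (u ∘ suc) (v ∘ suc) x)))
    (solve 5 (λ a b x p q → (a :+ b) :+ x :* (p :+ q) := (a :+ x :* p) :+ (b :+ x :* q)) refl _ _ _ _ _)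

  horner-* : ∀ k t (u : Fin n → Carrier) x →
             horner (k * t) (λ i → k * u i) x ≈ k * horner t u x
  horner-* {zero}  k t u x = refl
  horner-* {suc n} k t u x = trans
    (+-congˡ (*-congˡ (horner-* k t (u ∘ suc) x)))
    (solve 4 (λ k a x p → k :* a :+ x :* (k :* p) := k :* (a :+ x :* p)) refl _ _ _ _)

  horner-zero : ∀ {t} (u : Fin n → Carrier) x → t ≈ 0# → (∀ i → u i ≈ 0#) → horner t u x ≈ 0#
  horner-zero {zero}  u x t≈0 u≈0 = t≈0
  horner-zero {suc n} u x t≈0 u≈0 =
    trans (+-cong (u≈0 zero) (trans (*-congˡ (horner-zero (u ∘ suc) x t≈0 (u≈0 ∘ suc))) (zeroʳ x))) (+-identityˡ 0#)

  horner-last : (u : Fin (suc n) → Carrier) → ∀ x →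
                horner 0# u x ≈ horner (u (fromℕ n)) (u ∘ inject₁) x
  horner-last {zero}  u x = trans (+-congˡ (zeroʳ x)) (+-identityʳ _)
  horner-last {suc n} u x = +-congˡ (*-congˡ (horner-last (u ∘ suc) x))

  -- p(x) − p(b) = (x − b) q(x), with both sides moved so that no subtraction occurs.
  horner-quotient : ∀ t (u : Fin (suc n) → Carrier) b x →
    horner t u x + b * horner t (quotient t u b) x ≈ horner t u b + x * horner t (quotient t u b) x
  horner-quotient {zero}  t u b x =
    solve 4 (λ a x b t → (a :+ x :* t) :+ b :* t := (a :+ b :* t) :+ x :* t) refl _ _ _ _
  horner-quotient {suc n} t u b x = begin
    (u zero + x * p x) + b * (p b + x * q)
      ≈⟨ solve 6 (λ a x b r s q → (a :+ x :* r) :+ b :* (s :+ x :* q)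
                 := a :+ (x :* (r :+ b :* q) :+ b :* s)) refl _ _ _ _ _ _ ⟩
    u zero + (x * (p x + b * q) + b * p b)
      ≈⟨ +-congˡ (+-congʳ (*-congˡ (horner-quotient t (u ∘ suc) b x))) ⟩
    u zero + (x * (p b + x * q) + b * p b)
      ≈⟨ solve 5 (λ a x b s q → a :+ (x :* (s :+ x :* q) :+ b :* s)
                 := (a :+ b :* s) :+ x :* (s :+ x :* q)) refl _ _ _ _ _ ⟩
    (u zero + b * p b) + x * (p b + x * q) ∎
    where
    p = horner t (u ∘ suc)
    q = horner t (quotient t (u ∘ suc) b) x

  -- The value of the derivative, through (u₀ + X p)′ = p + X p′.
  slope : Carrier → (Fin n → Carrier) → Carrier → Carrier
  slope {zero}  t u x = 0#
  slope {suc n} t u x = horner t (u ∘ suc) x + x * slope t (u ∘ suc) x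

  slope-cong : ∀ {s t} (u v : Fin n → Carrier) x → s ≈ t → (∀ i → u i ≈ v i) → slope s u x ≈ slope t v x
  slope-cong {zero}  u v x s≈t u≈v = refl
  slope-cong {suc n} u v x s≈t u≈v = +-cong (horner-cong (u ∘ suc) (v ∘ suc) s≈t (u≈v ∘ suc) refl)
    (*-congˡ (slope-cong (u ∘ suc) (v ∘ suc) x s≈t (u≈v ∘ suc)))

  slope-* : ∀ k t (u : Fin n → Carrier) x → slope (k * t) (λ i → k * u i) x ≈ k * slope t u x
  slope-* {zero}  k t u x = sym (zeroʳ k)
  slope-* {suc n} k t u x = trans
    (+-cong (horner-* k t (u ∘ suc) x) (*-congˡ (slope-* k t (u ∘ suc) x)))
    (solve 4 (λ k p x q → k :* p :+ x :* (k :* q) := k :* (p :+ x :* q)) refl _ _ _ _)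

  -- Differentiating p(x) = p(b) + (x − b) q(x) gives p′(x) = q(x) + (x − b) q′(x).
  slope-quotient : ∀ t (u : Fin (suc n) → Carrier) b x →
    slope t u x + b * slope t (quotient t u b) x ≈
    horner t (quotient t u b) x + x * slope t (quotient t u b) x
  slope-quotient {zero}  t u b x = +-cong (trans (+-congˡ (zeroʳ x)) (+-identityʳ t)) (trans (zeroʳ b) (sym (zeroʳ x)))
  slope-quotient {suc n} t u b x = begin
    (p x + x * p′) + b * (q + x * q′)
      ≈⟨ solve 6 (λ x b r s q q′ → (r :+ x :* s) :+ b :* (q :+ x :* q′)
                 := (r :+ b :* q) :+ x :* (s :+ b :* q′)) refl _ _ _ _ _ _ ⟩
    (p x + b * q) + x * (p′ + b * q′)
      ≈⟨ +-cong (horner-quotient t (u ∘ suc) b x) (*-congˡ (slope-quotient t (u ∘ suc) b x)) ⟩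
    (p b + x * q) + x * (q + x * q′) ∎
    where
    p  = horner t (u ∘ suc)
    p′ = slope t (u ∘ suc) x
    q  = horner t (quotient t (u ∘ suc) b) x
    q′ = slope t (quotient t (u ∘ suc) b) x

  -- The polynomial is p(b) + (X - b) q; with q = 0 and p(b) = 0 nothing remains.
  quotient-zero : ∀ {t} (u : Fin (suc n) → Carrier) b → t ≈ 0# → (∀ i → quotient t u b i ≈ 0#) →
                  horner t u b ≈ 0# → ∀ i → u i ≈ 0#
  quotient-zero {zero}  {t} u b t≈0 q≈0 ub≈0 zero = begin
    u zero          ≈⟨ +-identityʳ _ ⟨
    u zero + 0#     ≈⟨ +-congˡ (trans (*-congˡ t≈0) (zeroʳ b)) ⟨
    u zero + b * t  ≈⟨ ub≈0 ⟩
    0#              ∎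
  quotient-zero {suc n} {t} u b t≈0 q≈0 ub≈0 zero = begin
    u zero                               ≈⟨ +-identityʳ _ ⟨
    u zero + 0#                          ≈⟨ +-congˡ (trans (*-congˡ (q≈0 zero)) (zeroʳ b)) ⟨
    u zero + b * horner t (u ∘ suc) b    ≈⟨ ub≈0 ⟩
    0#                                   ∎
  quotient-zero {suc n} u b t≈0 q≈0 ub≈0 (suc i) =
    quotient-zero (u ∘ suc) b t≈0 (q≈0 ∘ suc) (q≈0 zero) i

-- Roots of polynomials over a field.

module FieldProperties (em : ∀ {a} → ExcludedMiddle a) (F : HeytingField c ℓ₁ ℓ₂) where
  open CommutativeRing (fieldRing F) hiding (zero)
  open HornerProperties (fieldRing F) public
  open Classical em
  private module F = HeytingField F
  open import Algebra.Properties.Ring ring using (-0#≈0#)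
  open import Algebra.Properties.AbelianGroup +-abelianGroup using (x∙y⁻¹≈ε⇒x≈y)
  open import Relation.Binary.Reasoning.Setoid setoid

  x-0≈x : ∀ x → x - 0# ≈ x
  x-0≈x x = trans (+-congˡ -0#≈0#) (+-identityʳ x)

  1≉0 : 1# ≉ 0#
  1≉0 1≈0 = F.#-irrefl 1≈0
    (F.invertible⇒# (1# , trans (*-identityˡ _) (x-0≈x 1#) , trans (*-identityʳ _) (x-0≈x 1#)))

  inverse : ∀ {x} → x ≉ 0# → ∃ λ y → x * y ≈ 1#
  inverse {x} x≉0 with F.#⇒invertible (byContradiction λ ¬x#0 → x≉0 (proj₁ (F.tight x 0#) ¬x#0))
  ... | y , _ , eq = y , trans (*-congʳ (sym (x-0≈x x))) eq

  zero-product : ∀ {x y} → x * y ≈ 0# → x ≉ 0# → y ≈ 0#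
  zero-product {x} {y} xy≈0 x≉0 with inverse x≉0
  ... | z , xz≈1 = begin
    y            ≈⟨ *-identityˡ y ⟨
    1# * y       ≈⟨ *-congʳ (trans (*-comm z x) xz≈1) ⟨
    z * x * y    ≈⟨ *-assoc z x y ⟩
    z * (x * y)  ≈⟨ *-congˡ xy≈0 ⟩
    z * 0#       ≈⟨ zeroʳ z ⟩
    0#           ∎

  cancel : ∀ {x b y} → b * y ≈ x * y → x ≉ b → y ≈ 0#
  cancel {x} {b} {y} eq x≉b = zero-product (begin
    (x - b) * y       ≈⟨ distribʳ y x (- b) ⟩
    x * y + - b * y   ≈⟨ +-congʳ eq ⟨
    b * y + - b * y   ≈⟨ distribʳ y b (- b) ⟨
    (b - b) * y       ≈⟨ *-congʳ (-‿inverseʳ b) ⟩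
    0# * y            ≈⟨ zeroˡ y ⟩
    0#                ∎)
    λ x-b≈0 → x≉b (x∙y⁻¹≈ε⇒x≈y x b x-b≈0)

  quotient-root : ∀ {t} (u : Fin (suc n) → Carrier) {b x} → horner t u b ≈ 0# → horner t u x ≈ 0# →
                  x ≉ b → horner t (quotient t u b) x ≈ 0#
  quotient-root {t = t} u {b} {x} ub≈0 ux≈0 x≉b = cancel (begin
    b * q                 ≈⟨ +-identityˡ _ ⟨
    0# + b * q            ≈⟨ +-congʳ ux≈0 ⟨
    horner t u x + b * q  ≈⟨ horner-quotient t u b x ⟩
    horner t u b + x * q  ≈⟨ +-congʳ ub≈0 ⟩
    0# + x * q            ≈⟨ +-identityˡ _ ⟩
    x * q                 ∎) x≉b
    where q = horner t (quotient t u b) x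

  root-of-multiple : ∀ {t} (u : Fin (suc n) → Carrier) {b x} → horner t u b ≈ 0# →
                     horner t (quotient t u b) x ≈ 0# → horner t u x ≈ 0#
  root-of-multiple {t = t} u {b} {x} ub≈0 qx≈0 = begin
    horner t u x           ≈⟨ +-identityʳ _ ⟨
    horner t u x + 0#      ≈⟨ +-congˡ (trans (*-congˡ qx≈0) (zeroʳ b)) ⟨
    horner t u x + b * q   ≈⟨ horner-quotient t u b x ⟩
    horner t u b + x * q   ≈⟨ +-cong ub≈0 (trans (*-congˡ qx≈0) (zeroʳ x)) ⟩
    0# + 0#                ≈⟨ +-identityˡ 0# ⟩
    0#                     ∎
    where q = horner t (quotient t u b) x

  -- With leading coefficient 0 the vector `u` has degree below n, yet n distinct roots; division by
  -- X - r₀ lowers both numbers by one.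
  roots⇒zero : (u : Fin n → Carrier) (r : Fin n → Carrier) → Injective _≡_ _≈_ r →
               (∀ i → horner 0# u (r i) ≈ 0#) → ∀ i → u i ≈ 0#
  roots⇒zero {suc n} u r r-inj ur≈0 = quotient-zero u (r zero) refl
    (roots⇒zero (quotient 0# u (r zero)) (r ∘ suc) (λ eq → Finₚ.suc-injective (r-inj eq))
      λ i → quotient-root u (ur≈0 zero) (ur≈0 (suc i)) λ eq → contradiction (r-inj eq) λ ())
    (ur≈0 zero)

  SimpleRoots : (Fin n → Carrier) → Set _
  SimpleRoots u = ∀ {x} → horner 1# u x ≈ 0# → slope 1# u x ≉ 0#

  module _ (hasRoot : ∀ {n} (u : Fin (suc n) → Carrier) → ∃ λ x → horner 1# u x ≈ 0#) where

    -- For the quotient q by X - b one has p′(b) = q(b), so a simple root b is not a root of q; and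
    -- p′ = q + (X - b) q′ shows that a multiple root of q would be one of p. Hence q again has only
    -- simple roots, all different from b.
    split : (u : Fin n → Carrier) → SimpleRoots u →
            ∃ λ (r : Fin n → Carrier) → Injective _≡_ _≈_ r × (∀ i → horner 1# u (r i) ≈ 0#) ×
            (∀ {x} → horner 1# u x ≈ 0# → ∃ λ i → r i ≈ x)
    split {zero}  u simple = (λ ()) , (λ { {()} }) , (λ ()) , λ 1≈0 → contradiction 1≈0 1≉0
    split {suc n} u simple with hasRoot u
    ... | b , ub≈0 = b ∷ᶠ r , injective , roots , complete
      where
      q = quotient 1# u b
      qb≉0 : horner 1# q b ≉ 0#
      qb≉0 qb≈0 = simple ub≈0 (begin
        slope 1# u b                     ≈⟨ +-identityʳ _ ⟨
        slope 1# u b + 0#                ≈⟨ +-congˡ (-‿inverseʳ (b * slope 1# q b)) ⟨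
        slope 1# u b + (b * slope 1# q b - b * slope 1# q b)
                                         ≈⟨ +-assoc _ _ _ ⟨
        slope 1# u b + b * slope 1# q b - b * slope 1# q b
                                         ≈⟨ +-congʳ (slope-quotient 1# u b b) ⟩
        horner 1# q b + b * slope 1# q b - b * slope 1# q b
                                         ≈⟨ +-congʳ (trans (+-congʳ qb≈0) (+-identityˡ _)) ⟩
        b * slope 1# q b - b * slope 1# q b ≈⟨ -‿inverseʳ _ ⟩
        0#                               ∎)
      q-simple : SimpleRoots q
      q-simple {x} qx≈0 q′x≈0 = simple (root-of-multiple u ub≈0 qx≈0) (begin
        slope 1# u x                     ≈⟨ +-identityʳ _ ⟨
        slope 1# u x + 0#                ≈⟨ +-congˡ (trans (*-congˡ q′x≈0) (zeroʳ b)) ⟨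
        slope 1# u x + b * slope 1# q x  ≈⟨ slope-quotient 1# u b x ⟩
        horner 1# q x + x * slope 1# q x ≈⟨ +-cong qx≈0 (trans (*-congˡ q′x≈0) (zeroʳ x)) ⟩
        0# + 0#                          ≈⟨ +-identityˡ 0# ⟩
        0#                               ∎)
      rec = split q q-simple
      r = proj₁ rec
      r-root : ∀ i → horner 1# q (r i) ≈ 0#
      r-root = proj₁ (proj₂ (proj₂ rec))
      fresh : ∀ i → r i ≉ b
      fresh i eq = qb≉0 (trans (horner-congʳ 1# q (sym eq)) (r-root i))
      injective : Injective _≡_ _≈_ (b ∷ᶠ r)
      injective {zero}  {zero}  eq = ≡.refl
      injective {zero}  {suc i} eq = contradiction (sym eq) (fresh i)
      injective {suc i} {zero}  eq = contradiction eq (fresh i)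
      injective {suc i} {suc k} eq = ≡.cong suc (proj₁ (proj₂ rec) eq)
      roots : ∀ i → horner 1# u ((b ∷ᶠ r) i) ≈ 0#
      roots zero    = ub≈0
      roots (suc i) = root-of-multiple u ub≈0 (r-root i)
      complete : ∀ {x} → horner 1# u x ≈ 0# → ∃ λ i → (b ∷ᶠ r) i ≈ x
      complete {x} ux≈0 with dec (x ≈ b)
      ... | yes x≈b = zero , sym x≈b
      ... | no  x≉b =
        let i , eq = proj₂ (proj₂ (proj₂ rec)) (quotient-root u ub≈0 ux≈0 x≉b) in suc i , eq

-- Polynomial expressions in algebraic elements, and specialisations of tuples.

module Expressions (em : ∀ {a} → ExcludedMiddle a)
                   {c ℓ₁ ℓ₂ c′ ℓ₁′ ℓ₂′ : Level}
                   (K : HeytingField c ℓ₁ ℓ₂) (C : AlgebraicClosure K c′ ℓ₁′ ℓ₂′) where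
  open Classical em
  open AlgebraicClosure C
  open Adjunction C
  open CommutativeRing (fieldRing K̄) hiding (zero)
  open FieldProperties em K̄ public
  module K  = CommutativeRing (fieldRing K)
  module Kₚ = FieldProperties em K
  module ι = RingHomomorphism embedding
  module K[X] = Polynomial (fieldRing K)
  module K̄[X] = Polynomial (fieldRing K̄)
  open import Algebra.Properties.Ring ring
    using (-1*x≈-x; -‿distribʳ-*)
  open import Algebra.Properties.AbelianGroup +-abelianGroup
    using (x∙y⁻¹≈ε⇒x≈y; inverseʳ-unique)
  open import Algebra.Solver.Ring.NaturalCoefficients.Default commutativeSemiring
    using (solve; _:+_; _:*_; _:=_)
  open import Relation.Binary.Reasoning.Setoid setoid

  ι-injective : ∀ {x} → ι x ≈ 0# → x K.≈ K.0#
  ι-injective {x} ιx≈0 = byContradiction λ x≉0 →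
    let y , xy≈1 = Kₚ.inverse x≉0 in 1≉0 (begin
      1#          ≈⟨ ι.1#-homo ⟨
      ι K.1#      ≈⟨ ι.⟦⟧-cong xy≈1 ⟨
      ι (x K.* y) ≈⟨ ι.*-homo x y ⟩
      ι x * ι y   ≈⟨ trans (*-congʳ ιx≈0) (zeroˡ _) ⟩
      0#          ∎)

  Tuple : ℕ → Set c′
  Tuple j = Fin j → Carrier

  infixl 6 _⊕_
  infixl 7 _⊗_
  -- Polynomials over K kept as syntax, so that one expression can be read at several tuples.
  -- Negation is multiplication by the constant -1, and inverses are supplied by `inverse-expr`.
  data Expr (j : ℕ) : Set c where
    con : K.Carrier → Expr j
    var : Fin j → Expr j
    _⊕_ : Expr j → Expr j → Expr j
    _⊗_ : Expr j → Expr j → Expr j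

  eval : Tuple j → Expr j → Carrier
  eval γ (con x)  = ι x
  eval γ (var i)  = γ i
  eval γ (e ⊕ e′) = eval γ e + eval γ e′
  eval γ (e ⊗ e′) = eval γ e * eval γ e′

  rename : (Fin m → Fin n) → Expr m → Expr n
  rename h (con x)  = con x
  rename h (var i)  = var (h i)
  rename h (e ⊕ e′) = rename h e ⊕ rename h e′
  rename h (e ⊗ e′) = rename h e ⊗ rename h e′

  eval-rename : ∀ (γ : Tuple n) (h : Fin m → Fin n) e → eval γ (rename h e) ≡ eval (γ ∘ h) e
  eval-rename γ h (con x)  = ≡.refl
  eval-rename γ h (var i)  = ≡.refl
  eval-rename γ h (e ⊕ e′) = ≡.cong₂ _+_ (eval-rename γ h e) (eval-rename γ h e′)
  eval-rename γ h (e ⊗ e′) = ≡.cong₂ _*_ (eval-rename γ h e) (eval-rename γ h e′)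

  eval-cong : {γ γ′ : Tuple j} → (∀ i → γ i ≈ γ′ i) → ∀ e → eval γ e ≈ eval γ′ e
  eval-cong eq (con x)  = refl
  eval-cong eq (var i)  = eq i
  eval-cong eq (e ⊕ e′) = +-cong (eval-cong eq e) (eval-cong eq e′)
  eval-cong eq (e ⊗ e′) = *-cong (eval-cong eq e) (eval-cong eq e′)

  infix 8 ⊖_
  ⊖_ : Expr j → Expr j
  ⊖ e = con (K.- K.1#) ⊗ e

  eval-neg : ∀ (γ : Tuple j) e → eval γ (⊖ e) ≈ - eval γ e
  eval-neg γ e = trans (*-congʳ (trans (ι.-‿homo K.1#) (-‿cong ι.1#-homo))) (-1*x≈-x _)

  polynomial : K[X].Poly → Expr j → Expr j
  polynomial []      e = con K.0#
  polynomial (x ∷ p) e = con x ⊕ e ⊗ polynomial p e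

  eval-polynomial : ∀ (γ : Tuple j) p e → eval γ (polynomial p e) ≈ evalAt p (eval γ e)
  eval-polynomial γ []      e = ι.0#-homo
  eval-polynomial γ (x ∷ p) e = +-congˡ (*-congˡ (eval-polynomial γ p e))

  -- An algebraic x ≠ 0 satisfies a₀ + x p(x) = 0 with a₀ ≠ 0, so 1/x = − p(x)/a₀.
  inverse-expr : ∀ (γ : Tuple j) e → eval γ e ≉ 0# → ∃ λ e′ → eval γ e * eval γ e′ ≈ 1#
  inverse-expr γ e x≉0 with algebraic (eval γ e)
  ... | p , d , deg , px≈0 = invert p d deg px≈0
    where
    x = eval γ e
    invert : ∀ p d → K[X].HasDegree p d → evalAt p x ≈ 0# → ∃ λ e′ → x * eval γ e′ ≈ 1#
    invert []      d (0≉0 , _) _ = contradiction K.refl 0≉0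
    invert (a ∷ p) d deg px≈0 with dec (a K.≈ K.0#)
    invert (a ∷ p) zero    deg px≈0 | yes a≈0 = contradiction a≈0 (proj₁ deg)
    invert (a ∷ p) (suc d) deg px≈0 | yes a≈0 =
      invert p d (proj₁ deg , λ i d<i → proj₂ deg (suc i) (s≤s d<i)) (zero-product (begin
        x * evalAt p x        ≈⟨ +-identityˡ _ ⟨
        0# + x * evalAt p x   ≈⟨ +-congʳ (trans (ι.⟦⟧-cong a≈0) ι.0#-homo) ⟨
        ι a + x * evalAt p x  ≈⟨ px≈0 ⟩
        0#                    ∎) x≉0)
    invert (a ∷ p) d deg px≈0 | no a≉0 with Kₚ.inverse a≉0
    ... | b , ab≈1 = ⊖ (con b ⊗ polynomial p e) , (begin
      x * eval γ (⊖ (con b ⊗ polynomial p e))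
        ≈⟨ *-congˡ (trans (eval-neg γ (con b ⊗ polynomial p e)) (-‿cong (*-congˡ (eval-polynomial γ p e)))) ⟩
      x * - (ι b * P)    ≈⟨ -‿distribʳ-* _ _ ⟨
      - (x * (ι b * P))  ≈⟨ inverseʳ-unique _ _ (begin
        x * (ι b * P) + 1#         ≈⟨ +-congˡ (trans (ι.⟦⟧-cong ab≈1) ι.1#-homo) ⟨
        x * (ι b * P) + ι (a K.* b) ≈⟨ +-congˡ (ι.*-homo a b) ⟩
        x * (ι b * P) + ι a * ι b  ≈⟨ solve 4 (λ x b p a → x :* (b :* p) :+ a :* b := b :* (a :+ x :* p)) refl _ _ _ _ ⟩
        ι b * (ι a + x * P)        ≈⟨ trans (*-congˡ px≈0) (zeroʳ _) ⟩
        0#                         ∎) ⟨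
      1#                 ∎)
      where P = evalAt p x

  -- K(B) = K[B] for algebraic elements: beyond the ring operations only `inv` remains, and
  -- `inverse-expr` answers it. The tuple `γ` has to cover B but may contain more.
  toExpr : ∀ {b} {B : Pred Carrier b} (γ : Tuple j) → (∀ {x} → x ∈ B → ∃ λ i → γ i ≈ x) →
           ∀ {x} → x ∈ K⟨ B ⟩ → ∃ λ e → eval γ e ≈ x
  toExpr γ cov (base x)  = con x , refl
  toExpr γ cov (gen x∈B) = let i , eq = cov x∈B in var i , eq
  toExpr γ cov (add s t) =
    let e , eq = toExpr γ cov s; e′ , eq′ = toExpr γ cov t in e ⊕ e′ , +-cong eq eq′
  toExpr γ cov (neg s)   =
    let e , eq = toExpr γ cov s in ⊖ e , trans (eval-neg γ e) (-‿cong eq)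
  toExpr γ cov (mul s t) =
    let e , eq = toExpr γ cov s; e′ , eq′ = toExpr γ cov t in e ⊗ e′ , *-cong eq eq′
  toExpr γ cov (inv {x} {y} s xy≈1) with toExpr γ cov s
  ... | e , eq with inverse-expr γ e (λ e≈0 → 1≉0
    (trans (sym xy≈1) (trans (*-congʳ (trans (sym eq) e≈0)) (zeroˡ y))))
  ... | e′ , ee′≈1 = e′ , (begin
    eval γ e′             ≈⟨ *-identityʳ _ ⟨
    eval γ e′ * 1#        ≈⟨ *-congˡ xy≈1 ⟨
    eval γ e′ * (x * y)   ≈⟨ *-congˡ (*-congʳ eq) ⟨
    eval γ e′ * (eval γ e * y) ≈⟨ solve 3 (λ a b y → a :* (b :* y) := (b :* a) :* y) refl _ _ _ ⟩
    eval γ e * eval γ e′ * y  ≈⟨ *-congʳ ee′≈1 ⟩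
    1# * y                ≈⟨ *-identityˡ y ⟩
    y                     ∎)
  toExpr γ cov (resp eq s) = let e , eq′ = toExpr γ cov s in e , trans eq′ eq

  fromExpr : ∀ {b} {B : Pred Carrier b} (γ : Tuple j) → (∀ i → γ i ∈ K⟨ B ⟩) → ∀ e → eval γ e ∈ K⟨ B ⟩
  fromExpr γ γ∈ (con x)  = base x
  fromExpr γ γ∈ (var i)  = γ∈ i
  fromExpr γ γ∈ (e ⊕ e′) = add (fromExpr γ γ∈ e) (fromExpr γ γ∈ e′)
  fromExpr γ γ∈ (e ⊗ e′) = mul (fromExpr γ γ∈ e) (fromExpr γ γ∈ e′)

  -- Spec γ γ′: γ ↦ γ′ defines a K-algebra map K[γ] → K[γ′].
  Spec : Tuple j → Tuple j → Set _
  Spec γ γ′ = ∀ e → eval γ e ≈ 0# → eval γ′ e ≈ 0#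

  minus : Expr j → Expr j → Expr j
  minus e e′ = e ⊕ ⊖ e′

  eval-minus : ∀ (γ : Tuple j) e e′ → eval γ (minus e e′) ≈ eval γ e - eval γ e′
  eval-minus γ e e′ = +-congˡ (eval-neg γ e′)

  spec-≈ : {γ γ′ : Tuple j} → Spec γ γ′ → ∀ e e′ → eval γ e ≈ eval γ e′ → eval γ′ e ≈ eval γ′ e′
  spec-≈ {γ = γ} {γ′} spec e e′ eq = x∙y⁻¹≈ε⇒x≈y _ _
    (trans (sym (eval-minus γ′ e e′))
      (spec (minus e e′) (trans (eval-minus γ e e′) (trans (+-congʳ eq) (-‿inverseʳ _)))))

  -- K[γ] is a field: if `e` did not vanish at γ, its inverse there would be an expression, and the
  -- relation e · e⁻¹ = 1 would be carried to γ′, where `e` vanishes.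
  spec-sym : {γ γ′ : Tuple j} → Spec γ γ′ → Spec γ′ γ
  spec-sym {γ = γ} {γ′} spec e e′≈0 = byContradiction λ e≉0 →
    let e⁻¹ , eq = inverse-expr γ e e≉0 in 1≉0 (begin
      1#                      ≈⟨ ι.1#-homo ⟨
      ι K.1#                  ≈⟨ spec-≈ spec (e ⊗ e⁻¹) (con K.1#) (trans eq (sym ι.1#-homo)) ⟨
      eval γ′ e * eval γ′ e⁻¹ ≈⟨ trans (*-congʳ e′≈0) (zeroˡ _) ⟩
      0#                      ∎)

  spec-rename : {γ γ′ : Tuple n} → Spec γ γ′ → (h : Fin m → Fin n) → Spec (γ ∘ h) (γ′ ∘ h)
  spec-rename {γ = γ} {γ′} spec h e eq =
    trans (reflexive (≡.sym (eval-rename γ′ h e)))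
      (spec (rename h e) (trans (reflexive (eval-rename γ h e)) eq))

  spec-cong : {γ γ′ δ δ′ : Tuple j} → (∀ i → γ i ≈ δ i) → (∀ i → γ′ i ≈ δ′ i) → Spec γ γ′ → Spec δ δ′
  spec-cong eq eq′ spec e δe≈0 =
    trans (sym (eval-cong eq′ e)) (spec e (trans (eval-cong eq e) δe≈0))

  IsRoot : (Fin n → Expr j) → Tuple j → Carrier → Set ℓ₁′
  IsRoot u γ δ = horner 1# (eval γ ∘ u) δ ≈ 0#

  -- Remainders modulo the monic polynomial `u`, computed on expressions alone: the result is right
  -- for every tuple and every root of `u` over it, which makes the rewriting into monomials
  -- uniform.
  module Reduction (u : Fin n → Expr j) where

    -- The coefficients of a + X·v modulo the monic polynomial u.
    shift : Expr j → (Fin n → Expr j) → Fin n → Expr j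
    shift a v i = minus ((a ∷ᶠ v) (inject₁ i)) ((a ∷ᶠ v) (fromℕ n) ⊗ u i)

    _+ᵥ_ : (Fin n → Expr j) → (Fin n → Expr j) → Fin n → Expr j
    (v +ᵥ w) i = v i ⊕ w i

    _*ᵥ_ : (Fin m → Expr j) → (Fin n → Expr j) → Fin n → Expr j
    _*ᵥ_ {zero}  v w = λ _ → con K.0#
    _*ᵥ_ {suc m} v w = (λ i → v zero ⊗ w i) +ᵥ shift (con K.0#) ((v ∘ suc) *ᵥ w)

    -- Passing through `shift` also covers n = 0, where the modulus is 1 and no constant coefficient
    -- remains.
    constant : Expr j → Fin n → Expr j
    constant a = shift a λ _ → con K.0#

    reduce : Expr (suc j) → Fin n → Expr j
    reduce (con x)       = constant (con x)
    reduce (var zero)    = shift (con K.0#) (constant (con K.1#))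
    reduce (var (suc i)) = constant (var i)
    reduce (e ⊕ e′)      = reduce e +ᵥ reduce e′
    reduce (e ⊗ e′)      = reduce e *ᵥ reduce e′

    module _ (γ : Tuple j) (δ : Carrier) (root : IsRoot u γ δ) where

      at : ∀ {m} → (Fin m → Expr j) → Carrier
      at v = horner 0# (eval γ ∘ v) δ

      at-shift : ∀ a v → at (shift a v) ≈ eval γ a + δ * at v
      at-shift a v = begin
        -- Adding l · u(δ) = 0 restores the multiple of `u` that `shift` subtracted; l is the
        -- coefficient pushed up to Xⁿ.
        r                                      ≈⟨ trans (+-congˡ (trans (*-congˡ root) (zeroʳ l))) (+-identityʳ _) ⟨
        r + l * horner 1# (eval γ ∘ u) δ        ≈⟨ +-congˡ (horner-* l 1# (eval γ ∘ u) δ) ⟨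
        r + horner (l * 1#) (λ i → l * eval γ (u i)) δ
                                                ≈⟨ horner-+ 0# (l * 1#) (eval γ ∘ shift a v) (λ i → l * eval γ (u i)) δ ⟨
        horner (0# + l * 1#) (λ i → eval γ (shift a v i) + l * eval γ (u i)) δ
                                                ≈⟨ horner-cong _ (λ i → eval γ ((a ∷ᶠ v) (inject₁ i))) (trans (+-identityˡ _) (*-identityʳ l)) pointwise refl ⟩
        horner l (λ i → eval γ ((a ∷ᶠ v) (inject₁ i))) δ
                                                ≈⟨ horner-last (eval γ ∘ (a ∷ᶠ v)) δ ⟨
        eval γ a + δ * at v                     ∎
        where
        r = at (shift a v)
        l = eval γ ((a ∷ᶠ v) (fromℕ n))
        pointwise : ∀ i → eval γ (shift a v i) + l * eval γ (u i) ≈ eval γ ((a ∷ᶠ v) (inject₁ i))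
        pointwise i = begin
          eval γ (shift a v i) + l * eval γ (u i)  ≈⟨ +-congʳ (eval-minus γ ((a ∷ᶠ v) (inject₁ i)) ((a ∷ᶠ v) (fromℕ n) ⊗ u i)) ⟩
          s - l * eval γ (u i) + l * eval γ (u i)  ≈⟨ +-assoc s _ _ ⟩
          s + (- (l * eval γ (u i)) + l * eval γ (u i)) ≈⟨ +-congˡ (-‿inverseˡ _) ⟩
          s + 0#                                   ≈⟨ +-identityʳ s ⟩
          s                                        ∎
          where s = eval γ ((a ∷ᶠ v) (inject₁ i))

      at-zero : ∀ m → at {m} (λ _ → con K.0#) ≈ 0#
      at-zero m = horner-zero {m} (λ _ → ι K.0#) δ refl λ _ → ι.0#-homo

      at-constant : ∀ a → at (constant a) ≈ eval γ a
      at-constant a = trans (at-shift a λ _ → con K.0#)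
        (trans (+-congˡ (trans (*-congˡ (at-zero n)) (zeroʳ δ))) (+-identityʳ _))

      at-+ : ∀ v w → at (v +ᵥ w) ≈ at v + at w
      at-+ v w = trans (horner-cong _ (λ i → eval γ (v i) + eval γ (w i)) (sym (+-identityˡ 0#)) (λ _ → refl) refl)
        (horner-+ 0# 0# (eval γ ∘ v) (eval γ ∘ w) δ)

      at-* : ∀ {m} (v : Fin m → Expr j) w → at (v *ᵥ w) ≈ at v * at w
      at-* {zero}  v w = trans (at-zero n) (sym (zeroˡ _))
      at-* {suc m} v w = begin
        at ((λ i → v zero ⊗ w i) +ᵥ shift (con K.0#) ((v ∘ suc) *ᵥ w))
          ≈⟨ at-+ (λ i → v zero ⊗ w i) (shift (con K.0#) ((v ∘ suc) *ᵥ w)) ⟩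
        at (λ i → v zero ⊗ w i) + at (shift (con K.0#) ((v ∘ suc) *ᵥ w))
          ≈⟨ +-cong (trans (horner-cong _ (λ i → v₀ * eval γ (w i)) (sym (zeroʳ v₀)) (λ _ → refl) refl) (horner-* v₀ 0# (eval γ ∘ w) δ))
                    (at-shift (con K.0#) ((v ∘ suc) *ᵥ w)) ⟩
        v₀ * at w + (ι K.0# + δ * at ((v ∘ suc) *ᵥ w))
          ≈⟨ +-congˡ (trans (+-congʳ ι.0#-homo) (trans (+-identityˡ _) (*-congˡ (at-* (v ∘ suc) w)))) ⟩
        v₀ * at w + δ * (at (v ∘ suc) * at w)
          ≈⟨ solve 4 (λ a w d v → a :* w :+ d :* (v :* w) := (a :+ d :* v) :* w) refl _ _ _ _ ⟩
        at v * at w ∎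
        where v₀ = eval γ (v zero)

      at-reduce : ∀ e → at (reduce e) ≈ eval (δ ∷ᶠ γ) e
      at-reduce (con x)       = at-constant (con x)
      at-reduce (var zero)    = begin
        at (reduce (var zero))                  ≈⟨ at-shift (con K.0#) (constant (con K.1#)) ⟩
        ι K.0# + δ * at (constant (con K.1#))   ≈⟨ +-cong ι.0#-homo (*-congˡ (trans (at-constant (con K.1#)) ι.1#-homo)) ⟩
        0# + δ * 1#                             ≈⟨ trans (+-identityˡ _) (*-identityʳ δ) ⟩
        δ                                       ∎
      at-reduce (var (suc i)) = at-constant (var i)
      at-reduce (e ⊕ e′)      = trans (at-+ (reduce e) (reduce e′)) (+-cong (at-reduce e) (at-reduce e′))
      at-reduce (e ⊗ e′)      = trans (at-* (reduce e) (reduce e′)) (*-cong (at-reduce e) (at-reduce e′))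

  open Reduction public using (reduce; at-reduce)

  -- The degree of δ over K(γ) is at least n. Together with `IsRoot` for a vector of n coefficients
  -- it says that this vector is the minimal polynomial of δ.
  PowersIndependent : ℕ → Tuple j → Carrier → Set _
  PowersIndependent {j} n γ δ = (v : Fin n → Expr j) → horner 0# (eval γ ∘ v) δ ≈ 0# → ∀ i → eval γ (v i) ≈ 0#

  -- Top coefficients that vanish at γ are discarded; the highest surviving one, `a`, is inverted by
  -- `inverse-expr`, which leaves a monic polynomial.
  normalise : ∀ (γ : Tuple j) δ (v : Fin n → Expr j) →
    (∀ i → eval γ (v i) ≈ 0#) ⊎
    ∃ λ m → m < n × ∃₂ λ (a : Expr j) (u : Fin m → Expr j) →
      eval γ a ≉ 0# × horner 0# (eval γ ∘ v) δ ≈ eval γ a * horner 1# (eval γ ∘ u) δ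
  normalise {n = zero}  γ δ v = inj₁ λ ()
  normalise {n = suc n} γ δ v with normalise γ δ (v ∘ suc)
  ... | inj₂ (m , m<n , a , u , a≉0 , eq) with inverse-expr γ a a≉0
  ...   | a⁻¹ , aa⁻¹≈1 = inj₂ (suc m , s≤s m<n , a , (a⁻¹ ⊗ v zero) ∷ᶠ u , a≉0 , (begin
    v₀ + δ * horner 0# (eval γ ∘ v ∘ suc) δ           ≈⟨ +-cong (sym (*-identityˡ v₀)) (*-congˡ eq) ⟩
    1# * v₀ + δ * (A * U)                             ≈⟨ +-congʳ (*-congʳ aa⁻¹≈1) ⟨
    A * eval γ a⁻¹ * v₀ + δ * (A * U)                 ≈⟨ solve 5 (λ a b v d u → a :* b :* v :+ d :* (a :* u) := a :* (b :* v :+ d :* u)) refl _ _ _ _ _ ⟩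
    A * (eval γ a⁻¹ * v₀ + δ * U)                     ∎))
    where
    v₀ = eval γ (v zero)
    A  = eval γ a
    U  = horner 1# (eval γ ∘ u) δ
  normalise {n = suc n} γ δ v | inj₁ tail≈0 with dec (eval γ (v zero) ≈ 0#)
  ... | yes v₀≈0 = inj₁ λ { zero → v₀≈0 ; (suc i) → tail≈0 i }
  ... | no  v₀≉0 = inj₂ (0 , s≤s z≤n , v zero , (λ ()) , v₀≉0 ,
    trans (+-congˡ (trans (*-congˡ (horner-zero _ δ refl tail≈0)) (zeroʳ δ)))
      (trans (+-identityʳ _) (sym (*-identityʳ _))))

  -- Among monic relations one of least degree is taken; a nontrivial relation between lower powers
  -- could be normalised to a monic one of still smaller degree.
  minimalRelation : ∀ (γ : Tuple j) δ → (∃₂ λ n (u : Fin n → Expr j) → IsRoot u γ δ) →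
    ∃₂ λ n (u : Fin n → Expr j) → IsRoot u γ δ × PowersIndependent n γ δ
  minimalRelation γ δ some with least _ some
  ... | n , (u , root) , minimal = n , u , root , independent
    where
    independent : PowersIndependent n γ δ
    independent v vδ≈0 with normalise γ δ v
    ... | inj₁ v≈0 = v≈0
    ... | inj₂ (m , m<n , a , w , a≉0 , eq) =
      contradiction (w , zero-product (trans (sym eq) vδ≈0) a≉0) (minimal m m<n)

  hasRoot : (u : Fin (suc n) → Carrier) → ∃ λ x → horner 1# u x ≈ 0#
  hasRoot {n} u =
    let x , eq = algebraicallyClosed (toList u) n ((λ eq → 1≉0 (trans (sym (leading u)) eq)) , above u)
    in x , trans (eval-toList u x) eq
    where
    toList : ∀ {n} → (Fin n → Carrier) → List Carrier
    toList u = tabulate u ++ [ 1# ]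
    leading : ∀ {n} (u : Fin n → Carrier) → K̄[X].coeff (toList u) n ≈ 1#
    leading {zero}  u = refl
    leading {suc n} u = leading (u ∘ suc)
    above : ∀ {n} (u : Fin n → Carrier) i → n < i → K̄[X].coeff (toList u) i ≈ 0#
    above {zero}  u (suc i) _         = refl
    above {suc n} u (suc i) (s≤s n<i) = above (u ∘ suc) i n<i
    eval-toList : ∀ {n} (u : Fin n → Carrier) x → horner 1# u x ≈ K̄[X].eval (toList u) x
    eval-toList {zero}  u x = sym (trans (+-congˡ (zeroʳ x)) (+-identityʳ 1#))
    eval-toList {suc n} u x = +-congˡ (*-congˡ (eval-toList (u ∘ suc) x))

  -- γ and γ′ being conjugate, so are δ and any root δ′ of the transported minimal polynomial of δ.
  spec-extend : {γ γ′ : Tuple j} → Spec γ γ′ → ∀ δ → (∃₂ λ n (u : Fin n → Expr j) → IsRoot u γ δ) →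
                ∃ λ δ′ → Spec (δ ∷ᶠ γ) (δ′ ∷ᶠ γ′)
  spec-extend {j} {γ = γ} {γ′} spec δ some with minimalRelation γ δ some
  ... | n , u , root , independent = let δ′ , root′ = rootOf n u root in δ′ , extended u root independent root′
    where
    rootOf : ∀ n (u : Fin n → Expr j) → IsRoot u γ δ → ∃ (IsRoot u γ′)
    rootOf zero    u 1≈0  = contradiction 1≈0 1≉0
    rootOf (suc n) u root = hasRoot (eval γ′ ∘ u)
    extended : ∀ {n} (u : Fin n → Expr j) → IsRoot u γ δ → PowersIndependent n γ δ → ∀ {δ′} →
               IsRoot u γ′ δ′ → Spec (δ ∷ᶠ γ) (δ′ ∷ᶠ γ′)
    extended u root independent {δ′} root′ e eq = trans (sym (at-reduce u γ′ δ′ root′ e))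
      (horner-zero (eval _ ∘ reduce u e) δ′ refl λ i → spec (reduce u e i)
        (independent (reduce u e) (trans (at-reduce u γ δ root e) eq) i))

-- Linear algebra over K: dependence, bases of expressions, degrees in towers.

module LinearSystem (em : ∀ {a} → ExcludedMiddle a) (F : HeytingField c ℓ₁ ℓ₂) where
  open Classical em
  open FieldProperties em F using (1≉0; inverse)
  open CommutativeRing (fieldRing F) hiding (zero)
  open import Algebra.Definitions.RawMonoid +-rawMonoid using (sum)
  open import Algebra.Properties.CommutativeMonoid.Sum +-commutativeMonoid
    using (sum-cong-≋; sum-replicate-zero; sum-remove; ∑-distrib-+)
  open import Algebra.Properties.Semiring.Sum semiring using (*-distribʳ-sum)
  open import Algebra.Properties.Ring ring using (-‿distribˡ-*)
  open import Relation.Binary.Reasoning.Setoid setoid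

  dependent : (A : Fin (suc n) → Fin n → Carrier) → ∃ λ (y : Fin (suc n) → Carrier) →
              (∃ λ k → y k ≉ 0#) × (∀ i → sum (λ k → y k * A k i) ≈ 0#)
  dependent {zero}  A = (λ _ → 1#) , (zero , 1≉0) , λ ()
  dependent {suc n} A with dec (∃ λ k → A k zero ≉ 0#)
  -- Column zero vanishes throughout: one row is dropped by the coefficient 0, and the others have
  -- one column fewer.
  ... | no none with dependent (λ k i → A (suc k) (suc i))
  ...   | y , (k , yk≉0) , eqs = 0# ∷ᶠ y , (suc k , yk≉0) , λ where
    zero    → trans (sum-cong-≋ λ k → trans (*-congˡ {(0# ∷ᶠ y) k}
                (byContradiction λ Ak≉0 → none (k , Ak≉0))) (zeroʳ _)) (sum-replicate-zero (suc (suc n)))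
    (suc i) → trans (+-cong (zeroˡ _) (eqs i)) (+-identityˡ _)
  dependent {suc n} A | yes (p , Ap≉0) with inverse Ap≉0
  ... | b , eq = insertAt z p s , nonzero , solves
    where
    -- Adding `d k` times the pivot row clears column zero of row `punchIn p k`; `s` below is the
    -- total multiple of the pivot row used by the dependency `z`.
    d : Fin (suc n) → Carrier
    d k = - (A (punchIn p k) zero * b)
    B : Fin (suc n) → Fin (suc n) → Carrier
    B k i = d k * A p i + A (punchIn p k) i
    rec = dependent λ k i → B k (suc i)
    z = proj₁ rec
    s = sum λ k → z k * d k
    y = insertAt z p s
    nonzero : ∃ λ k → y k ≉ 0#
    nonzero = let k , zk≉0 = proj₁ (proj₂ rec) in
      punchIn p k , λ yk≈0 → zk≉0 (trans (reflexive (≡.sym (insertAt-punchIn z p s k))) yk≈0)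
    column-zero : ∀ k → B k zero ≈ 0#
    column-zero k = begin
      - (x * b) * A p zero + x     ≈⟨ +-congʳ (-‿distribˡ-* _ _) ⟨
      - (x * b * A p zero) + x     ≈⟨ +-congʳ (-‿cong (trans (*-assoc x b _) (*-congˡ (trans (*-comm b _) eq)))) ⟩
      - (x * 1#) + x               ≈⟨ +-congʳ (-‿cong (*-identityʳ x)) ⟩
      - x + x                          ≈⟨ -‿inverseˡ x ⟩
      0#                                 ∎
      where x = A (punchIn p k) zero
    B-column : ∀ i → sum (λ k → z k * B k i) ≈ 0#
    B-column zero    = trans (sum-cong-≋ {x = λ k → z k * B k zero} λ k → trans (*-congˡ {z k} (column-zero k)) (zeroʳ (z k)))
                               (sum-replicate-zero (suc n))
    B-column (suc i) = proj₂ (proj₂ rec) i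
    solves : ∀ i → sum (λ k → y k * A k i) ≈ 0#
    solves i = begin
      sum (λ k → y k * A k i)
        ≈⟨ sum-remove {i = p} (λ k → y k * A k i) ⟩
      y p * A p i + sum (λ k → y (punchIn p k) * A (punchIn p k) i)
        ≈⟨ +-cong (*-congʳ (reflexive (insertAt-lookup z p s)))
                    (sum-cong-≋ λ k → *-congʳ {A (punchIn p k) i} (reflexive (insertAt-punchIn z p s k))) ⟩
      s * A p i + sum (λ k → z k * A (punchIn p k) i)
        ≈⟨ +-congʳ (*-distribʳ-sum (A p i) (λ k → z k * d k)) ⟩
      sum (λ k → z k * d k * A p i) + sum (λ k → z k * A (punchIn p k) i)
        ≈⟨ ∑-distrib-+ (λ k → z k * d k * A p i) (λ k → z k * A (punchIn p k) i) ⟨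
      sum (λ k → z k * d k * A p i + z k * A (punchIn p k) i)
        ≈⟨ sum-cong-≋ {y = λ k → z k * B k i} (λ k →
             trans (+-congʳ (*-assoc (z k) (d k) (A p i))) (sym (distribˡ (z k) (d k * A p i) (A (punchIn p k) i)))) ⟩
      sum (λ k → z k * B k i)
        ≈⟨ B-column i ⟩
      0# ∎

module LinearAlgebra (em : ∀ {a} → ExcludedMiddle a)
                     {c ℓ₁ ℓ₂ c′ ℓ₁′ ℓ₂′ : Level}
                     (K : HeytingField c ℓ₁ ℓ₂) (C : AlgebraicClosure K c′ ℓ₁′ ℓ₂′) where
  open Classical em
  open AlgebraicClosure C
  open Adjunction C
  open CommutativeRing (fieldRing K̄) hiding (zero)
  open Expressions em K C
  open LinearSystem em K using (dependent)
  open import Algebra.Definitions.RawMonoid +-rawMonoid using (sum)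
  open import Algebra.Properties.Monoid.Sum +-monoid using (sum-cong-≋; sum-replicate-zero)
  open import Algebra.Properties.CommutativeMonoid.Sum +-commutativeMonoid using (∑-comm)
  open import Algebra.Properties.Semiring.Sum semiring using (*-distribˡ-sum; *-distribʳ-sum)
  open import Relation.Binary.Reasoning.Setoid setoid
  import Algebra.Definitions.RawMonoid K.+-rawMonoid as Kᴹ
  import Algebra.Properties.CommutativeMonoid.Sum K.+-commutativeMonoid as Kˢ

  combination : (Fin n → K.Carrier) → (Fin n → Carrier) → Carrier
  combination x s = sum λ i → ι (x i) * s i

  ι-sum : (x : Fin n → K.Carrier) → ι (Kᴹ.sum x) ≈ sum (ι ∘ x)
  ι-sum {zero}  x = ι.0#-homo
  ι-sum {suc n} x = trans (ι.+-homo _ _) (+-congˡ (ι-sum (x ∘ suc)))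

  combination-zero : (x : Fin n → K.Carrier) (s : Fin n → Carrier) → (∀ i → x i K.≈ K.0#) → combination x s ≈ 0#
  combination-zero {n} x s x≈0 = trans (sum-cong-≋ λ i →
    trans (*-congʳ (trans (ι.⟦⟧-cong (x≈0 i)) ι.0#-homo)) (zeroˡ (s i))) (sum-replicate-zero n)

  combination-combination : (y : Fin m → K.Carrier) (A : Fin m → Fin n → K.Carrier) (s : Fin n → Carrier) →
    sum (λ k → ι (y k) * combination (A k) s) ≈ combination (λ i → Kᴹ.sum λ k → y k K.* A k i) s
  combination-combination y A s = begin
    sum (λ k → ι (y k) * combination (A k) s)
      ≈⟨ sum-cong-≋ (λ k → *-distribˡ-sum (ι (y k)) λ i → ι (A k i) * s i) ⟩
    sum (λ k → sum λ i → ι (y k) * (ι (A k i) * s i))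
      ≈⟨ ∑-comm (λ k i → ι (y k) * (ι (A k i) * s i)) ⟩
    sum (λ i → sum λ k → ι (y k) * (ι (A k i) * s i))
      ≈⟨ sum-cong-≋ (λ i → sum-cong-≋ {y = λ k → ι (y k K.* A k i) * s i} λ k →
           trans (sym (*-assoc (ι (y k)) (ι (A k i)) (s i))) (*-congʳ (sym (ι.*-homo (y k) (A k i))))) ⟩
    sum (λ i → sum λ k → ι (y k K.* A k i) * s i)
      ≈⟨ sum-cong-≋ (λ i → *-distribʳ-sum (s i) λ k → ι (y k K.* A k i)) ⟨
    sum (λ i → sum (λ k → ι (y k K.* A k i)) * s i)
      ≈⟨ sum-cong-≋ (λ i → *-congʳ (ι-sum λ k → y k K.* A k i)) ⟨
    combination (λ i → Kᴹ.sum λ k → y k K.* A k i) s ∎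

  Independent : (Fin n → Carrier) → Set _
  Independent s = ∀ x → combination x s ≈ 0# → ∀ i → x i K.≈ K.0#

  -- A nontrivial relation x among the s i would give n + 1 rows in Kⁿ: x itself
  -- and the coordinates of the b k.  A dependency between the rows must then be trivial.
  spanning⇒independent : (s b : Fin n → Carrier) → (∀ k → ∃ λ x → b k ≈ combination x s) →
                         Independent b → Independent s
  spanning⇒independent {n} s b spans b-indep x xs≈0 i = byContradiction λ xi≉0 → contradict xi≉0
    where
    A : Fin (suc n) → Fin n → K.Carrier
    A = x ∷ᶠ (proj₁ ∘ spans)
    rows = dependent A
    y = proj₁ rows
    tail≈0 : ∀ k → y (suc k) K.≈ K.0#
    tail≈0 = b-indep (y ∘ suc) (begin
      combination (y ∘ suc) b
        ≈⟨ sum-cong-≋ (λ k → *-congˡ (proj₂ (spans k))) ⟩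
      sum (λ k → ι (y (suc k)) * combination (A (suc k)) s)
        ≈⟨ +-identityˡ _ ⟨
      0# + sum (λ k → ι (y (suc k)) * combination (A (suc k)) s)
        ≈⟨ +-congʳ (trans (*-congˡ xs≈0) (zeroʳ _)) ⟨
      sum (λ k → ι (y k) * combination (A k) s)
        ≈⟨ combination-combination y A s ⟩
      combination (λ i → Kᴹ.sum λ k → y k K.* A k i) s
        ≈⟨ combination-zero (λ i → Kᴹ.sum λ k → y k K.* A k i) s (proj₂ (proj₂ rows)) ⟩
      0# ∎)
    head≈0 : x i K.≉ K.0# → y zero K.≈ K.0#
    head≈0 xi≉0 = Kₚ.zero-product (K.trans (K.*-comm (x i) (y zero)) (K.trans (K.sym (K.+-identityʳ _))
      (K.trans (K.+-congˡ (K.sym (K.trans (Kˢ.sum-cong-≋ λ k → K.trans (K.*-congʳ (tail≈0 k)) (K.zeroˡ _))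
                                           (Kˢ.sum-replicate-zero n))))
               (proj₂ (proj₂ rows) i)))) xi≉0
    contradict : x i K.≉ K.0# → ⊥
    contradict xi≉0 with proj₁ (proj₂ rows)
    ... | zero  , y≉0 = y≉0 (head≈0 xi≉0)
    ... | suc k , y≉0 = y≉0 (tail≈0 k)

  -- The coefficients are chosen before the tuple, so one rewriting serves all of `X`. For a single
  -- tuple this is ordinary spanning; for all arrangements of roots it is what carries relations
  -- from one arrangement to another.
  Spans : Pred (Tuple j) a → (Fin n → Expr j) → Set _
  Spans X s = ∀ e → ∃ λ x → ∀ γ → γ ∈ X → eval γ e ≈ combination x (eval γ ∘ s)

  -- The products s i · Xˡ for l < d, where X is the newest variable.
  products : ∀ d → (Fin n → Expr j) → Fin (d *ᴺ n) → Expr (suc j)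
  products {n} (suc d) s i = [ rename suc ∘ s , (λ i → var zero ⊗ products d s i) ]′ (splitAt n i)

  sum-++ : ∀ m (h : Fin (m +ᴺ n) → Carrier) → sum h ≈ sum (λ i → h (i ↑ˡ n)) + sum (λ i → h (m ↑ʳ i))
  sum-++ zero    h = sym (+-identityˡ _)
  sum-++ (suc m) h = trans (+-congˡ (sum-++ m (h ∘ suc))) (sym (+-assoc _ _ _))

  combination-products : ∀ d (s : Fin n → Expr j) x γ δ →
    combination x (eval (δ ∷ᶠ γ) ∘ products (suc d) s) ≈
    combination (λ i → x (i ↑ˡ d *ᴺ n)) (eval γ ∘ s) +
    δ * combination (λ i → x (n ↑ʳ i)) (eval (δ ∷ᶠ γ) ∘ products d s)
  combination-products {n} d s x γ δ = trans (sum-++ n λ i → ι (x i) * eval (δ ∷ᶠ γ) (products (suc d) s i)) (+-cong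
    (sum-cong-≋ λ i → *-congˡ (reflexive (≡.trans
      (≡.cong (λ z → eval (δ ∷ᶠ γ) ([ rename suc ∘ s , (λ i → var zero ⊗ products d s i) ]′ z)) (Finₚ.splitAt-↑ˡ n i (d *ᴺ n)))
      (eval-rename (δ ∷ᶠ γ) suc (s i)))))
    (trans (sum-cong-≋ λ i → trans (*-congˡ (reflexive (≡.cong
        (λ z → eval (δ ∷ᶠ γ) ([ rename suc ∘ s , (λ i → var zero ⊗ products d s i) ]′ z)) (Finₚ.splitAt-↑ʳ n (d *ᴺ n) i))))
        (trans (sym (*-assoc _ _ _)) (trans (*-congʳ (*-comm _ δ)) (*-assoc _ _ _))))
      (sym (*-distribˡ-sum δ λ i → ι (x (n ↑ʳ i)) * eval (δ ∷ᶠ γ) (products d s i)))))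

  module _ {s : Fin n → Expr j} where

    expand : ∀ {X : Pred (Tuple j) a} → Spans X s → ∀ {d} (v : Fin d → Expr j) →
             ∃ λ x → ∀ γ δ → γ ∈ X → horner 0# (eval γ ∘ v) δ ≈ combination x (eval (δ ∷ᶠ γ) ∘ products d s)
    expand spans {zero}  v = (λ ()) , λ _ _ _ → refl
    expand spans {suc d} v with spans (v zero) | expand spans (v ∘ suc)
    ... | x , x-eq | y , y-eq = z , λ γ δ γ∈X → begin
      eval γ (v zero) + δ * horner 0# (eval γ ∘ v ∘ suc) δ
        ≈⟨ +-cong (x-eq γ γ∈X) (*-congˡ (y-eq γ δ γ∈X)) ⟩
      combination x (eval γ ∘ s) + δ * combination y (eval (δ ∷ᶠ γ) ∘ products d s)
        ≈⟨ +-cong (sum-cong-≋ λ i → *-congʳ (reflexive (≡.cong (ι ∘ [ x , y ]′) (Finₚ.splitAt-↑ˡ n i (d *ᴺ n)))))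
                  (*-congˡ (sum-cong-≋ λ i → *-congʳ (reflexive (≡.cong (ι ∘ [ x , y ]′) (Finₚ.splitAt-↑ʳ n (d *ᴺ n) i))))) ⟨
      combination (λ i → z (i ↑ˡ d *ᴺ n)) (eval γ ∘ s) + δ * combination (λ i → z (n ↑ʳ i)) (eval (δ ∷ᶠ γ) ∘ products d s)
        ≈⟨ combination-products d s z γ δ ⟨
      combination z (eval (δ ∷ᶠ γ) ∘ products (suc d) s) ∎
      where
      z : Fin (n +ᴺ d *ᴺ n) → K.Carrier
      z i = [ x , y ]′ (splitAt n i)

    -- Grouped by powers of δ, the coefficients are K-combinations of the `s i`; independence of the
    -- latter therefore traces their vanishing back to `x`.
    collect : ∀ d (x : Fin (d *ᴺ n) → K.Carrier) → ∃ λ (v : Fin d → Expr j) → ∀ γ δ →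
      combination x (eval (δ ∷ᶠ γ) ∘ products d s) ≈ horner 0# (eval γ ∘ v) δ ×
      (Independent (eval γ ∘ s) → (∀ i → eval γ (v i) ≈ 0#) → ∀ i → x i K.≈ K.0#)
    collect zero    x = (λ ()) , λ γ δ → refl , λ _ _ ()
    collect (suc d) x with collect d (λ i → x (n ↑ʳ i))
    ... | v , v-spec = row ∷ᶠ v , λ γ δ →
      trans (combination-products d s x γ δ) (+-cong (sym (eval-row γ)) (*-congˡ (proj₁ (v-spec γ δ)))) ,
      λ indep v≈0 i → ≡.subst (λ i → x i K.≈ K.0#) (Finₚ.join-splitAt n (d *ᴺ n) i)
        (vanishes γ δ indep v≈0 (splitAt n i))
      where
      linear : ∀ {n} → (Fin n → K.Carrier) → (Fin n → Expr j) → Expr j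
      linear {zero}  x s = con K.0#
      linear {suc n} x s = con (x zero) ⊗ s zero ⊕ linear (x ∘ suc) (s ∘ suc)
      eval-linear : ∀ {n} γ x (s : Fin n → Expr j) → eval γ (linear x s) ≈ combination x (eval γ ∘ s)
      eval-linear {zero}  γ x s = ι.0#-homo
      eval-linear {suc n} γ x s = +-congˡ (eval-linear γ (x ∘ suc) (s ∘ suc))
      row = linear (λ i → x (i ↑ˡ d *ᴺ n)) s
      eval-row : ∀ γ → eval γ row ≈ combination (λ i → x (i ↑ˡ d *ᴺ n)) (eval γ ∘ s)
      eval-row γ = eval-linear γ _ s
      vanishes : ∀ γ δ → Independent (eval γ ∘ s) → (∀ i → eval γ ((row ∷ᶠ v) i) ≈ 0#) →
                 ∀ z → x (Fin.join n (d *ᴺ n) z) K.≈ K.0#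
      vanishes γ δ indep v≈0 (inj₁ i) = indep _ (trans (sym (eval-row γ)) (v≈0 zero)) i
      vanishes γ δ indep v≈0 (inj₂ i) = proj₂ (v-spec γ δ) indep (v≈0 ∘ suc) i

    -- The spanning half of the degree formula, uniformly in the tuple: `reduce` brings the degree
    -- in the newest variable below d, and `expand` rewrites the coefficients in terms of `s`.
    spans-step : ∀ {X : Pred (Tuple j) a} {X′ : Pred (Tuple (suc j)) a′} {d} (u : Fin d → Expr j) →
                 (∀ γ → γ ∈ X′ → (γ ∘ suc) ∈ X × IsRoot u (γ ∘ suc) (γ zero)) →
                 Spans X s → Spans X′ (products d s)
    spans-step {d = d} u decompose spans e with expand spans (reduce u e)
    ... | x , eq = x , λ γ γ∈X′ → let γ∈X , root = decompose γ γ∈X′ in begin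
      eval γ e
        ≈⟨ eval-cong {γ = γ} {γ′ = γ zero ∷ᶠ (γ ∘ suc)} (λ { zero → refl ; (suc _) → refl }) e ⟩
      eval (γ zero ∷ᶠ (γ ∘ suc)) e
        ≈⟨ at-reduce u (γ ∘ suc) (γ zero) root e ⟨
      horner 0# (eval (γ ∘ suc) ∘ reduce u e) (γ zero)
        ≈⟨ eq (γ ∘ suc) (γ zero) γ∈X ⟩
      combination x (eval (γ zero ∷ᶠ (γ ∘ suc)) ∘ products d s)
        ≈⟨ sum-cong-≋ (λ i → *-congˡ {ι (x i)} (eval-cong {γ′ = γ}
             (λ { zero → refl ; (suc _) → refl }) (products d s i))) ⟩
      combination x (eval γ ∘ products d s) ∎

    -- The independence half: the powers of δ are separated over K(γ) first, then the `s i` over K.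
    independent-step : ∀ {γ δ d} → Independent (eval γ ∘ s) → PowersIndependent d γ δ →
                       Independent (eval (δ ∷ᶠ γ) ∘ products d s)
    independent-step {γ} {δ} {d} indep powers x eq =
      let v , v-spec = collect d x; v-eq , v≈0⇒x≈0 = v-spec γ δ
      in v≈0⇒x≈0 indep (powers v (trans (sym v-eq) eq))

  closed : Expr 0 → K.Carrier
  closed (con x)  = x
  closed (e ⊕ e′) = closed e K.+ closed e′
  closed (e ⊗ e′) = closed e K.* closed e′

  eval-closed : ∀ γ e → eval γ e ≈ ι (closed e)
  eval-closed γ (con x)  = refl
  eval-closed γ (e ⊕ e′) = trans (+-cong (eval-closed γ e) (eval-closed γ e′)) (sym (ι.+-homo _ _))
  eval-closed γ (e ⊗ e′) = trans (*-cong (eval-closed γ e) (eval-closed γ e′)) (sym (ι.*-homo _ _))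

  unit : Fin 1 → Expr 0
  unit _ = con K.1#

  combination-unit : ∀ (γ : Tuple 0) x → combination x (eval γ ∘ unit) ≈ ι (x zero)
  combination-unit γ x = trans (+-identityʳ _) (trans (*-congˡ ι.1#-homo) (*-identityʳ _))

  spans-unit : {X : Pred (Tuple 0) a} → Spans X unit
  spans-unit e = (λ _ → closed e) , λ γ _ → trans (eval-closed γ e) (sym (combination-unit γ λ _ → closed e))

  independent-unit : (γ : Tuple 0) → Independent (eval γ ∘ unit)
  independent-unit γ x eq zero = ι-injective (trans (sym (combination-unit γ x)) eq)

  -- Basis elements are expressions and not elements of K̄, so that adjoining a root can multiply
  -- them by powers of the new variable.
  record Basis (γ : Tuple j) (n : ℕ) : Set (c ⊔ ℓ₁ ⊔ c′ ⊔ ℓ₁′) where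
    field
      elements    : Fin n → Expr j
      spans       : Spans (_≡ γ) elements
      independent : Independent (eval γ ∘ elements)

  basis-unit : (γ : Tuple 0) → Basis γ 1
  basis-unit γ = record { elements = unit ; spans = spans-unit ; independent = independent-unit γ }

  basis-step : ∀ {γ : Tuple j} {δ} {d} (u : Fin d → Expr j) → IsRoot u γ δ → PowersIndependent d γ δ →
               Basis γ n → Basis (δ ∷ᶠ γ) (d *ᴺ n)
  basis-step {d = d} u root powers basis = record
    { elements    = products d elements
    ; spans       = spans-step {s = elements} u (λ { _ ≡.refl → ≡.refl , root }) spans
    ; independent = independent-step {s = elements} {d = d} independent powers
    }
    where open Basis basis

  basis⇒degree : ∀ {b} {B : Pred Carrier b} {γ : Tuple j} → (∀ i → γ i ∈ B) →
                 (∀ {x} → x ∈ B → ∃ λ i → γ i ≈ x) → Basis γ n → [ K⟨ B ⟩ :K]≡ n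
  basis⇒degree {γ = γ} γ∈B cov record { elements = s ; spans = spans ; independent = indep } = record
    { basis       = eval γ ∘ s
    ; basis∈L     = λ i → fromExpr γ (gen ∘ γ∈B) (s i)
    ; independent = indep
    ; spanning    = λ y∈ → let e , eq = toExpr γ cov y∈; x , eq′ = spans e
                           in x , trans (sym eq) (eq′ γ ≡.refl)
    }

  -- A spanning family whose size is the degree leaves no room for a relation.
  degree⇒independent : ∀ {b} {L : Pred Carrier b} {γ : Tuple j} → (∀ {x} → x ∈ L → ∃ λ e → eval γ e ≈ x) →
    (s : Fin n → Expr j) → Spans (_≡ γ) s → [ L :K]≡ n → Independent (eval γ ∘ s)
  degree⇒independent {γ = γ} expr s spans degree = spanning⇒independent (eval γ ∘ s) basis
    (λ k → let e , eq = expr (basis∈L k); x , eq′ = spans e in x , trans (sym eq) (eq′ γ ≡.refl))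
    independent
    where open [_:K]≡_ degree

-- Division with remainder for coefficient lists.

module CoefficientLists (R : CommutativeRing c ℓ) where
  open CommutativeRing R hiding (zero)
  open Polynomial R
  open import Relation.Binary.Reasoning.Setoid setoid

  coeff-+ : ∀ p q i → coeff (p +ₚ q) i ≈ coeff p i + coeff q i
  coeff-+ []      q       i       = sym (+-identityˡ _)
  coeff-+ (x ∷ p) []      i       = sym (+-identityʳ _)
  coeff-+ (x ∷ p) (y ∷ q) zero    = refl
  coeff-+ (x ∷ p) (y ∷ q) (suc i) = coeff-+ p q i

  coeff-* : ∀ x q i → coeff (map (x *_) q) i ≈ x * coeff q i
  coeff-* x []      i       = sym (zeroʳ x)
  coeff-* x (y ∷ q) zero    = refl
  coeff-* x (y ∷ q) (suc i) = coeff-* x q i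

  coeff-tabulate-zero : (r : Fin n → Carrier) → (∀ i → r i ≈ 0#) → ∀ i → coeff (tabulate r) i ≈ 0#
  coeff-tabulate-zero {zero}  r r≈0 i       = refl
  coeff-tabulate-zero {suc n} r r≈0 zero    = r≈0 zero
  coeff-tabulate-zero {suc n} r r≈0 (suc i) = coeff-tabulate-zero (r ∘ suc) (r≈0 ∘ suc) i

  monic : (Fin n → Carrier) → Poly
  monic u = tabulate u ++ [ 1# ]

  private
    reduce-leading : (u : Fin (suc n) → Carrier) (m : Fin n → Carrier) → ∀ i →
      u (fromℕ n) * coeff (monic m) i + coeff (tabulate λ i → u (inject₁ i) - u (fromℕ n) * m i) i ≈
      coeff (tabulate u) i
    reduce-leading {zero}  u m zero    = trans (+-identityʳ _) (*-identityʳ _)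
    reduce-leading {zero}  u m (suc i) = trans (+-identityʳ _) (zeroʳ _)
    reduce-leading {suc n} u m (suc i) = reduce-leading (u ∘ suc) (m ∘ suc) i
    reduce-leading {suc n} u m zero    = begin
      lm + (u zero - lm)    ≈⟨ +-comm lm _ ⟩
      u zero - lm + lm      ≈⟨ +-assoc _ _ _ ⟩
      u zero + (- lm + lm)  ≈⟨ +-congˡ (-‿inverseˡ lm) ⟩
      u zero + 0#           ≈⟨ +-identityʳ _ ⟩
      u zero                ∎
      where lm = u (fromℕ (suc n)) * m zero

  -- If p = q m + r, then x + X p = (l + X q) m + (x + X r - l m), where l is the coefficient of Xⁿ
  -- in x + X r.
  divide : (m : Fin n → Carrier) (p : Poly) →
           ∃₂ λ q (r : Fin n → Carrier) → ∀ i → coeff p i ≈ coeff (q *ₚ monic m) i + coeff (tabulate r) i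
  divide {n} m []      = [] , (λ _ → 0#) , λ i →
    sym (trans (+-identityˡ _) (coeff-tabulate-zero {n} (λ _ → 0#) (λ _ → refl) i))
  divide {n} m (x ∷ p) with divide m p
  ... | q , r , eq = l ∷ q , r′ , λ i → begin
    coeff (x ∷ p) i
      ≈⟨ shifted i ⟩
    coeff (0# ∷ q *ₚ monic m) i + coeff (tabulate u) i
      ≈⟨ +-congˡ (reduce-leading u m i) ⟨
    coeff (0# ∷ q *ₚ monic m) i + (l * coeff (monic m) i + coeff (tabulate r′) i)
      ≈⟨ +-assoc _ _ _ ⟨
    coeff (0# ∷ q *ₚ monic m) i + l * coeff (monic m) i + coeff (tabulate r′) i
      ≈⟨ +-congʳ (trans (+-comm _ _) (+-congʳ (sym (coeff-* l (monic m) i)))) ⟩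
    coeff (map (l *_) (monic m)) i + coeff (0# ∷ q *ₚ monic m) i + coeff (tabulate r′) i
      ≈⟨ +-congʳ (coeff-+ (map (l *_) (monic m)) (0# ∷ q *ₚ monic m) i) ⟨
    coeff ((l ∷ q) *ₚ monic m) i + coeff (tabulate r′) i ∎
    where
    u : Fin (suc n) → Carrier
    u = x ∷ᶠ r
    l = u (fromℕ n)
    r′ = λ i → u (inject₁ i) - l * m i
    shifted : ∀ i → coeff (x ∷ p) i ≈ coeff (0# ∷ q *ₚ monic m) i + coeff (tabulate u) i
    shifted zero    = sym (+-identityˡ x)
    shifted (suc i) = eq i

-- Evaluation of polynomials over K at elements of the closure.

module Evaluation (em : ∀ {a} → ExcludedMiddle a)
                  {c ℓ₁ ℓ₂ c′ ℓ₁′ ℓ₂′ : Level}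
                  (K : HeytingField c ℓ₁ ℓ₂) (C : AlgebraicClosure K c′ ℓ₁′ ℓ₂′) where
  open AlgebraicClosure C
  open CommutativeRing (fieldRing K̄) hiding (zero)
  open Expressions em K C
  open K[X]
  open CoefficientLists (fieldRing K)
  open import Algebra.Solver.Ring.NaturalCoefficients.Default commutativeSemiring
    using (solve; _:+_; _:*_; _:=_)
  open import Relation.Binary.Reasoning.Setoid setoid

  evalAt-+ : ∀ p q x → evalAt (p +ₚ q) x ≈ evalAt p x + evalAt q x
  evalAt-+ []      q       x = sym (+-identityˡ _)
  evalAt-+ (y ∷ p) []      x = sym (+-identityʳ _)
  evalAt-+ (y ∷ p) (z ∷ q) x = trans
    (+-cong (ι.+-homo y z) (*-congˡ (evalAt-+ p q x)))
    (solve 5 (λ y z x p q → (y :+ z) :+ x :* (p :+ q) := (y :+ x :* p) :+ (z :+ x :* q)) refl _ _ _ _ _)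

  evalAt-scale : ∀ y q x → evalAt (map (y K.*_) q) x ≈ ι y * evalAt q x
  evalAt-scale y []      x = sym (zeroʳ _)
  evalAt-scale y (z ∷ q) x = trans
    (+-cong (ι.*-homo y z) (*-congˡ (evalAt-scale y q x)))
    (solve 4 (λ y z x q → y :* z :+ x :* (y :* q) := y :* (z :+ x :* q)) refl _ _ _ _)

  evalAt-shift : ∀ p x → evalAt (K.0# ∷ p) x ≈ x * evalAt p x
  evalAt-shift p x = trans (+-congʳ ι.0#-homo) (+-identityˡ _)

  evalAt-* : ∀ p q x → evalAt (p *ₚ q) x ≈ evalAt p x * evalAt q x
  evalAt-* []      q x = sym (zeroˡ _)
  evalAt-* (y ∷ p) q x = begin
    evalAt (map (y K.*_) q +ₚ (K.0# ∷ p *ₚ q)) x   ≈⟨ evalAt-+ (map (y K.*_) q) (K.0# ∷ p *ₚ q) x ⟩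
    evalAt (map (y K.*_) q) x + evalAt (K.0# ∷ p *ₚ q) x
      ≈⟨ +-cong (evalAt-scale y q x) (trans (evalAt-shift (p *ₚ q) x) (*-congˡ (evalAt-* p q x))) ⟩
    ι y * evalAt q x + x * (evalAt p x * evalAt q x)
      ≈⟨ solve 4 (λ y q x p → y :* q :+ x :* (p :* q) := (y :+ x :* p) :* q) refl _ _ _ _ ⟩
    (ι y + x * evalAt p x) * evalAt q x ∎

  evalAt-zero : ∀ p x → (∀ i → coeff p i K.≈ K.0#) → evalAt p x ≈ 0#
  evalAt-zero []      x p≈0 = refl
  evalAt-zero (y ∷ p) x p≈0 = trans
    (+-cong (trans (ι.⟦⟧-cong (p≈0 zero)) ι.0#-homo) (trans (*-congˡ (evalAt-zero p x (p≈0 ∘ suc))) (zeroʳ x)))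
    (+-identityˡ 0#)

  evalAt-cong : ∀ {p q} x → p ≈ₚ q → evalAt p x ≈ evalAt q x
  evalAt-cong {[]}    {q}     x p≈q = sym (evalAt-zero q x (K.sym ∘ p≈q))
  evalAt-cong {y ∷ p} {[]}    x p≈q = evalAt-zero (y ∷ p) x p≈q
  evalAt-cong {y ∷ p} {z ∷ q} x p≈q =
    +-cong (ι.⟦⟧-cong (p≈q zero)) (*-congˡ (evalAt-cong {p} {q} x (p≈q ∘ suc)))

  evalAt-monic : (u : Fin n → K.Carrier) → ∀ x → evalAt (monic u) x ≈ horner 1# (ι ∘ u) x
  evalAt-monic {zero}  u x = trans (+-congˡ (zeroʳ x)) (trans (+-identityʳ _) ι.1#-homo)
  evalAt-monic {suc n} u x = +-congˡ (*-congˡ (evalAt-monic (u ∘ suc) x))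

  evalAt-tabulate : (u : Fin n → K.Carrier) → ∀ x → evalAt (tabulate u) x ≈ horner 0# (ι ∘ u) x
  evalAt-tabulate {zero}  u x = refl
  evalAt-tabulate {suc n} u x = +-congˡ (*-congˡ (evalAt-tabulate (u ∘ suc) x))

  evalAt-1 : ∀ x → evalAt [ K.1# ] x ≈ 1#
  evalAt-1 x = trans (+-congˡ (zeroʳ x)) (trans (+-identityʳ _) ι.1#-homo)

  -- A list may end in zeros, so the vector is cut at the degree and not at the end of the list. The
  -- derivative is matched alongside for the separability argument.
  dense : ∀ p n → HasDegree p n → ∃ λ (u : Fin n → K.Carrier) → ∀ x →
    evalAt p x ≈ horner (ι (coeff p n)) (ι ∘ u) x ×
    evalAt (derivative p) x ≈ slope (ι (coeff p n)) (ι ∘ u) x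
  dense []      n       (0≉0 , _) = contradiction K.refl 0≉0
  dense (y ∷ p) zero    (_ , p≈0) = (λ ()) , λ x →
    trans (+-congˡ (trans (*-congˡ (p0 x)) (zeroʳ x))) (+-identityʳ _) ,
    trans (evalAt-+ p _ x) (trans (+-cong (p0 x) (trans (evalAt-shift (derivative p) x) (trans (*-congˡ (p′0 p (λ i → p≈0 (suc i) (s≤s z≤n)) x)) (zeroʳ x)))) (+-identityˡ 0#))
    where
    p0 : ∀ x → evalAt p x ≈ 0#
    p0 x = evalAt-zero p x λ i → p≈0 (suc i) (s≤s z≤n)
    p′0 : ∀ p → (∀ i → coeff p i K.≈ K.0#) → ∀ x → evalAt (derivative p) x ≈ 0#
    p′0 []      _   x = refl
    p′0 (y ∷ p) p≈0 x = trans (evalAt-+ p _ x) (trans (+-cong (evalAt-zero p x (p≈0 ∘ suc))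
      (trans (evalAt-shift (derivative p) x) (trans (*-congˡ (p′0 p (p≈0 ∘ suc) x)) (zeroʳ x)))) (+-identityˡ 0#))
  dense (y ∷ p) (suc n) (lead , above) with dense p n (lead , λ i n<i → above (suc i) (s≤s n<i))
  ... | u , eq = y ∷ᶠ u , λ x → +-congˡ (*-congˡ (proj₁ (eq x))) ,
    trans (evalAt-+ p _ x) (+-cong (proj₁ (eq x)) (trans (evalAt-shift (derivative p) x) (*-congˡ (proj₂ (eq x)))))

-- The roots of f: minimal polynomials, conjugates, separability.

module SplittingField (em : ∀ {a} → ExcludedMiddle a)
                      {c ℓ₁ ℓ₂ c′ ℓ₁′ ℓ₂′ : Level}
                      (K : HeytingField c ℓ₁ ℓ₂) (C : AlgebraicClosure K c′ ℓ₁′ ℓ₂′)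
                      (f : Polynomial.Poly (fieldRing K))
                      (irreducible : Polynomial.Irreducible (fieldRing K) f)
                      (separable : Polynomial.Separable (fieldRing K) f)
                      (n : ℕ) (degree : Polynomial.HasDegree (fieldRing K) f n) where
  open AlgebraicClosure C
  open CommutativeRing (fieldRing K̄) hiding (zero)
  open Expressions em K C
  open LinearAlgebra em K C using (closed; eval-closed)
  open Evaluation em K C
  open K[X]
  open CoefficientLists (fieldRing K)
  open import Algebra.Definitions.RawMagma (RawRing.*-rawMagma rawRing-Poly) using (_∣_; _,_)
  open import Relation.Binary.Reasoning.Setoid setoid

  private
    abstract
      denseForm : ∃ λ (u : Fin n → K.Carrier) → ∀ x →
        evalAt f x ≈ horner (ι (coeff f n)) (ι ∘ u) x ×
        evalAt (derivative f) x ≈ slope (ι (coeff f n)) (ι ∘ u) x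
      denseForm = dense f n degree
      lead⁻¹ : ∃ λ b → coeff f n K.* b K.≈ K.1#
      lead⁻¹ = Kₚ.inverse (proj₁ degree)

  fᵐ : Fin n → K.Carrier
  fᵐ i = proj₁ lead⁻¹ K.* proj₁ denseForm i

  private
    lead : ι (proj₁ lead⁻¹) * ι (coeff f n) ≈ 1#
    lead = trans (sym (ι.*-homo _ _)) (trans (ι.⟦⟧-cong (K.trans (K.*-comm _ _) (proj₂ lead⁻¹))) ι.1#-homo)

  horner-fᵐ : ∀ x → horner 1# (ι ∘ fᵐ) x ≈ ι (proj₁ lead⁻¹) * evalAt f x
  horner-fᵐ x = begin
    horner 1# (ι ∘ fᵐ) x
      ≈⟨ horner-cong (ι ∘ fᵐ) _ (sym lead) (λ i → ι.*-homo (proj₁ lead⁻¹) (proj₁ denseForm i)) refl ⟩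
    horner (b * ι (coeff f n)) (λ i → b * ι (proj₁ denseForm i)) x
      ≈⟨ horner-* b (ι (coeff f n)) (ι ∘ proj₁ denseForm) x ⟩
    b * horner (ι (coeff f n)) (ι ∘ proj₁ denseForm) x
      ≈⟨ *-congˡ (proj₁ (proj₂ denseForm x)) ⟨
    b * evalAt f x ∎
    where b = ι (proj₁ lead⁻¹)

  slope-fᵐ : ∀ x → slope 1# (ι ∘ fᵐ) x ≈ ι (proj₁ lead⁻¹) * evalAt (derivative f) x
  slope-fᵐ x = begin
    slope 1# (ι ∘ fᵐ) x
      ≈⟨ slope-cong (ι ∘ fᵐ) _ x (sym lead) (λ i → ι.*-homo (proj₁ lead⁻¹) (proj₁ denseForm i)) ⟩
    slope (b * ι (coeff f n)) (λ i → b * ι (proj₁ denseForm i)) x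
      ≈⟨ slope-* b (ι (coeff f n)) (ι ∘ proj₁ denseForm) x ⟩
    b * slope (ι (coeff f n)) (ι ∘ proj₁ denseForm) x
      ≈⟨ *-congˡ (proj₂ (proj₂ denseForm x)) ⟨
    b * evalAt (derivative f) x ∎
    where b = ι (proj₁ lead⁻¹)

  lead⁻¹≉0 : ι (proj₁ lead⁻¹) ≉ 0#
  lead⁻¹≉0 eq = 1≉0 (trans (sym lead) (trans (*-congʳ eq) (zeroˡ _)))

  fᵐ-root : ∀ {x} → evalAt f x ≈ 0# → horner 1# (ι ∘ fᵐ) x ≈ 0#
  fᵐ-root fx≈0 = trans (horner-fᵐ _) (trans (*-congˡ fx≈0) (zeroʳ _))

  fᵐ-root⁻¹ : ∀ {x} → horner 1# (ι ∘ fᵐ) x ≈ 0# → evalAt f x ≈ 0#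
  fᵐ-root⁻¹ eq = zero-product (trans (sym (horner-fᵐ _)) eq) lead⁻¹≉0

  -- Expressions in the empty tuple are constants, so `minimalRelation` gives a polynomial over K. A
  -- remainder modulo it that vanishes at α is zero, because the lower powers of α are independent.
  minimalPolynomial : ∀ {α} → evalAt f α ≈ 0# →
    ∃ λ m → evalAt m α ≈ 0# × (∀ p → evalAt p α ≈ 0# → m ∣ p)
  minimalPolynomial {α} fα≈0 with minimalRelation (λ ()) α (n , con ∘ fᵐ , fᵐ-root fα≈0)
  ... | d , u , root , powers = monic μ , mα≈0 , divides
    where
    μ = closed ∘ u
    mα≈0 : evalAt (monic μ) α ≈ 0#
    mα≈0 = trans (evalAt-monic μ α) (trans
      (horner-cong (ι ∘ μ) _ refl (λ i → sym (eval-closed (λ ()) (u i))) refl) root)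
    divides : ∀ p → evalAt p α ≈ 0# → monic μ ∣ p
    divides p pα≈0 with divide μ p
    ... | q , r , eq = q , λ i → K.sym (K.trans (eq i)
      (K.trans (K.+-congˡ (coeff-tabulate-zero r r≈0 i)) (K.+-identityʳ _)))
      where
      p≈ : p ≈ₚ q *ₚ monic μ +ₚ tabulate r
      p≈ i = K.trans (eq i) (K.sym (coeff-+ (q *ₚ monic μ) (tabulate r) i))
      rα≈0 : horner 0# (ι ∘ r) α ≈ 0#
      rα≈0 = begin
        horner 0# (ι ∘ r) α                             ≈⟨ evalAt-tabulate r α ⟨
        evalAt (tabulate r) α                           ≈⟨ +-identityˡ _ ⟨
        0# + evalAt (tabulate r) α                      ≈⟨ +-congʳ (trans (evalAt-* q (monic μ) α) (trans (*-congˡ mα≈0) (zeroʳ _))) ⟨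
        evalAt (q *ₚ monic μ) α + evalAt (tabulate r) α ≈⟨ evalAt-+ (q *ₚ monic μ) (tabulate r) α ⟨
        evalAt (q *ₚ monic μ +ₚ tabulate r) α           ≈⟨ evalAt-cong {p} {q *ₚ monic μ +ₚ tabulate r} α p≈ ⟨
        evalAt p α                                      ≈⟨ pα≈0 ⟩
        0#                                              ∎
      r≈0 : ∀ i → r i K.≈ K.0#
      r≈0 i = ι-injective (powers (con ∘ r) rα≈0 i)

  unit≉0 : ∀ {p} x → p ∣ [ K.1# ] → evalAt p x ≉ 0#
  unit≉0 {p} x (u , up≈1) px≈0 = 1≉0 (begin
    1#                       ≈⟨ evalAt-1 x ⟨
    evalAt [ K.1# ] x        ≈⟨ evalAt-cong {u *ₚ p} {[ K.1# ]} x up≈1 ⟨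
    evalAt (u *ₚ p) x        ≈⟨ evalAt-* u p x ⟩
    evalAt u x * evalAt p x  ≈⟨ trans (*-congˡ px≈0) (zeroʳ _) ⟩
    0#                       ∎)

  evalAt-multiple : ∀ {p q} x → p ∣ q → evalAt p x ≈ 0# → evalAt q x ≈ 0#
  evalAt-multiple {p} {q} x (u , eq) px≈0 =
    trans (sym (evalAt-cong {u *ₚ p} {q} x eq)) (trans (evalAt-* u p x) (trans (*-congˡ px≈0) (zeroʳ _)))

  -- The minimal polynomial of α is an associate of f.
  common-root : ∀ {α β} g → evalAt f α ≈ 0# → evalAt f β ≈ 0# → evalAt g α ≈ 0# → evalAt g β ≈ 0#
  common-root {α} {β} g fα≈0 fβ≈0 gα≈0 = descend (divides f fα≈0)
    where
    minimal = minimalPolynomial fα≈0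
    μ = proj₁ minimal
    divides : ∀ p → evalAt p α ≈ 0# → μ ∣ p
    divides = proj₂ (proj₂ minimal)
    descend : μ ∣ f → evalAt g β ≈ 0#
    descend (q , qm≈f) = [ associate , (λ m∣1 → contradiction (proj₁ (proj₂ minimal)) (unit≉0 {μ} α m∣1)) ]′
      (Irreducible.split-∣1 irreducible {q} {μ} (λ i → K.sym (qm≈f i)))
      where
      associate : q ∣ [ K.1# ] → evalAt g β ≈ 0#
      associate q∣1 = evalAt-multiple {μ} {g} β (divides g gα≈0) (zero-product
        (trans (sym (evalAt-* q μ β)) (trans (evalAt-cong {q *ₚ μ} {f} β qm≈f) fβ≈0)) (unit≉0 {q} β q∣1))

  -- At a common root of f and f′ its minimal polynomial divides both; separability makes that
  -- polynomial a unit, although it has a root.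
  simple : SimpleRoots (ι ∘ fᵐ)
  simple {x} fx≈0 f′x≈0 = unit≉0 {μ} x
    (separable {μ} (divides f (fᵐ-root⁻¹ fx≈0))
      (divides (derivative f) (zero-product (trans (sym (slope-fᵐ x)) f′x≈0) lead⁻¹≉0)))
    (proj₁ (proj₂ minimal))
    where
    minimal = minimalPolynomial (fᵐ-root⁻¹ fx≈0)
    μ = proj₁ minimal
    divides : ∀ p → evalAt p x ≈ 0# → μ ∣ p
    divides = proj₂ (proj₂ minimal)

  abstract
    splitting : ∃ λ (r : Fin n → Carrier) → Injective _≡_ _≈_ r × (∀ i → evalAt f (r i) ≈ 0#) ×
                (∀ {x} → evalAt f x ≈ 0# → ∃ λ i → r i ≈ x)
    splitting =
      let r , r-injective , r-root , r-complete = split hasRoot (ι ∘ fᵐ) simple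
      in r , r-injective , fᵐ-root⁻¹ ∘ r-root , r-complete ∘ fᵐ-root

  ρ : Fin n → Carrier
  ρ = proj₁ splitting

  ρ-injective : Injective _≡_ _≈_ ρ
  ρ-injective = proj₁ (proj₂ splitting)

  ρ-root : ∀ i → evalAt f (ρ i) ≈ 0#
  ρ-root = proj₁ (proj₂ (proj₂ splitting))

  ρ-complete : ∀ {x} → evalAt f x ≈ 0# → ∃ λ i → ρ i ≈ x
  ρ-complete = proj₂ (proj₂ (proj₂ splitting))

-- Galois theory on indices: specialisations, permutations, automorphisms.

module Conjugates (em : ∀ {a} → ExcludedMiddle a)
                  {c ℓ₁ ℓ₂ c′ ℓ₁′ ℓ₂′ : Level}
                  (K : HeytingField c ℓ₁ ℓ₂) (C : AlgebraicClosure K c′ ℓ₁′ ℓ₂′)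
                  (f : Polynomial.Poly (fieldRing K))
                  (irreducible : Polynomial.Irreducible (fieldRing K) f)
                  (separable : Polynomial.Separable (fieldRing K) f)
                  (n : ℕ) (degree : Polynomial.HasDegree (fieldRing K) f n) where
  open AlgebraicClosure C
  open CommutativeRing (fieldRing K̄) hiding (zero)
  open Expressions em K C
  open LinearAlgebra em K C
  open SplittingField em K C f irreducible separable n degree
  open Roots C f
  private module E {j} = Horner {A = Expr j} _⊕_ _⊗_

  eval-horner : ∀ (γ : Tuple j) t (u : Fin m → Expr j) e →
                eval γ (E.horner t u e) ≡ horner (eval γ t) (eval γ ∘ u) (eval γ e)
  eval-horner {m = zero}  γ t u e = ≡.refl
  eval-horner {m = suc _} γ t u e =
    ≡.cong (λ z → eval γ (u zero) + eval γ e * z) (eval-horner γ t (u ∘ suc) e)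

  eval-quotient : ∀ (γ : Tuple j) t (u : Fin (suc m) → Expr j) e i →
                  eval γ (E.quotient t u e i) ≡ quotient (eval γ t) (eval γ ∘ u) (eval γ e) i
  eval-quotient {m = suc _} γ t u e zero    = eval-horner γ t (u ∘ suc) e
  eval-quotient {m = suc _} γ t u e (suc i) = eval-quotient γ t (u ∘ suc) e i

  -- f divided by X − x₁, …, X − xⱼ.
  remaining : ∀ j {d} → j +ᴺ d ≡ n → ∃ λ (u : Fin d → Expr j) →
              ∀ (b : Fin j → Fin n) → Inj b → ∀ i → (∀ l → b l ≢ i) → IsRoot u (ρ ∘ b) (ρ i)
  remaining zero    ≡.refl = con ∘ fᵐ , λ _ _ i _ → fᵐ-root (ρ-root i)
  remaining (suc j) {d} eq with remaining j (≡.trans (ℕₚ.+-suc j d) eq)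
  ... | u , u-root = E.quotient (con K.1#) (rename suc ∘ u) (var zero) , λ b b-inj i b≢i →
    let γ = ρ ∘ b
        u′ = eval γ ∘ rename suc ∘ u
        lifted : ∀ {x} → IsRoot u (γ ∘ suc) x → horner (ι K.1#) u′ x ≈ 0#
        lifted root = trans (horner-cong u′ _ ι.1#-homo (λ l → reflexive (eval-rename γ suc (u l))) refl) root
    in trans
      (horner-cong _ (quotient (ι K.1#) u′ (γ zero)) (sym ι.1#-homo)
        (λ l → reflexive (eval-quotient γ (con K.1#) (rename suc ∘ u) (var zero) l)) refl)
      (quotient-root u′
        (lifted (u-root (b ∘ suc) (Finₚ.suc-injective ∘ b-inj) (b zero) λ l e → contradiction (b-inj e) λ ()))
        (lifted (u-root (b ∘ suc) (Finₚ.suc-injective ∘ b-inj) i (b≢i ∘ suc)))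
        (λ e → b≢i zero (≡.sym (ρ-injective e))))

  Arrangement : Pred (Tuple j) c′
  Arrangement {j} γ = ∃ λ (b : Fin j → Fin n) → Inj b × γ ≡ ρ ∘ b

  -- Each step reduces modulo the quotient of degree n - j, and the sizes multiply exactly as
  -- `n P′ suc j` is defined. Independence is not claimed: at a given arrangement it amounts to the
  -- degree being `n P′ j`.
  monomials : ∀ j → j ≤ n → ∃ λ (s : Fin (n P′ j) → Expr j) → Spans Arrangement s
  monomials zero    _   = unit , spans-unit
  monomials (suc j) j<n with remaining j (ℕₚ.m+[n∸m]≡n (ℕₚ.<⇒≤ j<n)) | monomials j (ℕₚ.<⇒≤ j<n)
  ... | u , u-root | s , spans = products (n ∸ j) s , spans-step u
    (λ { _ (b , b-inj , ≡.refl) → (b ∘ suc , Finₚ.suc-injective ∘ b-inj , ≡.refl) ,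
         u-root (b ∘ suc) (Finₚ.suc-injective ∘ b-inj) (b zero) λ l eq → contradiction (b-inj eq) λ () })
    spans

  -- If [K(α₁,…,αⱼ):K] = nPⱼ, then the monomials x₁^{e₁} ⋯ xⱼ^{eⱼ} with eᵢ ≤ n − i
  -- are independent at α, so a relation at α is a formal consequence of relations
  -- that hold at every arrangement of roots.
  degree⇒spec : ∀ {b} {L : Pred Carrier b} (a b : Fin j → Fin n) → Inj a → Inj b →
                (∀ {x} → x ∈ L → ∃ λ e → eval (ρ ∘ a) e ≈ x) → [ L :K]≡ (n P j) → Spec (ρ ∘ a) (ρ ∘ b)
  degree⇒spec {j} {L = L} a b a-inj b-inj expr deg e ea≈0 with monomials j j≤n
    where j≤n = Finₚ.injective⇒≤ a-inj
  ... | s , spans with spans e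
  ... | x , eq = trans (eq (ρ ∘ b) (b , b-inj , ≡.refl)) (combination-zero x (eval (ρ ∘ b) ∘ s)
    (degree⇒independent {γ = ρ ∘ a} expr s
      (λ e → let x , eq = spans e in x , λ { _ ≡.refl → eq (ρ ∘ a) (a , a-inj , ≡.refl) })
      (≡.subst ([ L :K]≡_) (P≡P′ (Finₚ.injective⇒≤ a-inj)) deg)
      x (trans (sym (eq (ρ ∘ a) (a , a-inj , ≡.refl))) ea≈0)))

  -- The Galois group, seen as the permutations of indices that preserve every relation over K among
  -- the roots.
  Permutes : (Fin n → Fin n) → Set _
  Permutes π = Inj π × Spec ρ (ρ ∘ π)

  -- The index form of `Transitive[ k ]`. The four conditions are compared with this form, and
  -- automorphisms enter only in the translation.
  Homogeneous : ℕ → Set _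
  Homogeneous k = ∀ (a b : Fin k → Fin n) → Inj a → Inj b →
                  ∃ λ π → Permutes π × (∀ i → π (a i) ≡ b i)

  module _ (a b : Fin j → Fin n) where

    -- The tuples grow as roots are adjoined one at a time, so `old` and `new` record positions. A
    -- root may be adjoined twice: equality of two entries is itself a relation and survives
    -- specialisation.
    record Extension (r : Fin m → Fin n) : Set (c ⊔ c′ ⊔ ℓ₁′) where
      field
        {size} : ℕ
        γ γ′   : Tuple size
        spec   : Spec γ γ′
        old    : Fin j → Fin size
        new    : Fin m → Fin size
        γ-old  : ∀ i → γ (old i) ≡ ρ (a i)
        γ′-old : ∀ i → γ′ (old i) ≡ ρ (b i)
        γ-new  : ∀ i → γ (new i) ≡ ρ (r i)

    extension : Spec (ρ ∘ a) (ρ ∘ b) → (r : Fin m → Fin n) → Extension r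
    extension {zero} spec r = record
      { γ = ρ ∘ a ; γ′ = ρ ∘ b ; spec = spec ; old = id ; new = λ ()
      ; γ-old = λ _ → ≡.refl ; γ′-old = λ _ → ≡.refl ; γ-new = λ () }
    extension {suc m} spec r =
      let δ′ , spec′ = spec-extend X.spec (ρ (r zero)) (n , con ∘ fᵐ , fᵐ-root (ρ-root (r zero))) in record
      { γ = ρ (r zero) ∷ᶠ X.γ ; γ′ = δ′ ∷ᶠ X.γ′ ; spec = spec′ ; old = suc ∘ X.old ; new = zero ∷ᶠ (suc ∘ X.new)
      ; γ-old = X.γ-old ; γ′-old = X.γ′-old ; γ-new = λ { zero → ≡.refl ; (suc i) → X.γ-new i } }
      where module X = Extension (extension spec (r ∘ suc))

    -- All roots are adjoined to those of `a`. Their images are roots, since f(x) = 0 is a relation;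
    -- they are distinct, since `Spec` reverses; and they agree with `b`, because the coincidence of
    -- a new entry with an old one is a relation too.
    spec⇒permutation : Spec (ρ ∘ a) (ρ ∘ b) → ∃ λ π → Permutes π × (∀ i → π (a i) ≡ b i)
    spec⇒permutation a↦b = π , (injective , π-spec) , agrees
      where
      open Extension (extension a↦b id)
      image : ∀ i → ∃ λ i′ → ρ i′ ≈ γ′ (new i)
      image i = ρ-complete (trans (sym (eval-polynomial γ′ f (var (new i))))
        (spec (polynomial f (var (new i)))
          (trans (eval-polynomial γ f (var (new i)))
            (≡.subst (λ x → evalAt f x ≈ 0#) (≡.sym (γ-new i)) (ρ-root i)))))
      π : Fin n → Fin n
      π = proj₁ ∘ image
      π-spec : Spec ρ (ρ ∘ π)
      π-spec = spec-cong (reflexive ∘ γ-new) (sym ∘ proj₂ ∘ image)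
        (spec-rename spec new)
      injective : Inj π
      injective {i} {i′} eq = ρ-injective
        (spec-≈ (spec-sym π-spec) (var i) (var i′) (reflexive (≡.cong ρ eq)))
      agrees : ∀ i → π (a i) ≡ b i
      agrees i = ρ-injective (trans (proj₂ (image (a i))) (trans
        (spec-≈ spec (var (new (a i))) (var (old i))
          (reflexive (≡.trans (γ-new (a i)) (≡.sym (γ-old i)))))
        (reflexive (γ′-old i))))

  module _ (σ : G) where
    open Automorphism σ
    private module σ = IsRingIsomorphism isRingIsomorphism

    image-root : ∀ α → evalAt f (σ · α) ≈ 0#
    -- The induction meets different membership proofs for one element, so the proof is left
    -- arbitrary; `σ.⟦⟧-cong refl` exchanges them.
    eval-σ : (r : Fin j → Root) (e : Expr j) (x∈ : eval (proj₁ ∘ r) e ∈ K⟨ R ⟩) →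
             proj₁ (⟦ eval (proj₁ ∘ r) e , x∈ ⟧) ≈ eval (λ i → σ · r i) e
    eval-σ r (con x)  x∈ = trans (σ.⟦⟧-cong refl) (fixesK x)
    eval-σ r (var i)  x∈ = σ.⟦⟧-cong refl
    eval-σ r (e ⊕ e′) x∈ = trans (σ.⟦⟧-cong refl) (trans (σ.+-homo (_ , mem e) (_ , mem e′))
      (+-cong (eval-σ r e (mem e)) (eval-σ r e′ (mem e′))))
      where mem = fromExpr (proj₁ ∘ r) (gen ∘ proj₂ ∘ r)
    eval-σ r (e ⊗ e′) x∈ = trans (σ.⟦⟧-cong refl) (trans (σ.*-homo (_ , mem e) (_ , mem e′))
      (*-cong (eval-σ r e (mem e)) (eval-σ r e′ (mem e′))))
      where mem = fromExpr (proj₁ ∘ r) (gen ∘ proj₂ ∘ r)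

    spec-σ : (r : Fin j → Root) → Spec (proj₁ ∘ r) (λ i → σ · r i)
    spec-σ r e eq = trans (sym (eval-σ r e (fromExpr (proj₁ ∘ r) (gen ∘ proj₂ ∘ r) e)))
      (trans (σ.⟦⟧-cong eq) σ.0#-homo)

    image-root α = trans (sym (eval-polynomial _ f (var zero)))
      (spec-σ {1} (λ _ → α) (polynomial f (var zero)) (trans (eval-polynomial (λ _ → proj₁ α) f (var zero)) (proj₂ α)))

    permutation : ∃ λ π → Permutes π × (∀ i → ρ (π i) ≈ σ · (ρ i , ρ-root i))
    permutation = π , (injective , spec) , proj₂ ∘ image
      where
      r : Fin n → Root
      r i = ρ i , ρ-root i
      image : ∀ i → ∃ λ i′ → ρ i′ ≈ σ · r i
      image i = ρ-complete (image-root (r i))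
      π = proj₁ ∘ image
      spec : Spec ρ (ρ ∘ π)
      spec = spec-cong (λ _ → refl) (sym ∘ proj₂ ∘ image) (spec-σ r)
      injective : Inj π
      injective {i} {i′} eq = ρ-injective (spec-≈ (spec-sym spec) (var i) (var i′) (reflexive (≡.cong ρ eq)))

  arrangedRoots : (a : Fin j → Fin n) → Inj a → Injection (≡.setoid (Fin j)) (elements R)
  arrangedRoots a a-inj = record
    { to = λ i → ρ (a i) , ρ-root (a i) ; cong = λ { ≡.refl → refl } ; injective = a-inj ∘ ρ-injective }

  transitive⇒homogeneous : ∀ {k} → Transitive[ k ] → Homogeneous k
  transitive⇒homogeneous trans-k a b a-inj b-inj with trans-k (arrangedRoots a a-inj) (arrangedRoots b b-inj)
  ... | σ , σα≈β with permutation σ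
  ... | π , permutes , eq = π , permutes , λ i → ρ-injective (trans (eq (a i)) (σα≈β i))

  module _ {π : Fin n → Fin n} (π-permutes : Permutes π) where
    private
      module L = RawRing rawRing-K⟨ R ⟩
      spec : Spec ρ (ρ ∘ π)
      spec = proj₂ π-permutes
      expr : (x : Σ Carrier K⟨ R ⟩) → ∃ λ e → eval ρ e ≈ proj₁ x
      expr (x , x∈) = toExpr ρ ρ-complete x∈
      map-root : Σ Carrier K⟨ R ⟩ → Σ Carrier K⟨ R ⟩
      map-root x = eval (ρ ∘ π) (proj₁ (expr x)) , fromExpr (ρ ∘ π) (gen ∘ ρ-root ∘ π) (proj₁ (expr x))

    -- `toExpr` picks some expression for x, and `Spec` makes the choice irrelevant. Each law of an
    -- automorphism can then be checked on a convenient expression.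
    map-root-eval : ∀ x e → eval ρ e ≈ proj₁ x → proj₁ (map-root x) ≈ eval (ρ ∘ π) e
    map-root-eval x e eq = spec-≈ spec (proj₁ (expr x)) e (trans (proj₂ (expr x)) (sym eq))

    automorphism : G
    automorphism = record
      { ⟦_⟧ = map-root
      ; isRingIsomorphism = record
        { isRingMonomorphism = record
          { isRingHomomorphism = record
            { isSemiringHomomorphism = record
              { isNearSemiringHomomorphism = record
                { +-isMonoidHomomorphism = record
                  { isMagmaHomomorphism = record
                    { isRelHomomorphism = record
                      { cong = λ {x} {y} x≈y → map-root-eval x (proj₁ (expr y)) (trans (proj₂ (expr y)) (sym x≈y)) }
                    ; homo = λ x y → map-root-eval (x L.+ y) (proj₁ (expr x) ⊕ proj₁ (expr y)) (+-cong (proj₂ (expr x)) (proj₂ (expr y))) }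
                  ; ε-homo = trans (map-root-eval L.0# (con K.0#) ι.0#-homo) ι.0#-homo }
                ; *-homo = λ x y → map-root-eval (x L.* y) (proj₁ (expr x) ⊗ proj₁ (expr y)) (*-cong (proj₂ (expr x)) (proj₂ (expr y))) }
              ; 1#-homo = trans (map-root-eval L.1# (con K.1#) ι.1#-homo) ι.1#-homo }
            ; -‿homo = λ x → trans
                (map-root-eval (L.- x) (⊖ proj₁ (expr x)) (trans (eval-neg ρ (proj₁ (expr x))) (-‿cong (proj₂ (expr x)))))
                (eval-neg (ρ ∘ π) (proj₁ (expr x))) }
          ; injective = λ {x} {y} eq → trans (sym (proj₂ (expr x)))
              (trans (spec-≈ (spec-sym spec) (proj₁ (expr x)) (proj₁ (expr y)) eq) (proj₂ (expr y))) }
        -- A preimage is found by writing the element in the permuted roots, which still cover all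
        -- roots, and evaluating the same expression at `ρ`.
        ; surjective = λ (y , y∈) →
            let e , eq = toExpr (ρ ∘ π) covers y∈
            in (eval ρ e , fromExpr ρ (gen ∘ ρ-root) e) ,
               λ {z} z≈x → trans (map-root-eval z e (sym z≈x)) eq }
      ; fixesK = λ x → map-root-eval (ι x , base x) (con x) refl }
      where
      covers : ∀ {x} → x ∈ R → ∃ λ i → ρ (π i) ≈ x
      covers fx≈0 =
        let i , eq = ρ-complete fx≈0; i′ , eq′ = injective⇒surjective π (proj₁ π-permutes) i
        in i′ , trans (reflexive (≡.cong ρ eq′)) eq

  homogeneous⇒transitive : ∀ {k} → Homogeneous k → Transitive[ k ]
  homogeneous⇒transitive hom α β =
    let π , permutes , πa≡b = hom (positions α) (positions β) (positions-injective α) (positions-injective β) in automorphism permutes , λ i →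
      trans (map-root-eval permutes (_ , gen (proj₂ (Injection.to α i))) (var (positions α i)) (proj₂ (index α i)))
        (trans (reflexive (≡.cong ρ (πa≡b i))) (proj₂ (index β i)))
    where
    index : (α : Injection (≡.setoid (Fin _)) (elements R)) → ∀ i → ∃ λ i′ → ρ i′ ≈ proj₁ (Injection.to α i)
    index α i = ρ-complete (proj₂ (Injection.to α i))
    positions : Injection (≡.setoid (Fin _)) (elements R) → Fin _ → Fin n
    positions α = proj₁ ∘ index α
    positions-injective : ∀ α → Inj (positions α)
    positions-injective α {i} {i′} eq = Injection.injective α
      (trans (sym (proj₂ (index α i))) (trans (reflexive (≡.cong ρ eq)) (proj₂ (index α i′))))

  -- An expression in one variable is a polynomial over K, so `common-root` already gives the
  -- specialisation between any two roots.
  homogeneous₁ : Homogeneous 1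
  homogeneous₁ a b _ _ = spec⇒permutation a b λ e ea≈0 → trans (sym (eval-toPoly (ρ ∘ b) e))
    (common-root (toPoly e) (ρ-root (a zero)) (ρ-root (b zero)) (trans (eval-toPoly (ρ ∘ a) e) ea≈0))
    where
    open K[X] using (Poly; _+ₚ_; _*ₚ_)
    open Evaluation em K C
    toPoly : Expr 1 → Poly
    toPoly (con x)  = [ x ]
    toPoly (var _)  = K.0# ∷ [ K.1# ]
    toPoly (e ⊕ e′) = toPoly e +ₚ toPoly e′
    toPoly (e ⊗ e′) = toPoly e *ₚ toPoly e′
    eval-toPoly : ∀ γ e → evalAt (toPoly e) (γ zero) ≈ eval γ e
    eval-toPoly γ (con x)    = trans (+-congˡ (zeroʳ _)) (+-identityʳ _)
    eval-toPoly γ (var zero) = trans (evalAt-shift [ K.1# ] (γ zero)) (trans (*-congˡ (evalAt-1 (γ zero))) (*-identityʳ _))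
    eval-toPoly γ (e ⊕ e′)   = trans (evalAt-+ (toPoly e) (toPoly e′) (γ zero)) (+-cong (eval-toPoly γ e) (eval-toPoly γ e′))
    eval-toPoly γ (e ⊗ e′)   = trans (evalAt-* (toPoly e) (toPoly e′) (γ zero)) (*-cong (eval-toPoly γ e) (eval-toPoly γ e′))

-- Generation by few roots, minimal generating sets, clusters: conditions (1) to (3).

module Clusters (em : ∀ {a} → ExcludedMiddle a)
                {c ℓ₁ ℓ₂ c′ ℓ₁′ ℓ₂′ : Level}
                (K : HeytingField c ℓ₁ ℓ₂) (C : AlgebraicClosure K c′ ℓ₁′ ℓ₂′)
                (f : Polynomial.Poly (fieldRing K))
                (irreducible : Polynomial.Irreducible (fieldRing K) f)
                (separable : Polynomial.Separable (fieldRing K) f)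
                (n : ℕ) (degree : Polynomial.HasDegree (fieldRing K) f n)
                (k : ℕ) (k<n : k < n) where
  open Classical em
  open AlgebraicClosure C
  open CommutativeRing (fieldRing K̄) hiding (zero)
  open Expressions em K C
  open SplittingField em K C f irreducible separable n degree
  open Conjugates em K C f irreducible separable n degree
  open Roots C f
  open import Relation.Binary.Reasoning.Setoid setoid

  k≤n : k ≤ n
  k≤n = ℕₚ.<⇒≤ k<n

  -- Both tuples are completed to permutations of all indices and cut off after k entries, where
  -- `hom` applies.
  homogeneous-≤ : Homogeneous k → j ≤ k → Homogeneous j
  homogeneous-≤ hom j≤k a b a-inj b-inj =
    let α , α-inj , α-extends = extend a a-inj
        β , β-inj , β-extends = extend b b-inj
        π , permutes , agrees = hom (λ i → α (inject≤ i k≤n)) (λ i → β (inject≤ i k≤n))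
          (Finₚ.inject≤-injective k≤n k≤n _ _ ∘ α-inj) (Finₚ.inject≤-injective k≤n k≤n _ _ ∘ β-inj)
        inside = λ i → Finₚ.inject≤-idempotent i j≤k k≤n (ℕₚ.≤-trans j≤k k≤n)
    in π , permutes , λ i → ≡.trans
      (≡.cong π (≡.sym (≡.trans (≡.cong α (inside i)) (α-extends (ℕₚ.≤-trans j≤k k≤n) i))))
      (≡.trans (agrees (inject≤ i j≤k)) (≡.trans (≡.cong β (inside i)) (β-extends (ℕₚ.≤-trans j≤k k≤n) i)))

  GeneratedBy : ∀ {b} → Pred Carrier b → (Fin j → Fin n) → Set _
  GeneratedBy B a = ∀ {x} → x ∈ B → ∃ λ l → ρ (a l) ≈ x

  -- A root β outside a still has another conjugate over K(a), because j + 1 ≤ k < n.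
  not-generated : Homogeneous k → (a : Fin j → Fin n) → Inj a → j < k → ∀ i → (∀ l → a l ≢ i) →
                  ∀ {b} {B : Pred Carrier b} → GeneratedBy B a → ρ i ∉ K⟨ B ⟩
  not-generated hom a a-inj j<k i a≢i gen-a ρi∈ =
    let e , e≈ρi = toExpr (ρ ∘ a) gen-a ρi∈
        i′ , i′-new = avoided (i ∷ᶠ a) (ℕₚ.≤-<-trans j<k k<n)
        π , (_ , spec) , agrees = homogeneous-≤ hom j<k (i ∷ᶠ a) (i′ ∷ᶠ a)
          (∷-injective a≢i a-inj) (∷-injective (λ l eq → i′-new (suc l) eq) a-inj)
    in i′-new zero (ρ-injective (begin
      ρ i                        ≈⟨ e≈ρi ⟨
      eval (ρ ∘ a) e             ≈⟨ eval-cong (λ l → reflexive (≡.cong ρ (agrees (suc l)))) e ⟨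
      eval (ρ ∘ π ∘ a) e         ≡⟨ eval-rename (ρ ∘ π) a e ⟨
      eval (ρ ∘ π) (rename a e)  ≈⟨ spec-≈ spec (rename a e) (var i) (trans (reflexive (eval-rename ρ a e)) e≈ρi) ⟩
      ρ (π i)                    ≡⟨ ≡.cong ρ (agrees zero) ⟩
      ρ i′                       ∎))

  adjoin-least : ∀ {b b′} {A : Pred Carrier b} {B : Pred Carrier b′} → A ⊆ K⟨ B ⟩ → K⟨ A ⟩ ⊆ K⟨ B ⟩
  adjoin-least A⊆ (base x)    = base x
  adjoin-least A⊆ (gen x∈A)   = A⊆ x∈A
  adjoin-least A⊆ (add s t)   = add (adjoin-least A⊆ s) (adjoin-least A⊆ t)
  adjoin-least A⊆ (neg s)     = neg (adjoin-least A⊆ s)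
  adjoin-least A⊆ (mul s t)   = mul (adjoin-least A⊆ s) (adjoin-least A⊆ t)
  adjoin-least A⊆ (inv s eq)  = inv (adjoin-least A⊆ s) eq
  adjoin-least A⊆ (resp eq s) = resp eq (adjoin-least A⊆ s)

  Range : (Fin j → Fin n) → Pred Carrier ℓ₁′
  Range a x = ∃ λ l → ρ (a l) ≈ x

  enumerate : ∀ {b} {Q : Pred Carrier b} → Q ⊆ R → HasCardinality (elements Q) m →
              ∃ λ (a : Fin m → Fin n) → Inj a × GeneratedBy Q a × (∀ l → ∃ λ x → x ∈ Q × ρ (a l) ≈ x)
  enumerate {m = m} {Q = Q} Q⊆R card = positions , inj , (λ {x} x∈Q →
      let l , eq = strictlySurjective (x , x∈Q) in l , trans (proj₂ (position l)) eq) ,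
      λ l → proj₁ (to l) , proj₂ (to l) , proj₂ (position l)
    where
    open Bijection card
    position : ∀ l → ∃ λ i → ρ i ≈ proj₁ (to l)
    position l = ρ-complete (Q⊆R (proj₂ (to l)))
    positions : Fin m → Fin n
    positions = proj₁ ∘ position
    inj : Inj positions
    inj {l} {l′} eq = injective (trans (sym (proj₂ (position l)))
      (trans (reflexive (≡.cong ρ eq)) (proj₂ (position l′))))

  -- Fewer than k roots leave out another one, and `not-generated` keeps it outside their field.
  generating⇒large : Homogeneous k → ∀ B → K⟨ member B ⟩ ≐ K_f → CardinalityAtLeast k B
  generating⇒large hom B (_ , K_f⊆) with subset-finite setoid ρ (λ x x∈B → ρ-complete (RootSubset.⊆R B x∈B))
  ... | m , card with enumerate (RootSubset.⊆R B) card
  ... | a , a-inj , gen-a , _ = m , card , ℕₚ.≮⇒≥ λ m<k →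
    let i , new = avoided a (ℕₚ.<-trans m<k k<n)
    in not-generated hom a a-inj m<k i new gen-a (K_f⊆ (gen (ρ-root i)))

  -- Once the position `l₀` of δ is removed, fewer than k roots are left, and `not-generated`
  -- applies to them.
  small⇒irredundant : Homogeneous k → ∀ D → CardinalityAtMost k D → ∀ δ → δ ∈ member D → δ ∉ K⟨ D ∖ δ ⟩
  small⇒irredundant hom D (m , card , m≤k) δ δ∈D δ∈K with enumerate (RootSubset.⊆R D) card
  ... | a , a-inj , gen-a , _ with gen-a δ∈D
  ... | l₀ , eq₀ = moved a a-inj m≤k gen-a l₀ eq₀
    where
    moved : ∀ {m} (a : Fin m → Fin n) → Inj a → m ≤ k → GeneratedBy (member D) a → ∀ l₀ → ρ (a l₀) ≈ δ → ⊥
    moved {suc m} a a-inj m<k gen-a l₀ eq₀ = not-generated hom (a ∘ punchIn l₀)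
      (Finₚ.punchIn-injective l₀ _ _ ∘ a-inj) m<k (a l₀) (λ l eq → Finₚ.punchInᵢ≢i l₀ l (a-inj eq))
      (λ (x∈D , x≉δ) → let l , eq = gen-a x∈D
                           l₀≢l = λ l₀≡l → x≉δ (trans (sym eq) (trans (reflexive (≡.cong (ρ ∘ a) (≡.sym l₀≡l))) eq₀))
                       in punchOut l₀≢l , trans (reflexive (≡.cong (ρ ∘ a) (Finₚ.punchIn-punchOut l₀≢l))) eq)
      (resp (sym eq₀) δ∈K)

  Generating : (Fin j → Fin n) → Set (c ⊔ ℓ₁′)
  Generating b = ∀ i → ∃ λ e → eval (ρ ∘ b) e ≈ ρ i

  Irredundant : (Fin j → Fin n) → Set (c ⊔ ℓ₁′)
  Irredundant {zero}  b = Lift _ ⊤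
  Irredundant {suc j} b = ∀ l → ¬ ∃ λ e → eval (ρ ∘ b ∘ punchIn l) e ≈ ρ (b l)

  -- All n roots generate, so a least size exists; an entry expressible through the others could be
  -- left out.
  smallestGenerating : ∃₂ λ m (b : Fin m → Fin n) → Inj b × Generating b × Irredundant b
  smallestGenerating with least (λ m → ∃ λ (b : Fin m → Fin n) → Inj b × Generating b)
                                (n , id , id , λ i → var i , refl)
  ... | m , (b , b-inj , b-gen) , minimal = m , b , b-inj , b-gen , irredundant b b-inj b-gen minimal
    where
    irredundant : ∀ {m} (b : Fin m → Fin n) → Inj b → Generating b →
                  (∀ i → i < m → ¬ ∃ λ (b : Fin i → Fin n) → Inj b × Generating b) → Irredundant b
    irredundant {zero}  b _ _ _ = lift tt
    irredundant {suc m} b b-inj b-gen minimal l₀ (e₀ , eq₀) = minimal m ℕₚ.≤-refl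
      (b ∘ punchIn l₀ , Finₚ.punchIn-injective l₀ _ _ ∘ b-inj , λ i →
        let e , eq = b-gen i in toExpr (ρ ∘ b ∘ punchIn l₀) id (resp eq (fromExpr (ρ ∘ b) inside e)))
      where
      inside : ∀ l → ρ (b l) ∈ K⟨ Range (b ∘ punchIn l₀) ⟩
      inside l with l₀ Finₚ.≟ l
      ... | yes ≡.refl = resp eq₀ (fromExpr (ρ ∘ b ∘ punchIn l₀) (λ l → gen (l , refl)) e₀)
      ... | no  l₀≢l   = gen (punchOut l₀≢l , reflexive (≡.cong (ρ ∘ b) (Finₚ.punchIn-punchOut l₀≢l)))

  rangeSubset : (Fin j → Fin n) → RootSubset
  rangeSubset b = record
    { member   = λ x → Lift c′ (Range b x)
    ; respects = λ { x≈y (lift (l , eq)) → lift (l , trans eq x≈y) }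
    ; ⊆R       = λ { (lift (l , eq)) → root-cong eq (ρ-root (b l)) } }
    where
    root-cong : ∀ {x y} → x ≈ y → x ∈ R → y ∈ R
    root-cong {x} {y} x≈y fx≈0 = trans (sym (eval-polynomial (λ _ → y) f (var {1} zero)))
      (trans (sym (eval-cong (λ _ → x≈y) (polynomial f (var {1} zero))))
        (trans (eval-polynomial (λ _ → x) f (var zero)) fx≈0))

  -- A proper subset misses some entry `ρ (b l)`, hence lies among the other entries, which do not
  -- generate it.
  irredundant⇒minimal : (b : Fin j → Fin n) → Generating b → Irredundant b → MinimalGenerating (rangeSubset b)
  irredundant⇒minimal b b-gen b-irr =
    (adjoin-least (gen ∘ RootSubset.⊆R (rangeSubset b)) ,
     adjoin-least λ x∈R → let i , eq = ρ-complete x∈R; e , eq′ = b-gen i in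
       resp (trans eq′ eq) (fromExpr (ρ ∘ b) (λ l → gen (lift (l , refl))) e)) ,
    λ A (A⊆B , B⊈A) (_ , K_f⊆) → B⊈A λ { {x} (lift (l , eq)) → byContradiction λ x∉A →
      missing b b-irr l A (lower ∘ A⊆B) (λ ρbl∈A → x∉A (RootSubset.respects A eq ρbl∈A)) K_f⊆ }
    where
    missing : ∀ {j} (b : Fin j → Fin n) → Irredundant b → ∀ l A → member A ⊆ Range b → ρ (b l) ∉ member A →
              ¬ (K_f ⊆ K⟨ member A ⟩)
    missing {suc j} b b-irr l A A⊆b bl∉A K_f⊆ = b-irr l (toExpr (ρ ∘ b ∘ punchIn l)
      (λ {x} x∈A → let l′ , eq = A⊆b x∈A
                       l≢l′ = λ l≡l′ → bl∉A (RootSubset.respects A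
                                (trans (sym eq) (reflexive (≡.cong (ρ ∘ b) (≡.sym l≡l′)))) x∈A)
                   in punchOut l≢l′ , trans (reflexive (≡.cong (ρ ∘ b) (Finₚ.punchIn-punchOut l≢l′))) eq)
      (K_f⊆ (gen (ρ-root (b l)))))

  module _ {π : Fin n → Fin n} (permutes : Permutes π) where

    permute-generating : (b : Fin j → Fin n) → Generating b → Generating (π ∘ b)
    permute-generating b b-gen i =
      let i′ , πi′≡i = injective⇒surjective π (proj₁ permutes) i; e , eq = b-gen i′
      in e , trans (reflexive (≡.sym (eval-rename (ρ ∘ π) b e)))
               (trans (spec-≈ (proj₂ permutes) (rename b e) (var i′) (trans (reflexive (eval-rename ρ b e)) eq))
                 (reflexive (≡.cong ρ πi′≡i)))

    permute-irredundant : (b : Fin j → Fin n) → Irredundant b → Irredundant (π ∘ b)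
    permute-irredundant {zero}  b _         = lift tt
    permute-irredundant {suc j} b b-irr l (e , eq) = b-irr l (e ,
      trans (reflexive (≡.sym (eval-rename ρ (b ∘ punchIn l) e)))
        (spec-≈ (spec-sym (proj₂ permutes)) (rename (b ∘ punchIn l) e) (var (b l))
          (trans (reflexive (eval-rename (ρ ∘ π) (b ∘ punchIn l) e)) eq)))

  small⇒extendable : Homogeneous k → ∀ D → CardinalityAtMost k D →
                     ∃ λ B → MinimalGenerating B × member D ⊆ member B
  small⇒extendable hom D (j , card , j≤k) with smallestGenerating | enumerate (RootSubset.⊆R D) card
  ... | m , b , b-inj , b-gen , b-irr | a , a-inj , gen-a , _ =
    let π , permutes , agrees = homogeneous-≤ hom j≤k (λ l → b (inject≤ l j≤m)) a
          (Finₚ.inject≤-injective j≤m j≤m _ _ ∘ b-inj) a-inj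
    in rangeSubset (π ∘ b) ,
       irredundant⇒minimal (π ∘ b) (permute-generating permutes b b-gen) (permute-irredundant permutes b b-irr) ,
       λ x∈D → let l , eq = gen-a x∈D in
         lift (inject≤ l j≤m , trans (reflexive (≡.cong ρ (agrees l))) eq)
    where
    -- The smallest generating tuple must have at least k entries, so that its first j can be moved
    -- onto those of `D`.
    k≤m : k ≤ m
    k≤m = ℕₚ.≮⇒≥ λ m<k →
      let i , new = avoided b (ℕₚ.<-trans m<k k<n); e , eq = b-gen i
      in not-generated hom b b-inj m<k i new {B = Range b} id
           (resp eq (fromExpr (ρ ∘ b) (λ l → gen (l , refl)) e))
    j≤m : j ≤ m
    j≤m = ℕₚ.≤-trans j≤k k≤m

  -- All clusters are singletons, in index form; r_K(f) = 1 and s_K(f) = n both follow from it.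
  Separated : Set _
  Separated = ∀ {i i′} → Kᴸ⟨ [ ρ i ] ⟩ ≐ Kᴸ⟨ [ ρ i′ ] ⟩ → i ≡ i′

  Kᴸ-cong : ∀ {x y} → x ≈ y → Kᴸ⟨ [ x ] ⟩ ≐ Kᴸ⟨ [ y ] ⟩
  Kᴸ-cong x≈y = adjoin-least (λ { (here z≈x) → gen (here (trans z≈x x≈y)) }) ,
                adjoin-least (λ { (here z≈y) → gen (here (trans z≈y (sym x≈y))) })

  ≐-trans : ∀ {F G H : Field} → F ≐ G → G ≐ H → F ≐ H
  ≐-trans (F⊆G , G⊆F) (G⊆H , H⊆G) = (λ x∈ → G⊆H (F⊆G x∈)) , λ x∈ → G⊆F (H⊆G x∈)

  ≐-sym : ∀ {F G : Field} → F ≐ G → G ≐ F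
  ≐-sym (F⊆G , G⊆F) = G⊆F , F⊆G

  -- The one-entry case of `not-generated`, hence the requirement 1 < k.
  homogeneous⇒separated : Homogeneous k → 2 ≤ k → Separated
  homogeneous⇒separated hom 2≤k {i} {i′} (Ki⊆ , _) with i′ Finₚ.≟ i
  ... | yes i′≡i = ≡.sym i′≡i
  ... | no  i′≢i = contradiction (Ki⊆ (gen (here refl)))
    (not-generated hom (λ (_ : Fin 1) → i′) (λ { {zero} {zero} _ → ≡.refl }) 2≤k i (λ _ → i′≢i)
      (λ { (here x≈) → zero , sym x≈ }))

  separated⇒r≡1 : Separated → r_K≡ 1
  separated⇒r≡1 separated (α , α∈R) = record
    { to        = λ _ → α , α∈R , id , id
    ; cong      = λ _ → refl
    ; bijective = (λ { {zero} {zero} _ → ≡.refl }) , λ (x , x∈R , Kx≐Kα) → zero , λ _ →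
        let i , eq = ρ-complete x∈R; i′ , eq′ = ρ-complete α∈R
        in trans (sym eq′) (trans (reflexive (≡.cong ρ (≡.sym (separated
             (≐-trans (Kᴸ-cong eq) (≐-trans Kx≐Kα (Kᴸ-cong (sym eq′)))))))) eq) }

  r≡1⇒separated : r_K≡ 1 → Separated
  r≡1⇒separated r≡1 {i} {i′} Ki≐Ki′ = ρ-injective (trans (sym (proj₂ l)) (trans (bij.cong (only (proj₁ l) (proj₁ l′))) (proj₂ l′)))
    where
    module bij = Bijection (r≡1 (ρ i , ρ-root i))
    l  = bij.strictlySurjective (ρ i  , ρ-root i  , id , id)
    l′ = bij.strictlySurjective (ρ i′ , ρ-root i′ , ≐-sym Ki≐Ki′)
    only : (x y : Fin 1) → x ≡ y
    only zero zero = ≡.refl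

  -- With singleton clusters any ordering of the roots orders a set of representatives, so towers
  -- with prescribed beginnings exist.
  arrangedClusters : Separated → (τ : Fin n → Fin n) → Inj τ → s_K≡ n
  arrangedClusters separated τ τ-inj = record
    { to        = λ i → ρ (τ i) , ρ-root (τ i)
    ; cong      = λ { ≡.refl → id , id }
    ; bijective = τ-inj ∘ separated , λ (α , α∈R) →
        let i , ρi≈α = ρ-complete α∈R; l , τl≡i = injective⇒surjective τ τ-inj i
        in l , λ { ≡.refl → Kᴸ-cong (trans (reflexive (≡.cong ρ τl≡i)) ρi≈α) } }

-- Cluster towers and their degrees: condition (4).

module Towers (em : ∀ {a} → ExcludedMiddle a)
              {c ℓ₁ ℓ₂ c′ ℓ₁′ ℓ₂′ : Level}
              (K : HeytingField c ℓ₁ ℓ₂) (C : AlgebraicClosure K c′ ℓ₁′ ℓ₂′)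
              (f : Polynomial.Poly (fieldRing K))
              (irreducible : Polynomial.Irreducible (fieldRing K) f)
              (separable : Polynomial.Separable (fieldRing K) f)
              (n : ℕ) (degree : Polynomial.HasDegree (fieldRing K) f n)
              (k : ℕ) (k<n : k < n) where
  open Classical em
  open AlgebraicClosure C
  open CommutativeRing (fieldRing K̄) hiding (zero)
  open Expressions em K C
  open LinearAlgebra em K C using (Basis; basis-unit; basis-step; basis⇒degree)
  open SplittingField em K C f irreducible separable n degree
  open Conjugates em K C f irreducible separable n degree
  open Clusters em K C f irreducible separable n degree k k<n
  open Roots C f
  open Data.List.Membership.Setoid setoid using () renaming (_∈_ to _∈ᴸ_)

  degree-cong : ∀ {F G : Field} → F ≐ G → [ F :K]≡ m → [ G :K]≡ m
  degree-cong (F⊆G , G⊆F) deg = record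
    { basis = basis ; basis∈L = λ i → F⊆G (basis∈L i) ; independent = independent ; spanning = λ y∈ → spanning (G⊆F y∈) }
    where open [_:K]≡_ deg

  -- The map `F` absorbs the entries already passed: after one step the rest is again a chain, for
  -- `F ∘ (r zero ∷_)`.
  Chain : (List Carrier → Field) → (Fin m → Carrier) → List Field
  Chain F r = map F (inits (tabulate r))

  chain-suc : ∀ (F : List Carrier → Field) (r : Fin (suc m) → Carrier) →
              Chain F r ≡ F [] ∷ Chain (F ∘ (r zero ∷_)) (r ∘ suc)
  chain-suc F r = ≡.cong (λ Fs → F [] ∷ F [ r zero ] ∷ Fs) (≡.sym (Listₚ.map-∘ _))

  -- `F p` is K(γ, p). In the recursions below γ keeps only the passed entries that enlarged the
  -- field, so that it can carry a basis; `adjoins-member` skips an entry that did not.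
  Adjoins : (List Carrier → Field) → Tuple j → Set _
  Adjoins F γ = ∀ p → F p ≐ K⟨ (λ x → (∃ λ l → γ l ≈ x) ⊎ x ∈ᴸ p) ⟩

  adjoins-degree : ∀ {F} {γ : Tuple j} → Adjoins F γ → Basis γ m → [ F [] :K]≡ m
  adjoins-degree {γ = γ} adj basis = degree-cong (≐-sym (adj []))
    (basis⇒degree {γ = γ} (λ i → inj₁ (i , refl)) (λ { (inj₁ hit) → hit }) basis)

  adjoins-suc : ∀ {F} {γ : Tuple j} {x} → Adjoins F γ → Adjoins (F ∘ (x ∷_)) (x ∷ᶠ γ)
  adjoins-suc adj p = ≐-trans (adj _)
    ( adjoin-least (λ { (inj₁ (l , eq)) → gen (inj₁ (suc l , eq))
                      ; (inj₂ (here eq)) → gen (inj₁ (zero , sym eq))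
                      ; (inj₂ (there y∈p)) → gen (inj₂ y∈p) })
    , adjoin-least (λ { (inj₁ (zero , eq)) → gen (inj₂ (here (sym eq)))
                      ; (inj₁ (suc l , eq)) → gen (inj₁ (l , eq))
                      ; (inj₂ y∈p) → gen (inj₂ (there y∈p)) }) )

  adjoins-member : ∀ {F} {γ : Tuple j} {x} → Adjoins F γ → x ∈ F [] → Adjoins (F ∘ (x ∷_)) γ
  adjoins-member adj x∈ p = ≐-trans (adj _)
    ( adjoin-least (λ { (inj₁ hit) → gen (inj₁ hit)
                      ; (inj₂ (here eq)) → resp (sym eq)
                          (adjoin-least (λ { (inj₁ hit) → gen (inj₁ hit) }) (proj₁ (adj []) x∈))
                      ; (inj₂ (there y∈p)) → gen (inj₂ y∈p) })
    , adjoin-least (λ { (inj₁ hit) → gen (inj₁ hit) ; (inj₂ y∈p) → gen (inj₂ (there y∈p)) }) )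

  adjoins-⊆ : ∀ {F} {γ : Tuple j} {x} → Adjoins F γ → F [] ⊆ F [ x ]
  adjoins-⊆ adj y∈ = proj₂ (adj _) (adjoin-least (λ { (inj₁ hit) → gen (inj₁ hit) }) (proj₁ (adj []) y∈))

  Degrees : List Field → List ℕ → Set _
  Degrees Fs ds = ∃ λ Ls → StrictSteps Fs Ls × Pointwise [_:K]≡_ Ls ds

  degrees-equal : ∀ {F} {r : Fin (suc m) → Carrier} {ds} → F [] ≐ F [ r zero ] →
                  Degrees (Chain (F ∘ (r zero ∷_)) (r ∘ suc)) ds → Degrees (Chain F r) ds
  degrees-equal {F = F} {r} F≐ (Ls , steps , degs) =
    Ls , ≡.subst (λ Fs → StrictSteps Fs Ls) (≡.sym (chain-suc F r)) (equal F≐ steps) , degs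

  degrees-strict : ∀ {F} {r : Fin (suc m) → Carrier} {d ds} → F [] ⊂ F [ r zero ] → [ F [ r zero ] :K]≡ d →
                   Degrees (Chain (F ∘ (r zero ∷_)) (r ∘ suc)) ds → Degrees (Chain F r) (d ∷ ds)
  degrees-strict {F = F} {r} F⊂ deg (Ls , steps , degs) =
    F [ r zero ] ∷ Ls ,
    ≡.subst (λ Fs → StrictSteps Fs (F [ r zero ] ∷ Ls)) (≡.sym (chain-suc F r)) (strict F⊂ steps) ,
    deg ∷ degs

  head∈ : ∀ {F} {γ : Tuple j} {x} → Adjoins F γ → x ∈ F [ x ]
  head∈ adj = proj₂ (adj _) (gen (inj₂ (here refl)))

  -- Beyond the first k steps the degrees are not known, but a degree sequence must cover the whole
  -- tower: each step is either trivial or extends the basis by a minimal relation.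
  degreeSequence : ∀ {d} F (γ : Tuple j) → Adjoins F γ → Basis γ d → (r : Fin m → Carrier) → (∀ l → r l ∈ R) →
                   ∃ (Degrees (Chain F r))
  degreeSequence {m = zero}  F γ adj basis r r∈R = [] , [] , done , []
  degreeSequence {m = suc m} F γ adj basis r r∈R with dec (r zero ∈ F [])
  ... | yes x∈ =
    let ds , degs = degreeSequence (F ∘ (r zero ∷_)) γ (adjoins-member adj x∈) basis (r ∘ suc) (r∈R ∘ suc)
    in ds , degrees-equal {r = r} (adjoins-⊆ adj , λ y∈ → proj₂ (adj []) (adjoin-least
         (λ { (inj₁ hit) → gen (inj₁ hit) }) (proj₁ (adjoins-member adj x∈ []) y∈))) degs
  ... | no x∉ =
    let d , u , root , powers = minimalRelation γ (r zero) (n , con ∘ fᵐ , fᵐ-root (r∈R zero))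
        basis′ = basis-step {γ = γ} u root powers basis
        adj′ = adjoins-suc adj
        ds , degs = degreeSequence (F ∘ (r zero ∷_)) (r zero ∷ᶠ γ) adj′ basis′ (r ∘ suc) (r∈R ∘ suc)
    in _ , degrees-strict {r = r} (adjoins-⊆ adj , λ F⊆ → x∉ (F⊆ (head∈ adj)))
             (adjoins-degree adj′ basis′) degs

  -- The values, at positions from j on, of a permutation extending `a`.
  complement : (a : Fin j → Fin n) → Inj a → ∃ λ (r : Fin (n ∸ j) → Fin n) → Inj r × (∀ l l′ → a l ≢ r l′)
  complement {j} a a-inj = (λ l → π (Fin.cast eq (j ↑ʳ l))) ,
    (λ e → Finₚ.↑ʳ-injective j _ _ (Finₚ.toℕ-injective (≡.trans (≡.sym (Finₚ.toℕ-cast eq _))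
      (≡.trans (≡.cong Fin.toℕ (π-inj e)) (Finₚ.toℕ-cast eq _))))) ,
    λ l l′ e → ℕₚ.<⇒≢ (ℕₚ.<-≤-trans (Finₚ.toℕ<n l) (ℕₚ.m≤m+n j (Fin.toℕ l′)))
      (≡.trans (≡.sym (Finₚ.toℕ-inject≤ l j≤n))
        (≡.trans (≡.cong Fin.toℕ (π-inj (≡.trans (π-extends j≤n l) e)))
          (≡.trans (Finₚ.toℕ-cast eq (j ↑ʳ l′)) (Finₚ.toℕ-↑ʳ j l′))))
    where
    j≤n = Finₚ.injective⇒≤ a-inj
    eq = ℕₚ.m+[n∸m]≡n j≤n
    extended = extend a a-inj
    π = proj₁ extended
    π-inj = proj₁ (proj₂ extended)
    π-extends = proj₂ (proj₂ extended)

  -- A polynomial over K(a) vanishing at one root outside a vanishes at all n − j of them.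
  powers-independent : Homogeneous k → (a : Fin j → Fin n) → Inj a → j < k → ∀ i → (∀ l → a l ≢ i) →
                       PowersIndependent (n ∸ j) (ρ ∘ a) (ρ i)
  powers-independent {j} hom a a-inj j<k i a≢i v vρi≈0 = roots⇒zero (eval (ρ ∘ a) ∘ v) (ρ ∘ r)
    (proj₁ (proj₂ (complement a a-inj)) ∘ ρ-injective) vanishes
    where
    r = proj₁ (complement a a-inj)
    e : Expr (suc j)
    e = E.horner (con K.0#) (rename suc ∘ v) (var zero)
      where module E = Horner {A = Expr (suc j)} _⊕_ _⊗_
    eval-e : ∀ i → eval (ρ ∘ (i ∷ᶠ a)) e ≈ horner 0# (eval (ρ ∘ a) ∘ v) (ρ i)
    eval-e i = trans (reflexive (eval-horner (ρ ∘ (i ∷ᶠ a)) (con K.0#) (rename suc ∘ v) (var zero)))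
      (horner-cong _ (eval (ρ ∘ a) ∘ v) ι.0#-homo (λ l → reflexive (eval-rename (ρ ∘ (i ∷ᶠ a)) suc (v l))) refl)
    vanishes : ∀ l → horner 0# (eval (ρ ∘ a) ∘ v) (ρ (r l)) ≈ 0#
    vanishes l =
      let r≢a = λ l′ → proj₂ (proj₂ (complement a a-inj)) l′ l
          π , (_ , spec) , agrees = homogeneous-≤ hom j<k (i ∷ᶠ a) (r l ∷ᶠ a)
            (∷-injective a≢i a-inj) (∷-injective r≢a a-inj)
      in trans (sym (eval-e (r l))) (trans
           (sym (eval-cong (λ l′ → reflexive (≡.cong ρ (agrees l′))) e))
           (spec-rename spec (i ∷ᶠ a) e (trans (eval-e i) vρi≈0)))

  independent-cong : ∀ {d} {γ γ′ : Tuple j} {δ δ′} → (∀ l → γ l ≈ γ′ l) → δ ≈ δ′ →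
                     PowersIndependent d γ δ → PowersIndependent d γ′ δ′
  independent-cong {γ = γ} {γ′} {δ} γ≈γ′ δ≈δ′ powers v eq i = trans (sym (eval-cong γ≈γ′ (v i)))
    (powers v (trans (horner-cong (eval γ ∘ v) (eval γ′ ∘ v) refl (λ l → eval-cong γ≈γ′ (v l)) δ≈δ′) eq) i)

  root-cong : ∀ {d} (u : Fin d → Expr j) {γ γ′ : Tuple j} {δ δ′} → (∀ l → γ l ≈ γ′ l) → δ ≈ δ′ →
              IsRoot u γ δ → IsRoot u γ′ δ′
  root-cong u {γ} {γ′} γ≈γ′ δ≈δ′ root = trans
    (sym (horner-cong (eval γ ∘ u) (eval γ′ ∘ u) refl (λ l → eval-cong γ≈γ′ (u l)) δ≈δ′)) root

  -- After j entries, d = k - j steps still have prescribed degrees; then `degreeSequence` takes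
  -- over. `γ` is kept beside `ρ ∘ a` because representatives match roots only up to `_≈_`, and `g`
  -- is the degree function shifted as `applyUpTo` shifts it.
  homogeneous-degrees : Homogeneous k → ∀ d F (a : Fin j → Fin n) (γ : Tuple j) → (∀ l → ρ (a l) ≈ γ l) →
    Adjoins F γ → Basis γ (n P j) → (b : Fin m → Fin n) (r : Fin m → Carrier) → (∀ l → ρ (b l) ≈ r l) →
    Inj a → Inj b → (∀ l l′ → a l ≢ b l′) → j +ᴺ d ≡ k → d ≤ m →
    (g : ℕ → ℕ) → (∀ i → g i ≡ n P suc (j +ᴺ i)) →
    ∃ λ ds → Degrees (Chain F r) ds × take d ds ≡ applyUpTo g d
  homogeneous-degrees hom zero F a γ a≈γ adj basis b r b≈r a-inj b-inj a≢b j+d≡k _ g g≡ =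
    let ds , degs = degreeSequence F γ adj basis r λ l → root-≈ (b≈r l) (ρ-root (b l)) in ds , degs , ≡.refl
    where
    root-≈ : ∀ {x y} → x ≈ y → x ∈ R → y ∈ R
    root-≈ {x} {y} x≈y fx≈0 = fᵐ-root⁻¹ (trans (horner-congʳ 1# (ι ∘ fᵐ) (sym x≈y)) (fᵐ-root fx≈0))
  homogeneous-degrees {j} {suc m} hom (suc d) F a γ a≈γ adj basis b r b≈r a-inj b-inj a≢b j+d≡k (s≤s d≤m) g g≡ =
    let ds , degs , eq = homogeneous-degrees hom d (F ∘ (r zero ∷_)) (b zero ∷ᶠ a) (r zero ∷ᶠ γ)
          (λ { zero → b≈r zero ; (suc l) → a≈γ l }) adj′ basis′ (b ∘ suc) (r ∘ suc) (b≈r ∘ suc)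
          (∷-injective (λ l → a≢b l zero) a-inj) (Finₚ.suc-injective ∘ b-inj)
          (λ { zero l′ eq → contradiction (b-inj eq) (λ ()) ; (suc l) l′ → a≢b l (suc l′) })
          (≡.trans (≡.sym (ℕₚ.+-suc j d)) j+d≡k) d≤m (g ∘ suc)
          (λ i → ≡.trans (g≡ (suc i)) (≡.cong (λ z → n P suc z) (ℕₚ.+-suc j i)))
    in _ , degrees-strict {r = r} (adjoins-⊆ adj , λ F⊆ → x∉ (F⊆ (head∈ adj)))
             (adjoins-degree adj′ basis′) degs ,
       ≡.cong₂ _∷_ (≡.sym (≡.trans (g≡ 0) (≡.cong (λ z → n P suc z) (ℕₚ.+-identityʳ j)))) eq
    where
    j<k : j < k
    j<k = ≡.subst (j <_) j+d≡k (ℕₚ.m<m+n j (s≤s z≤n))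
    j<n = ℕₚ.<-trans j<k k<n
    relation = remaining j (ℕₚ.m+[n∸m]≡n (ℕₚ.<⇒≤ j<n))
    adj′ : Adjoins (F ∘ (r zero ∷_)) (r zero ∷ᶠ γ)
    adj′ = adjoins-suc adj
    basis′ : Basis (r zero ∷ᶠ γ) (n P suc j)
    basis′ = ≡.subst (Basis (r zero ∷ᶠ γ)) (≡.sym (P-suc j<n)) (basis-step {γ = γ} (proj₁ relation)
      (root-cong (proj₁ relation) a≈γ (b≈r zero) (proj₂ relation a a-inj (b zero) λ l → a≢b l zero))
      (independent-cong a≈γ (b≈r zero) (powers-independent hom a a-inj j<k (b zero) λ l → a≢b l zero)) basis)
    x∉ : r zero ∉ F []
    x∉ x∈ = not-generated hom a a-inj j<k (b zero) (λ l → a≢b l zero)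
      (λ { (inj₁ (l , eq)) → l , trans (a≈γ l) eq }) (resp (sym (b≈r zero)) (proj₁ (adj []) x∈))

  module _ (T : ClusterTower) where
    open ClusterTower T using (s; ordering)
    private module T = Bijection ordering

    representative : Fin s → Carrier
    representative = proj₁ ∘ T.to

    place : ∀ l → ∃ λ i → ρ i ≈ representative l
    place l = ρ-complete (proj₂ (T.to l))

    place-injective : Inj (proj₁ ∘ place)
    place-injective {l} {l′} eq = T.injective (Kᴸ-cong (trans (sym (proj₂ (place l)))
      (trans (reflexive (≡.cong ρ eq)) (proj₂ (place l′)))))

    -- If s < k, a root outside the representatives would lie in the field of the representative of
    -- its own cluster, against `not-generated`. So a tower has enough steps for k degrees.
    many-clusters : Homogeneous k → k ≤ s
    many-clusters hom = ℕₚ.≮⇒≥ λ s<k →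
      let i , new = avoided (proj₁ ∘ place) (ℕₚ.<-trans s<k k<n)
          l , K≐ = T.strictlySurjective (ρ i , ρ-root i)
      in not-generated hom (proj₁ ∘ place) place-injective s<k i new {B = Range (proj₁ ∘ place)} id
           (adjoin-least (λ { (here eq) → gen (l , trans (proj₂ (place l)) (sym eq)) }) (proj₂ K≐ (gen (here refl))))

    tower-degrees : Homogeneous k →
      ∃ λ ds → HasDegreeSequence T ds × take k ds ≡ applyUpTo (λ i → n P suc i) k
    tower-degrees hom = homogeneous-degrees hom k Kᴸ⟨_⟩ (λ ()) (λ ()) (λ ())
      (λ p → adjoin-least (gen ∘ inj₂) , adjoin-least λ { (inj₁ (() , _)) ; (inj₂ x∈p) → gen x∈p })
      (basis-unit λ ()) (proj₁ ∘ place) representative (proj₂ ∘ place)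
      (λ { {()} }) place-injective (λ ()) ≡.refl (many-clusters hom) (λ i → n P suc i) (λ _ → ≡.refl)

    tower-length : Homogeneous k → ∃ λ m → HasLength T m × k ≤ m
    tower-length hom =
      let ds , (Ls , steps , degs) , eq = tower-degrees hom
      in length Ls , (Ls , steps , ≡.refl) , (begin
        k                                         ≡⟨ Listₚ.length-applyUpTo (λ i → n P suc i) k ⟨
        length (applyUpTo (λ i → n P suc i) k)    ≡⟨ ≡.cong length eq ⟨
        length (take k ds)                        ≡⟨ Listₚ.length-take k ds ⟩
        k ⊓ length ds                             ≤⟨ ℕₚ.m⊓n≤n k (length ds) ⟩
        length ds                                 ≡⟨ Pointwiseₚ.Pointwise-length degs ⟨
        length Ls                                 ∎)
      where open ℕₚ.≤-Reasoning

  -- If the next entries differed, equality of the fields would put one of them into the field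
  -- generated by `a` and the other, and `not-generated` excludes this when suc j < k. Thus k - 1
  -- entries can be read off from a tower, which is the origin of the bound nPₖ₋₁.
  same-start : Homogeneous k → ∀ d F F′ (a : Fin j → Fin n) → Adjoins F (ρ ∘ a) → Adjoins F′ (ρ ∘ a) →
    (b b′ : Fin m → Fin n) → Inj a → Inj b → Inj b′ → (∀ l l′ → a l ≢ b l′) → (∀ l l′ → a l ≢ b′ l′) →
    j +ᴺ d < k → Pointwise _≐_ (Chain F (ρ ∘ b)) (Chain F′ (ρ ∘ b′)) →
    ∀ l → Fin.toℕ l < d → b l ≡ b′ l
  same-start {j} {suc m} hom (suc d) F F′ a adj adj′ b b′ a-inj b-inj b′-inj a≢b a≢b′ j+d<k eqs = go
    (≡.subst₂ (Pointwise _≐_) (chain-suc F (ρ ∘ b)) (chain-suc F′ (ρ ∘ b′)) eqs)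
    where
    adjoins-cons : ∀ {F} i → Adjoins F (ρ ∘ a) → Adjoins (F ∘ (ρ i ∷_)) (ρ ∘ (i ∷ᶠ a))
    adjoins-cons i adj p = ≐-trans (adjoins-suc adj p)
      ( adjoin-least (λ { (inj₁ (zero , eq)) → gen (inj₁ (zero , eq)) ; (inj₁ (suc l , eq)) → gen (inj₁ (suc l , eq))
                        ; (inj₂ y∈p) → gen (inj₂ y∈p) })
      , adjoin-least (λ { (inj₁ (zero , eq)) → gen (inj₁ (zero , eq)) ; (inj₁ (suc l , eq)) → gen (inj₁ (suc l , eq))
                        ; (inj₂ y∈p) → gen (inj₂ y∈p) }) )
    1+j<k : suc j < k
    1+j<k = ℕₚ.≤-<-trans (≡.subst (suc j ≤_) (≡.sym (ℕₚ.+-suc j d)) (s≤s (ℕₚ.m≤m+n j d))) j+d<k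
    head≡ : F [ ρ (b zero) ] ≐ F′ [ ρ (b′ zero) ] → b zero ≡ b′ zero
    head≡ (_ , F′⊆) = byContradiction λ b≢b′ → not-generated hom (b zero ∷ᶠ a)
      (∷-injective (λ l → a≢b l zero) a-inj) 1+j<k (b′ zero)
      (λ { zero → b≢b′ ; (suc l) → a≢b′ l zero })
      (λ { (inj₁ hit) → hit }) (proj₁ (adjoins-cons (b zero) adj []) (F′⊆ (head∈ adj′)))
    go : Pointwise _≐_ (F [] ∷ Chain (F ∘ (ρ (b zero) ∷_)) (ρ ∘ b ∘ suc))
                       (F′ [] ∷ Chain (F′ ∘ (ρ (b′ zero) ∷_)) (ρ ∘ b′ ∘ suc)) →
         ∀ l → Fin.toℕ l < suc d → b l ≡ b′ l
    go (_ ∷ eq ∷ _)    zero    _         = head≡ eq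
    go (_ ∷ eqs@(eq ∷ _)) (suc l) (s≤s l<d) = same-start hom d
      (F ∘ (ρ (b zero) ∷_)) (F′ ∘ (ρ (b′ zero) ∷_)) (b zero ∷ᶠ a) (adjoins-cons (b zero) adj)
      (≡.subst (λ i → Adjoins (F′ ∘ (ρ (b′ zero) ∷_)) (ρ ∘ (i ∷ᶠ a))) (≡.sym (head≡ eq)) (adjoins-cons (b′ zero) adj′))
      (b ∘ suc) (b′ ∘ suc) (∷-injective (λ l → a≢b l zero) a-inj) (Finₚ.suc-injective ∘ b-inj) (Finₚ.suc-injective ∘ b′-inj)
      (λ { zero l′ e → contradiction (b-inj e) (λ ()) ; (suc l) l′ → a≢b l (suc l′) })
      (λ { zero l′ e → contradiction (b′-inj (≡.trans (≡.sym (head≡ eq)) e)) (λ ()) ; (suc l) l′ → a≢b′ l (suc l′) })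
      (≡.subst (_< k) (ℕₚ.+-suc j d) j+d<k) eqs l l<d

  many-towers : Homogeneous k → 0 < k → HasAtLeast (n P (k ∸ 1)) clusterTowers
  many-towers hom 0<k with 2 ℕₚ.≤? k
  -- For k = 1 clusters may contain several roots, but n P 0 = 1 and any one tower is enough.
  ... | no  k≱2 = ≡.subst (λ k → HasAtLeast (n P (k ∸ 1)) clusterTowers) 1≡k record
    { to        = λ _ → tower
    ; cong      = λ _ → Setoid.refl clusterTowers {tower}
    ; injective = λ { {zero} {zero} _ → ≡.refl } }
    where
    1≡k : 1 ≡ k
    1≡k = ℕₚ.≤-antisym 0<k (ℕₚ.≤-pred (ℕₚ.≰⇒> k≱2))
    tower : ClusterTower
    tower = record { ordering = proj₂ (covered⇒finite clusters (λ i → ρ i , ρ-root i)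
      λ (α , α∈R) → let i , eq = ρ-complete α∈R in i , Kᴸ-cong eq) }
  ... | yes 2≤k = record
    { to        = tower
    ; cong      = λ { {x} ≡.refl → Setoid.refl clusterTowers {tower x} }
    ; injective = λ {x} {y} eqs → ≡.subst-injective (P≡P′ k-1≤n) (arrangement-distinct n (k ∸ 1) _ _ λ l →
        ≡.trans (≡.sym (τ-extends x l)) (≡.trans
          (same-start hom (k ∸ 1) Kᴸ⟨_⟩ Kᴸ⟨_⟩ (λ ()) adjoins adjoins (τ x) (τ y)
            (λ { {()} }) (τ-inj x) (τ-inj y) (λ ()) (λ ()) k-1<k eqs (inject≤ l k-1≤n)
            (≡.subst (_< k ∸ 1) (≡.sym (Finₚ.toℕ-inject≤ l k-1≤n)) (Finₚ.toℕ<n l)))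
          (τ-extends y l))) }
    where
    k-1<k : k ∸ 1 < k
    k-1<k = ℕₚ.∸-monoʳ-< {k} {1} {0} (s≤s z≤n) 0<k
    k-1≤n : k ∸ 1 ≤ n
    k-1≤n = ℕₚ.≤-trans (ℕₚ.<⇒≤ k-1<k) k≤n
    adjoins : ∀ {γ : Tuple 0} → Adjoins Kᴸ⟨_⟩ γ
    adjoins p = adjoin-least (gen ∘ inj₂) , adjoin-least λ { (inj₁ (() , _)) ; (inj₂ x∈p) → gen x∈p }
    code : Fin (n P (k ∸ 1)) → Fin (n P′ (k ∸ 1))
    code = ≡.subst Fin (P≡P′ k-1≤n)
    extended : ∀ x → _
    extended x = extend (arrangement n (k ∸ 1) (code x)) (arrangement-injective n (k ∸ 1) (code x))
    τ : Fin (n P (k ∸ 1)) → Fin n → Fin n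
    τ x = proj₁ (extended x)
    τ-inj : ∀ x → Inj (τ x)
    τ-inj x = proj₁ (proj₂ (extended x))
    τ-extends : ∀ x l → τ x (inject≤ l k-1≤n) ≡ arrangement n (k ∸ 1) (code x) l
    τ-extends x = proj₂ (proj₂ (extended x)) k-1≤n
    tower : Fin (n P (k ∸ 1)) → ClusterTower
    tower x = record { ordering = arrangedClusters (homogeneous⇒separated hom 2≤k) (τ x) (τ-inj x) }

-- The converse: degrees along chosen towers.

module Converse (em : ∀ {a} → ExcludedMiddle a)
                {c ℓ₁ ℓ₂ c′ ℓ₁′ ℓ₂′ : Level}
                (K : HeytingField c ℓ₁ ℓ₂) (C : AlgebraicClosure K c′ ℓ₁′ ℓ₂′)
                (f : Polynomial.Poly (fieldRing K))
                (irreducible : Polynomial.Irreducible (fieldRing K) f)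
                (separable : Polynomial.Separable (fieldRing K) f)
                (n : ℕ) (degree : Polynomial.HasDegree (fieldRing K) f n)
                (k : ℕ) (0<k : 0 < k) (k<n : k < n) where
  open AlgebraicClosure C
  open CommutativeRing (fieldRing K̄) hiding (zero)
  open Expressions em K C
  open SplittingField em K C f irreducible separable n degree
  open Conjugates em K C f irreducible separable n degree
  open Clusters em K C f irreducible separable n degree k k<n
  open Towers em K C f irreducible separable n degree k k<n
  open Roots C f
  open Data.List.Membership.Setoid setoid using () renaming (_∈_ to _∈ᴸ_)

  -- A degree sequence records strict steps only. As the first d + 1 steps are proper, its entry d
  -- belongs to the field after d + 1 adjunctions and not to a later one.
  degreeAt : ∀ d F (r : Fin m → Carrier) {ds} g → Degrees (Chain F r) ds → d < m →
    take (suc d) ds ≡ applyUpTo g (suc d) →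
    (∀ i → i ≤ d → ¬ (F (take (suc i) (tabulate r)) ⊆ F (take i (tabulate r)))) →
    [ F (take (suc d) (tabulate r)) :K]≡ g d
  degreeAt {suc m} d F r g (Ls , steps , degs) (s≤s d≤m) eq proper =
    go (≡.subst (λ Fs → StrictSteps Fs Ls) (chain-suc F r) steps) degs eq
    where
    go : ∀ {Ls ds} → StrictSteps (F [] ∷ Chain (F ∘ (r zero ∷_)) (r ∘ suc)) Ls → Pointwise [_:K]≡_ Ls ds →
         take (suc d) ds ≡ applyUpTo g (suc d) → [ F (take (suc d) (tabulate r)) :K]≡ g d
    go (equal (_ , L⊆F) _) _ _ = contradiction (λ {x} → L⊆F {x}) (proper 0 z≤n)
    go (strict _ steps) (deg ∷ degs) eq = last d d≤m proper (Listₚ.∷-injective eq)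
      where
      last : ∀ d → d ≤ m → (∀ i → i ≤ d → ¬ (F (take (suc i) (tabulate r)) ⊆ F (take i (tabulate r)))) →
             _ ≡ g 0 × take d _ ≡ applyUpTo (g ∘ suc) d → [ F (take (suc d) (tabulate r)) :K]≡ g d
      last zero    _   _      (eq , _)  = ≡.subst [ F [ r zero ] :K]≡_ eq deg
      last (suc d) d<m proper (_  , eq) =
        degreeAt d (F ∘ (r zero ∷_)) (r ∘ suc) (g ∘ suc) (_ , steps , degs) d<m eq λ i i≤d → proper (suc i) (s≤s i≤d)

  ∈-take⁺ : ∀ (r : Fin m → Carrier) l i → Fin.toℕ l < i → r l ∈ᴸ take i (tabulate r)
  ∈-take⁺ r zero    (suc i) _         = here refl
  ∈-take⁺ r (suc l) (suc i) (s≤s l<i) = there (∈-take⁺ (r ∘ suc) l i l<i)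

  ∈-take⁻ : ∀ (r : Fin m → Carrier) i {x} → x ∈ᴸ take i (tabulate r) → ∃ λ l → Fin.toℕ l < i × r l ≈ x
  ∈-take⁻ {suc m} r (suc i) (here eq)  = zero , s≤s z≤n , sym eq
  ∈-take⁻ {suc m} r (suc i) (there x∈) = let l , l<i , eq = ∈-take⁻ (r ∘ suc) i x∈ in suc l , s≤s l<i , eq

  module _ (irredundant : ∀ D → CardinalityAtMost k D → ∀ δ → δ ∈ member D → δ ∉ K⟨ D ∖ δ ⟩)
           (separated : Separated)
           (degrees : ∀ T → ∃ λ ds → HasDegreeSequence T ds × take k ds ≡ applyUpTo (λ i → n P suc i) k)
           where

    module _ (a : Fin k → Fin n) (a-inj : Inj a) where

      π : Fin n → Fin n
      π = proj₁ (extend a a-inj)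

      π-extends : ∀ l → π (inject≤ l k≤n) ≡ a l
      π-extends = proj₂ (proj₂ (extend a a-inj)) k≤n

      tower : ClusterTower
      tower = record { ordering = arrangedClusters separated π (proj₁ (proj₂ (extend a a-inj))) }

      step : ℕ → List Carrier
      step i = take i (tabulate (ρ ∘ π))

      step⊆ : ∀ {i x} → i ≤ k → x ∈ᴸ step i → ∃ λ l → Fin.toℕ l < i × ρ (a l) ≈ x
      step⊆ {i} i≤k x∈ =
        let l , l<i , eq = ∈-take⁻ (ρ ∘ π) i x∈
            l<k = ℕₚ.<-≤-trans l<i i≤k
            l≡ = Finₚ.toℕ-injective (≡.trans (Finₚ.toℕ-inject≤ (Fin.fromℕ< l<k) k≤n) (Finₚ.toℕ-fromℕ< l<k))
        in Fin.fromℕ< l<k , ≡.subst (_< i) (≡.sym (Finₚ.toℕ-fromℕ< l<k)) l<i ,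
           trans (reflexive (≡.cong ρ (≡.trans (≡.sym (π-extends _)) (≡.cong π l≡)))) eq

      small : CardinalityAtMost k (rangeSubset a)
      small = k , record
        { to        = λ l → ρ (a l) , lift (l , refl)
        ; cong      = λ { ≡.refl → refl }
        ; bijective = a-inj ∘ ρ-injective , λ { (x , lift (l , eq)) → l , λ { ≡.refl → eq } } } , ℕₚ.≤-refl

      -- Irredundance of the whole set of k entries suffices: the entries before position i lie
      -- among those other than `ρ (a l)`.
      proper : ∀ i → i < k → ¬ (Kᴸ⟨ step (suc i) ⟩ ⊆ Kᴸ⟨ step i ⟩)
      proper i i<k ⊆Fᵢ = irredundant (rangeSubset a) small (ρ (a l)) (lift (l , refl))
        (adjoin-least others (⊆Fᵢ (gen member-l)))
        where
        l = Fin.fromℕ< i<k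
        member-l : ρ (a l) ∈ᴸ step (suc i)
        member-l = ≡.subst (λ z → ρ z ∈ᴸ step (suc i)) (π-extends l)
          (∈-take⁺ (ρ ∘ π) (inject≤ l k≤n) (suc i) (s≤s (ℕₚ.≤-reflexive
            (≡.trans (Finₚ.toℕ-inject≤ l k≤n) (Finₚ.toℕ-fromℕ< i<k)))))
        others : ∀ {x} → x ∈ᴸ step i → x ∈ K⟨ rangeSubset a ∖ ρ (a l) ⟩
        others x∈ = let l′ , l′<i , eq = step⊆ (ℕₚ.<⇒≤ i<k) x∈ in gen (lift (l′ , eq) , λ x≈ρal →
          ℕₚ.<⇒≢ l′<i (≡.trans (≡.cong Fin.toℕ (a-inj (ρ-injective (trans eq x≈ρal)))) (Finₚ.toℕ-fromℕ< i<k)))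

      degree-top : [ Kᴸ⟨ step k ⟩ :K]≡ (n P k)
      degree-top with degrees tower
      ... | ds , degs , eq = ≡.subst (λ i → [ Kᴸ⟨ step i ⟩ :K]≡ (n P i)) 1+[k-1]≡k
        -- Entry k - 1 of the sequence, counted from 0, is the degree after k steps; 0 < k turns
        -- `suc (k ∸ 1)` into k.
        (degreeAt (k ∸ 1) Kᴸ⟨_⟩ (ρ ∘ π) (λ i → n P suc i) degs (≡.subst (_≤ n) (≡.sym 1+[k-1]≡k) k≤n)
          (≡.subst (λ i → take i ds ≡ applyUpTo (λ i → n P suc i) i) (≡.sym 1+[k-1]≡k) eq)
          λ i i≤ → proper i (≡.subst (suc i ≤_) 1+[k-1]≡k (s≤s i≤)))
        where
        1+[k-1]≡k : suc (k ∸ 1) ≡ k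
        1+[k-1]≡k = ℕₚ.m+[n∸m]≡n 0<k

    homogeneous : Homogeneous k
    homogeneous a b a-inj b-inj = spec⇒permutation a b (degree⇒spec a b a-inj b-inj
      (toExpr (ρ ∘ a) λ x∈ → let l , _ , eq = step⊆ a a-inj ℕₚ.≤-refl x∈ in l , eq)
      (degree-top a a-inj))

-- Equivalence of transitivity with the four conditions.

module Equivalence (em : ∀ {a} → ExcludedMiddle a)
                   {c ℓ₁ ℓ₂ c′ ℓ₁′ ℓ₂′ : Level}
                   (K : HeytingField c ℓ₁ ℓ₂) (C : AlgebraicClosure K c′ ℓ₁′ ℓ₂′)
                   (f : Polynomial.Poly (fieldRing K))
                   (irreducible : Polynomial.Irreducible (fieldRing K) f)
                   (separable : Polynomial.Separable (fieldRing K) f)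
                   (n : ℕ) (degree : Polynomial.HasDegree (fieldRing K) f n)
                   (k : ℕ) (0<k : 0 < k) (k<n : k < n) where
  open Conjugates em K C f irreducible separable n degree
  open Clusters em K C f irreducible separable n degree k k<n
  open Towers em K C f irreducible separable n degree k k<n
  open Converse em K C f irreducible separable n degree k 0<k k<n
  open Roots C f

  Condition₁ Condition₂ Condition₃ Condition₄ : Set _
  Condition₁ = ∀ B → MinimalGenerating B → CardinalityAtLeast k B
  Condition₂ = ∀ D → CardinalityAtMost k D →
    (∀ δ → δ ∈ member D → δ ∉ K⟨ D ∖ δ ⟩) × ∃ λ B → MinimalGenerating B × member D ⊆ member B
  Condition₃ = 2 ≤ k → r_K≡ 1 × s_K≡ n
  Condition₄ = (∀ T → ∃ λ m → HasLength T m × k ≤ m) ×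
    (∀ T → ∃ λ ds → HasDegreeSequence T ds × take k ds ≡ applyUpTo (λ i → n P suc i) k) ×
    HasAtLeast (n P (k ∸ 1)) clusterTowers

  forward₁ : Homogeneous k → Condition₁
  forward₁ hom B minimal = generating⇒large hom B (proj₁ minimal)

  forward₂ : Homogeneous k → Condition₂
  forward₂ hom D small = small⇒irredundant hom D small , small⇒extendable hom D small

  forward₃ : Homogeneous k → Condition₃
  forward₃ hom 2≤k = let separated = homogeneous⇒separated hom 2≤k in
    separated⇒r≡1 separated , arrangedClusters separated id id

  forward₄ : Homogeneous k → Condition₄
  forward₄ hom = (λ T → tower-length T hom) , (λ T → tower-degrees T hom) , many-towers hom 0<k

  backward : Condition₂ → Condition₃ → Condition₄ → Homogeneous k
  backward small-subsets trivial-clusters (_ , degrees , _) with 2 ℕₚ.≤? k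
  ... | yes 2≤k = homogeneous (λ D small → proj₁ (small-subsets D small))
                              (r≡1⇒separated (proj₁ (trivial-clusters 2≤k))) degrees
  ... | no  k≱2 = ≡.subst Homogeneous (ℕₚ.≤-antisym 0<k (ℕₚ.≤-pred (ℕₚ.≰⇒> k≱2))) homogeneous₁

  to : Transitive[ k ] → (Condition₁ × Condition₂ × Condition₃ × Condition₄)
  to transitive = forward₁ hom , forward₂ hom , forward₃ hom , forward₄ hom
    where
    hom : Homogeneous k
    hom = transitive⇒homogeneous transitive

  from : (Condition₁ × Condition₂ × Condition₃ × Condition₄) → Transitive[ k ]
  from (_ , c₂ , c₃ , c₄) = homogeneous⇒transitive (backward c₂ c₃ c₄)

  equivalence : Transitive[ k ] ⇔ (Condition₁ × Condition₂ × Condition₃ × Condition₄)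
  equivalence = record { to = to ; from = from ; to-cong = ≡.cong to ; from-cong = ≡.cong from }

theorem3p4 : (∀ {a} → ExcludedMiddle a) →
    ∀ {c ℓ₁ ℓ₂ c′ ℓ₁′ ℓ₂′ : Level}
    (K : HeytingField c ℓ₁ ℓ₂) (C : AlgebraicClosure K c′ ℓ₁′ ℓ₂′) →
    let open Polynomial (fieldRing K) in
    IsPerfect K →
    (f : Poly) → Irreducible f →
    (n : ℕ) → HasDegree f n → 2 < n →
    (k : ℕ) → 0 < k → k < n →
    let open Roots C f in
    Transitive[ k ] ⇔
    ( (∀ B → MinimalGenerating B → CardinalityAtLeast k B)
    × (∀ D → CardinalityAtMost k D →
    (∀ δ → δ ∈ member D → δ ∉ K⟨ D ∖ δ ⟩) ×
    ∃ λ B → MinimalGenerating B × member D ⊆ member B)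
    × (2 ≤ k → r_K≡ 1 × s_K≡ n)
    × ( (∀ T → ∃ λ m → HasLength T m × k ≤ m)
    × (∀ T → ∃ λ ds → HasDegreeSequence T ds ×
    take k ds ≡ applyUpTo (λ i → n P suc i) k)
    × HasAtLeast (n P (k ∸ 1)) clusterTowers))
theorem3p4 em K C perfect f irreducible n degree _ k 0<k k<n =
  Equivalence.equivalence em K C f irreducible (perfect f irreducible) n degree k 0<k k<n
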